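{- Let $t(n)=3^{\frac{n-1}{3}}+\frac{n-1}{3}$, and let $f_1,f_2$ be the functions defined in the context. (1) For every tree $T$ of order $n\geq 4$, \[\Phi(T)\leq 3^{\frac{n-1}{3}}+\frac{n-1}{3},\] with equality if and only if $n\equiv 1\pmod 3$ and $T\cong T^*_n$. (2) For every forest $F$ of order $n$ with $4\leq n\leq 6$: if $\Phi(F)<f_1(n)$, then $\Phi(F)\leq f_2(n)$. For every forest $F$ of order $n\geq 7$: if $\Phi(F)<f_1(n)$, then $\Phi(F)\leq f_2(n)$, with equality if and only if \begin{itemize} \item $F\cong \frac{n-7}{3}P_3\cup T^*_7$, when $n\equiv 1\pmod 3$; \item $F\cong \frac{n-8}{3}P_3\cup T^*_8$ or $F\cong \frac{n-5}{3}P_3\cup K_{1,4}$, when $n\equiv 2\pmod 3$; \item $F\cong K_{1,3}\cup K_{1,4}$, when $n=9$; \item $F\cong \frac{n-12}{3}P_3\cup 3K_{1,3}$, when $n\equiv 0\pmod 3$ and $n\geq 12$. \end{itemize}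
   Context: All graphs are finite, simple, undirected. A dissociation set of a graph $G$ is a set $S\subseteq V(G)$ such that every vertex of the induced subgraph $G[S]$ has degree at most $1$. A dissociation set is maximal if it is not a proper subset of another dissociation set. $\Phi(G)$ denotes the number of maximal dissociation sets of $G$. The order of a graph is its number of vertices. $P_n$ is the path on $n$ vertices, $K_{1,m}$ the star with $m$ leaves; $G\cup H$ is the disjoint union and $kG$ the disjoint union of $k$ copies of $G$ (with $0G$ the empty graph). For $n\geq 4$, $n\equiv 1\pmod 3$, $T^*_n$ is the tree obtained from $\frac{n-1}{3}P_3$ and one extra isolated vertex $w$ by joining $w$ to the central (non-leaf) vertex of each of the $\frac{n-1}{3}$ copies of $P_3$. In particular $T^*_7$ is this tree for $n=7$. $T^*_8$ is the tree of order $8$ obtained from $2K_{1,3}$ by adding one edge joining a leaf of one copy of $K_{1,3}$ to a leaf of the other copy. $f_1(n)=3^{n/3}$ if $n\equiv 0\pmod 3$, $n\ge 3$; $f_1(n)=4\cdot 3^{\frac{n-4}{3}}$ if $n\equiv 1\pmod 3$, $n\geq 4$; $f_1(5)=5$; $f_1(n)=4^2\cdot 3^{\frac{n-8}{3}}$ if $n\equiv 2\pmod 3$, $n\geq 8$. $f_2(4)=3$, $f_2(5)=4$, $f_2(6)=6$; $f_2(n)=11\cdot 3^{\frac{n-7}{3}}$ if $n\equiv 1\pmod 3$, $n\geq 7$; $f_2(n)=15\cdot 3^{\frac{n-8}{3}}$ if $n\equiv 2\pmod 3$, $n\geq 8$; $f_2(9)=20$; $f_2(n)=4^3\cdot 3^{\frac{n-12}{3}}$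 if $n\equiv 0\pmod 3$, $n\geq 12$. -}

module Defs where

open import Data.Nat using (ℕ; zero; suc; _+_; _*_; _∸_; _^_; _≤_; _<_; _%_; _/_)
open import Data.Nat.Properties using (_≤?_)
open import Data.Bool using (Bool; true; false; _∧_; _∨_; not; if_then_else_)
import Data.Bool as B
open import Data.Fin using (Fin; zero; suc; splitAt)
import Data.Fin as F
open import Data.Fin.Subset using (Subset; _∈_; _⊂_; outside; inside)
open import Data.Fin.Subset.Properties using (_∈?_; _⊂?_; anySubset?)
open import Data.Fin.Properties using (all?)
open import Data.Vec using (_∷_; [])
open import Data.List using (List; []; _∷_; length; filter; map; _++_; _∷ʳ_; allFin)
open import Data.Bool.ListAction using (any)
open import Data.List.Relation.Unary.Linked using (Linked)
open import Data.List.Relation.Unary.Unique.Propositional using (Unique)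
open import Data.Product using (Σ; ∃; _×_; _,_; proj₁; proj₂)
open import Data.Sum using (_⊎_; inj₁; inj₂)
open import Function.Bundles using (_↔_; Inverse)
open import Relation.Nullary using (¬_; Dec; yes; no; does)
open import Relation.Nullary.Decidable using (_×-dec_; ¬?)
open import Relation.Binary.PropositionalEquality using (_≡_; refl; sym; trans)

record Graph (n : ℕ) : Set where
  field
    adj    : Fin n → Fin n → Bool
    adj-sym : ∀ u v → adj u v ≡ adj v u
    adj-irrefl : ∀ u → adj u u ≡ false
open Graph public

Adj : ∀ {n} → Graph n → Fin n → Fin n → Set
Adj G u v = adj G u v ≡ true

data Walk {n} (G : Graph n) : Fin n → Fin n → Set where
  here : ∀ {u} → Walk G u u
  step : ∀ {u w v} → Adj G u w → Walk G w v → Walk G u v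

Connected : ∀ {n} → Graph n → Set
Connected G = ∀ u v → Walk G u v

record Cycle {n} (G : Graph n) : Set where
  field
    start    : Fin n
    rest     : List (Fin n)
    long     : 2 ≤ length rest
    distinct : Unique (start ∷ rest)
    linked   : Linked (Adj G) ((start ∷ rest) ∷ʳ start)

Forest : ∀ {n} → Graph n → Set
Forest G = ¬ Cycle G

Tree : ∀ {n} → Graph n → Set
Tree G = Connected G × Forest G

degIn : ∀ {n} → Graph n → Subset n → Fin n → ℕ
degIn G S v = length (filter (λ u → (u ∈? S) ×-dec (adj G v u B.≟ true)) (allFin _))

Dissociation : ∀ {n} → Graph n → Subset n → Set
Dissociation G S = ∀ v → v ∈ S → degIn G S v ≤ 1

MaximalDissociation : ∀ {n} → Graph n → Subset n → Set
MaximalDissociation G S =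
  Dissociation G S × ¬ (∃ λ T → Dissociation G T × S ⊂ T)

dissociation? : ∀ {n} (G : Graph n) (S : Subset n) → Dec (Dissociation G S)
dissociation? G S = all? (λ v → dec v)
  where
  dec : ∀ v → Dec (v ∈ S → degIn G S v ≤ 1)
  dec v with v ∈? S | degIn G S v ≤? 1
  ... | _      | yes p = yes (λ _ → p)
  ... | no v∉S | no _  = yes (λ v∈S → Data.Empty.⊥-elim (v∉S v∈S))
    where import Data.Empty
  ... | yes v∈S | no ¬p = no (λ f → ¬p (f v∈S))

maximalDissociation? : ∀ {n} (G : Graph n) (S : Subset n) → Dec (MaximalDissociation G S)
maximalDissociation? G S =
  dissociation? G S ×-dec ¬? (anySubset? (λ T → dissociation? G T ×-dec (S ⊂? T)))

allSubsets : ∀ n → List (Subset n)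
allSubsets zero    = [] ∷ []
allSubsets (suc n) = map (outside ∷_) (allSubsets n) ++ map (inside ∷_) (allSubsets n)

Φ : ∀ {n} → Graph n → ℕ
Φ {n} G = length (filter (maximalDissociation? G) (allSubsets n))

-- Isomorphism (between graphs whose orders are given by possibly different
-- expressions): an adjacency-preserving bijection of vertex sets

_≅_ : ∀ {m n} → Graph m → Graph n → Set
_≅_ {m} {n} G H =
  Σ (Fin m ↔ Fin n) λ φ → ∀ u v → adj G u v ≡ adj H (Inverse.to φ u) (Inverse.to φ v)

fromEdges : ∀ {n} → List (Fin n × Fin n) → Graph n
fromEdges {n} es = record { adj = a ; adj-sym = s ; adj-irrefl = i }
  where
  eqᵇ : Fin n → Fin n → Bool
  eqᵇ u v = does (u F.≟ v)
  has : Fin n → Fin n → Bool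
  has u v = any (λ e → eqᵇ (proj₁ e) u ∧ eqᵇ (proj₂ e) v) es
  a : Fin n → Fin n → Bool
  a u v = not (eqᵇ u v) ∧ (has u v ∨ has v u)
  eq-sym : ∀ u v → eqᵇ u v ≡ eqᵇ v u
  eq-sym u v with u F.≟ v | v F.≟ u
  ... | yes _ | yes _ = refl
  ... | no _  | no _  = refl
  ... | yes p | no q  = Data.Empty.⊥-elim (q (sym p)) where import Data.Empty
  ... | no p  | yes q = Data.Empty.⊥-elim (p (sym q)) where import Data.Empty
  s : ∀ u v → a u v ≡ a v u
  s u v rewrite eq-sym u v = Relation.Binary.PropositionalEquality.cong (not (eqᵇ v u) ∧_)
                               (Data.Bool.Properties.∨-comm (has u v) (has v u))
    where import Data.Bool.Properties
          import Relation.Binary.PropositionalEquality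
  i : ∀ u → a u u ≡ false
  i u with u F.≟ u
  ... | yes _ = refl
  ... | no p  = Data.Empty.⊥-elim (p refl) where import Data.Empty

_⊕_ : ∀ {m n} → Graph m → Graph n → Graph (m + n)
_⊕_ {m} {n} G H = record { adj = a ; adj-sym = s ; adj-irrefl = i }
  where
  a : Fin (m + n) → Fin (m + n) → Bool
  a u v with splitAt m u | splitAt m v
  ... | inj₁ x | inj₁ y = adj G x y
  ... | inj₂ x | inj₂ y = adj H x y
  ... | _      | _      = false
  s : ∀ u v → a u v ≡ a v u
  s u v with splitAt m u | splitAt m v
  ... | inj₁ x | inj₁ y = adj-sym G x y
  ... | inj₂ x | inj₂ y = adj-sym H x y
  ... | inj₁ x | inj₂ y = refl
  ... | inj₂ x | inj₁ y = refl
  i : ∀ u → a u u ≡ false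
  i u with splitAt m u
  ... | inj₁ x = adj-irrefl G x
  ... | inj₂ x = adj-irrefl H x

copies : ∀ {n} (k : ℕ) → Graph n → Graph (k * n)
copies zero    G = record { adj = λ () ; adj-sym = λ () ; adj-irrefl = λ () }
copies (suc k) G = G ⊕ copies k G

copiesMark : ∀ {n} (k : ℕ) → (Fin n → Bool) → Fin (k * n) → Bool
copiesMark zero    c ()
copiesMark {n} (suc k) c v with splitAt n v
... | inj₁ x = c x
... | inj₂ y = copiesMark k c y

addApex : ∀ {n} → Graph n → (Fin n → Bool) → Graph (suc n)
addApex {n} G c = record { adj = a ; adj-sym = s ; adj-irrefl = i }
  where
  a : Fin (suc n) → Fin (suc n) → Bool
  a zero    zero    = false
  a zero    (suc v) = c v
  a (suc u) zero    = c u
  a (suc u) (suc v) = adj G u v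
  s : ∀ u v → a u v ≡ a v u
  s zero    zero    = refl
  s zero    (suc v) = refl
  s (suc u) zero    = refl
  s (suc u) (suc v) = adj-sym G u v
  i : ∀ u → a u u ≡ false
  i zero    = refl
  i (suc u) = adj-irrefl G u

P₃ : Graph 3
P₃ = fromEdges ((zero , suc zero) ∷ (suc zero , suc (suc zero)) ∷ [])

P₃centre : Fin 3 → Bool
P₃centre zero             = false
P₃centre (suc zero)       = true
P₃centre (suc (suc zero)) = false

K₁ : (m : ℕ) → Graph (suc m)
K₁ m = fromEdges (map (λ i → zero , suc i) (allFin m))

T* : (k : ℕ) → Graph (suc (k * 3))
T* k = addApex (copies k P₃) (copiesMark k P₃centre)

-- T*_8: two copies of K_{1,3} (centres 0 and 4) plus the edge 3 - 7
-- joining a leaf of one copy to a leaf of the other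
T*₈ : Graph 8
T*₈ = fromEdges ((# 0 , # 1) ∷ (# 0 , # 2) ∷ (# 0 , # 3)
               ∷ (# 4 , # 5) ∷ (# 4 , # 6) ∷ (# 4 , # 7) ∷ (# 3 , # 7) ∷ [])
  where open import Data.Fin using (#_)

-- "m ≤ t(n)" where t(n) = 3^((n-1)/3) + (n-1)/3 (real exponent).
-- Since m - (n-1)/3 ≤ 3^((n-1)/3)  ⇔  3m - (n-1) ≤ 3^((n+2)/3)
--   ⇔  3m - (n-1) ≤ 0  or  (3m - (n-1))³ ≤ 3^(n+2),
-- this is exactly the following (truncated subtraction covers the first case).
_≤t_ : ℕ → ℕ → Set
m ≤t n = (3 * m ∸ (n ∸ 1)) ^ 3 ≤ 3 ^ (n + 2)

-- "m = t(n)", similarly (3^(n+2) > 0 forces 3m > n-1)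
_≡t_ : ℕ → ℕ → Set
m ≡t n = (3 * m ∸ (n ∸ 1)) ^ 3 ≡ 3 ^ (n + 2)

-- f₁ (only meaningful for n ≥ 4, where all cases are defined)
f₁ : ℕ → ℕ
f₁ 5 = 5
f₁ n with n % 3
... | 0 = 3 ^ (n / 3)
... | 1 = 4 * 3 ^ ((n ∸ 4) / 3)
... | _ = 4 ^ 2 * 3 ^ ((n ∸ 8) / 3)

-- f₂ (only meaningful for n ≥ 4)
f₂ : ℕ → ℕ
f₂ 4 = 3
f₂ 5 = 4
f₂ 6 = 6
f₂ 9 = 20
f₂ n with n % 3
... | 0 = 4 ^ 3 * 3 ^ ((n ∸ 12) / 3)
... | 1 = 11 * 3 ^ ((n ∸ 7) / 3)
... | _ = 15 * 3 ^ ((n ∸ 8) / 3)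

Extremal : ∀ {n} → Graph n → Set
Extremal {n} F =
    (∃ λ k → n ≡ k * 3 + 7 × F ≅ (copies k P₃ ⊕ T* 2))
  ⊎ (∃ λ k → n ≡ k * 3 + 8 × (F ≅ (copies k P₃ ⊕ T*₈) ⊎ F ≅ (copies (suc k) P₃ ⊕ K₁ 4)))
  ⊎ (n ≡ 9 × F ≅ (K₁ 3 ⊕ K₁ 4))
  ⊎ (∃ λ k → n ≡ k * 3 + 12 × F ≅ (copies k P₃ ⊕ copies 3 (K₁ 3)))

{-# OPTIONS --safe #-}
module Submission where

-- Rooted trees arise from single vertices by R ▷ C, which hangs C below the root of R. The subsets of a
-- rooted tree that are fine away from the root fall into six classes according to what they look like
-- from the root; the class counts of R ▷ C are bilinear in those of R and C, and Φ is the sum of three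
-- of them. So, for a fixed piece pendant at a vertex, Φ of a tree is linear in the counts of the rest E,
-- and a bound on it from the bounds for smaller trees containing E is a Farkas certificate. In a tree of
-- order at least 11 one finds such a reducible piece or a vertex with at least two pendant P₃ and one
-- further neighbour, and only the latter leads to T*. In forests Φ is multiplicative, and a component
-- other than P₃, K₁,₃, K₁,₄, T*₇ and T*₈ costs so much that any optimal completion stays below f₂.

open import Defs hiding (here; step)
open import Data.Bool using (Bool; true; false; T; _∧_; _∨_; not; _xor_; if_then_else_)
import Data.Bool as B
open import Data.Bool.ListAction using (all; any)
open import Data.Bool.Properties using (∧-zeroʳ; ∧-comm; ¬-not; T-≡; T-∧; T-∨)
open import Data.Empty using (⊥; ⊥-elim)
open import Data.Fin using (Fin; zero; suc; splitAt; join; punchIn; punchOut)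
import Data.Fin as F
open import Data.Fin.Patterns
open import Data.Fin.Permutation using (↔⇒≡)
open import Data.Fin.Properties using (any?; all?; +↔⊎; 0↔⊥; 1↔⊤; splitAt-join; join-splitAt; punchIn-punchOut; punchOut-punchIn; punchOut-cong; punchInᵢ≢i; punchIn-injective)
open import Data.Fin.Subset using (Subset; _∪_; ⁅_⁆; _⊂_; inside; outside)
open import Data.Fin.Subset.Properties using (_∈?_; x∈p∪q⁻; p⊆p∪q; q⊆p∪q; x∈⁅x⁆; x∈⁅y⁆⇒x≡y)
open import Data.List using (List; []; _∷_; length; filter; foldl; map; take; replicate; upTo; allFin; cartesianProduct; cartesianProductWith; concatMap; _++_; _∷ʳ_)
open import Data.List.Membership.DecPropositional using () renaming (_∈?_ to mem?)
open import Data.List.Membership.Propositional using (_∈_; lose)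
open import Data.List.Membership.Propositional.Properties
open import Data.List.Properties using (length-map; length-++; length-tabulate; length-replicate; ++-assoc; map-++; foldl-∷ʳ; foldl-++)
open import Data.List.Relation.Binary.Permutation.Propositional as ↭ using (_↭_; ↭-refl; ↭-sym; ↭-trans; prep)
open import Data.List.Relation.Binary.Permutation.Propositional.Properties as ↭ using (All-resp-↭; ↭-length; ∷↭∷ʳ; ++-comm)
open import Data.List.Relation.Unary.All as All using (All; []; _∷_)
open import Data.List.Relation.Unary.All.Properties as All using (all⁺; ++⁻ˡ)
open import Data.List.Relation.Unary.AllPairs using ([]; _∷_)
open import Data.List.Relation.Unary.Any using (here; there)
open import Data.List.Relation.Unary.Linked using (Linked; [-]; _∷_)
import Data.List.Relation.Unary.Linked.Properties as Linked
open import Data.List.Relation.Unary.Unique.Propositional using (Unique)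
import Data.List.Relation.Unary.Unique.Propositional.Properties as Unique
open import Data.Maybe using (Maybe; just; nothing; is-just)
open import Data.Nat
open import Data.Nat.DivMod using (m≡m%n+[m/n]*n; m%n<n; [m+kn]%n≡m%n; m*n%n≡0; m*n/n≡m; %-congˡ)
open import Data.Nat.Induction using (<-wellFounded)
open import Data.Nat.Properties
open import Data.Nat.Tactic.RingSolver using (solve-∀)
open import Data.Product using (Σ; ∃; ∃₂; _×_; _,_; proj₁; proj₂)
open import Data.Sum using (_⊎_; inj₁; inj₂; [_,_]′; map₂)
open import Data.Sum.Function.Propositional using (_⊎-↔_)
open import Data.Sum.Properties using (inj₁-injective; inj₂-injective)
open import Data.Unit using (⊤; tt)
open import Data.Vec using (lookup; tabulate; []; _∷_)
open import Data.Vec.Properties using ([]=⇒lookup; lookup⇒[]=; lookup∘tabulate; tabulate∘lookup; tabulate-cong)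
open import Function.Base using (_∘_; case_of_; id)
open import Function.Bundles using (_⇔_; mk⇔; _↔_; Equivalence; Inverse; mk↔ₛ′)
open import Function.Properties.Inverse using (↔-refl; ↔-sym; ↔-trans)
open import Induction.WellFounded using (Acc; acc)
open import Relation.Binary.PropositionalEquality
open import Relation.Nullary using (¬_; Dec; yes; no)
open import Relation.Nullary.Decidable using (_×-dec_; ¬?; from-yes)

-- Rooted trees and their counts

-- Maximality of a dissociation set is a condition on balls of radius two, so the information
-- passing through the root of a piece is bounded: whether the root is in the set, its neighbours
-- there, and at most one pending demand. A tree has many presentations by `▷`, but `φ` counts sets
-- of the graph, hence does not depend on the root or on the order of the children, and any vertex
-- can be made the root where an argument wants it. The obstacle to a plain induction is that `t(n)`
-- is irrational for two residues of the order. The caps are rational: a sixtieth of `cap n` is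
-- `t(n)` when `n ≡ 1` modulo 3 and lies below it at the other orders from 11 on, so this stronger
-- hypothesis can be checked in integers. It fails at small orders, already for `P₃`, which is why
-- everything of order at most 10 is enumerated, both as a whole tree and as the rest `E` of a
-- larger one. The number of legs `P₃` at one vertex is unbounded and leads to the equality case; it
-- is treated by a closed formula in that number. All other irreducible pieces have order at most 5,
-- so an edge of a tree of order at least 11 cannot have irreducible pieces on both sides.

infixl 6 _⊛_

-- How many sets of a rooted tree fall into each of the classes alone, needy, paired, blocked, half, bare
-- (see Class).
record Counts : Set where
  constructor ⟨_,_,_,_,_,_⟩
  field a₀ a₁ b d x y : ℕ
open Counts

p w s v t : Counts → ℕ
p c = a₀ c + a₁ c
w c = d c + x c + y c
s c = a₀ c + b c + d c
v c = d c + x c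
t c = a₀ c + b c

_⊛_ : Counts → Counts → Counts
R ⊛ C = ⟨ a₀ R * v C , a₀ R * y C + a₁ R * w C , b R * w C + p R * p C
        , d R * s C + x R * t C + y R * b C , x R * d C + y R * a₀ C , y R * d C ⟩

dot : Counts → Counts → ℕ
dot f c = a₀ f * a₀ c + a₁ f * a₁ c + b f * b c + d f * d c + x f * x c + y f * y c

-- The adjoint of `_⊛ C` with respect to `dot`: the terms of `⊛` are collected by the class of `R`.
-- Hanging a fixed piece thereby becomes an operation on functionals.
pull : Counts → Counts → Counts
pull C f = ⟨ a₀ f * v C + a₁ f * y C + b f * p C , a₁ f * w C + b f * p C , b f * w C
           , d f * s C , d f * t C + x f * d C , d f * b C + x f * a₀ C + y f * d C ⟩

dot-pull : ∀ f R C → dot f (R ⊛ C) ≡ dot (pull C f) R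
dot-pull f R C = lemma (a₀ f) (a₁ f) (b f) (d f) (x f) (y f) (a₀ R) (a₁ R) (b R) (d R) (x R) (y R)
                       (v C) (w C) (s C) (t C) (p C) (a₀ C) (b C) (d C) (y C)
  where
  lemma : ∀ f0 f1 fb fd fx fy A0 A1 B D X Y v w s t p a0 b d y →
    f0 * (A0 * v) + f1 * (A0 * y + A1 * w) + fb * (B * w + (A0 + A1) * p) + fd * (D * s + X * t + Y * b)
      + fx * (X * d + Y * a0) + fy * (Y * d)
    ≡ (f0 * v + f1 * y + fb * p) * A0 + (f1 * w + fb * p) * A1 + fb * w * B + fd * s * D
      + (fd * t + fx * d) * X + (fd * b + fx * a0 + fy * d) * Y
  lemma = solve-∀

infixl 6 _▷_

data RT : Set where
  leaf : RT
  _▷_  : RT → RT → RT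

size : RT → ℕ
size leaf    = 1
size (R ▷ C) = size R + size C

cnt : RT → Counts
cnt leaf    = ⟨ 1 , 0 , 0 , 0 , 0 , 1 ⟩
cnt (R ▷ C) = cnt R ⊛ cnt C

φ : RT → ℕ
φ t = s (cnt t)


-- The inequalities between class counts that the certificates may use. The first reflects that
-- adding the root to a bare set makes it alone.
record Nice (c : Counts) : Set where
  constructor nice
  field
    y≤a₀ : y c ≤ a₀ c
    p≤w  : p c ≤ w c
    x≤b  : x c ≤ b c
  w≤s : w c ≤ s c
  w≤s = ≤-trans (+-mono-≤ (+-monoʳ-≤ (d c) x≤b) y≤a₀) (≤-reflexive (lemma (d c) (b c) (a₀ c)))
    where
    lemma : ∀ d b a → d + b + a ≡ a + b + d
    lemma = solve-∀
open Nice

-- The invariants reproduce themselves because two totals factor: `p (R ⊛ C)` is `p R * w C` and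
-- `w (R ⊛ C)` is `w R * s C`. So `p ≤ w` for `R` and `w ≤ s` for `C` give `p ≤ w` for the product.
⊛-nice : ∀ {R C} → Nice R → Nice C → Nice (R ⊛ C)
⊛-nice {R} {C} nR nC = nice
  (*-mono-≤ (y≤a₀ nR) (m≤m+n (d C) (x C)))
  (begin
    p (R ⊛ C)   ≡⟨ e₁ (a₀ R) (a₁ R) (d C) (x C) (y C) ⟩
    p R * w C   ≤⟨ *-mono-≤ (p≤w nR) (w≤s nC) ⟩
    w R * s C   ≡⟨ e₂ (d R) (x R) (y R) (a₀ C) (b C) (d C) ⟩
    w (R ⊛ C)   ∎)
  (+-mono-≤ (*-mono-≤ (x≤b nR) (≤-trans (m≤m+n (d C) (x C)) (m≤m+n (d C + x C) (y C))))
            (*-mono-≤ (≤-trans (y≤a₀ nR) (m≤m+n _ _)) (m≤m+n _ _)))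
  where
  open ≤-Reasoning
  e₁ : ∀ A₀ A₁ d x y → A₀ * (d + x) + (A₀ * y + A₁ * (d + x + y)) ≡ (A₀ + A₁) * (d + x + y)
  e₁ = solve-∀
  e₂ : ∀ D X Y a b d → (D + X + Y) * (a + b + d)
       ≡ D * (a + b + d) + X * (a + b) + Y * b + (X * d + Y * a) + Y * d
  e₂ = solve-∀

cnt-nice : ∀ t → Nice (cnt t)
cnt-nice leaf    = nice (s≤s z≤n) (s≤s z≤n) z≤n
cnt-nice (R ▷ C) = ⊛-nice (cnt-nice R) (cnt-nice C)

-- Starts from the coefficients of `s` and pulls them back through the pieces, so that `φ` of a tree
-- is read off from the counts of the part carrying these pieces.
functional : List Counts → Counts
functional []       = ⟨ 1 , 0 , 1 , 1 , 0 , 0 ⟩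
functional (c ∷ cs) = pull c (functional cs)

functional-spec : ∀ R cs → s (foldl _⊛_ R cs) ≡ dot (functional cs) R
functional-spec R []       = lemma (a₀ R) (a₁ R) (b R) (d R) (x R) (y R)
  where
  lemma : ∀ a a' b d x y → a + b + d ≡ 1 * a + 0 * a' + 1 * b + 1 * d + 0 * x + 0 * y
  lemma = solve-∀
functional-spec R (c ∷ cs) = trans (functional-spec (R ⊛ c) cs) (dot-pull (functional cs) R c)

attach : RT → List RT → RT
attach = foldl _▷_

cnt-attach : ∀ R cs → cnt (attach R cs) ≡ foldl _⊛_ (cnt R) (map cnt cs)
cnt-attach R []       = refl
cnt-attach R (c ∷ cs) = cnt-attach (R ▷ c) cs

φ-attach : ∀ R cs → φ (attach R cs) ≡ dot (functional (map cnt cs)) (cnt R)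
φ-attach R cs = trans (cong s (cnt-attach R cs)) (functional-spec (cnt R) (map cnt cs))

sizes : List RT → ℕ
sizes []       = 0
sizes (c ∷ cs) = size c + sizes cs

size-attach : ∀ R cs → size (attach R cs) ≡ size R + sizes cs
size-attach R []       = sym (+-identityʳ _)
size-attach R (c ∷ cs) = trans (size-attach (R ▷ c) cs) (+-assoc (size R) (size c) (sizes cs))

infixl 6 _⊞_
infixl 7 _⊠_
_⊞_ : Counts → Counts → Counts
f ⊞ g = ⟨ a₀ f + a₀ g , a₁ f + a₁ g , b f + b g , d f + d g , x f + x g , y f + y g ⟩

_⊠_ : ℕ → Counts → Counts
k ⊠ f = ⟨ k * a₀ f , k * a₁ f , k * b f , k * d f , k * x f , k * y f ⟩

_≤ᶜ_ : Counts → Counts → Bool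
f ≤ᶜ g = (a₀ f ≤ᵇ a₀ g) ∧ (a₁ f ≤ᵇ a₁ g) ∧ (b f ≤ᵇ b g) ∧ (d f ≤ᵇ d g) ∧ (x f ≤ᵇ x g) ∧ (y f ≤ᵇ y g)

dot-⊞ : ∀ f g c → dot (f ⊞ g) c ≡ dot f c + dot g c
dot-⊞ f g c = lemma (a₀ f) (a₁ f) (b f) (d f) (x f) (y f) (a₀ g) (a₁ g) (b g) (d g) (x g) (y g)
                    (a₀ c) (a₁ c) (b c) (d c) (x c) (y c)
  where
  lemma : ∀ f1 f2 f3 f4 f5 f6 g1 g2 g3 g4 g5 g6 c1 c2 c3 c4 c5 c6 →
    (f1 + g1) * c1 + (f2 + g2) * c2 + (f3 + g3) * c3 + (f4 + g4) * c4 + (f5 + g5) * c5 + (f6 + g6) * c6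
    ≡ f1 * c1 + f2 * c2 + f3 * c3 + f4 * c4 + f5 * c5 + f6 * c6
      + (g1 * c1 + g2 * c2 + g3 * c3 + g4 * c4 + g5 * c5 + g6 * c6)
  lemma = solve-∀

dot-⊠ : ∀ k f c → dot (k ⊠ f) c ≡ k * dot f c
dot-⊠ k f c = lemma k (a₀ f) (a₁ f) (b f) (d f) (x f) (y f) (a₀ c) (a₁ c) (b c) (d c) (x c) (y c)
  where
  lemma : ∀ k f1 f2 f3 f4 f5 f6 c1 c2 c3 c4 c5 c6 →
    k * f1 * c1 + k * f2 * c2 + k * f3 * c3 + k * f4 * c4 + k * f5 * c5 + k * f6 * c6
    ≡ k * (f1 * c1 + f2 * c2 + f3 * c3 + f4 * c4 + f5 * c5 + f6 * c6)
  lemma = solve-∀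

∧⁻ : ∀ {p q} → T (p ∧ q) → T p × T q
∧⁻ = Equivalence.to T-∧

dot-mono : ∀ {f g} c → T (f ≤ᶜ g) → dot f c ≤ dot g c
dot-mono {f} {g} c h with ∧⁻ {a₀ f ≤ᵇ a₀ g} h
... | h₁ , h with ∧⁻ {a₁ f ≤ᵇ a₁ g} h
... | h₂ , h with ∧⁻ {b f ≤ᵇ b g} h
... | h₃ , h with ∧⁻ {d f ≤ᵇ d g} h
... | h₄ , h with ∧⁻ {x f ≤ᵇ x g} h
... | h₅ , h₆ = +-mono-≤ (+-mono-≤ (+-mono-≤ (+-mono-≤ (+-mono-≤
    (*-monoˡ-≤ (a₀ c) (≤ᵇ⇒≤ (a₀ f) _ h₁)) (*-monoˡ-≤ (a₁ c) (≤ᵇ⇒≤ (a₁ f) _ h₂)))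
    (*-monoˡ-≤ (b c) (≤ᵇ⇒≤ (b f) _ h₃))) (*-monoˡ-≤ (d c) (≤ᵇ⇒≤ (d f) _ h₄)))
    (*-monoˡ-≤ (x c) (≤ᵇ⇒≤ (x f) _ h₅))) (*-monoˡ-≤ (y c) (≤ᵇ⇒≤ (y f) _ h₆))

record Form : Set where
  constructor form
  field pow lin con : ℕ
open Form

eval : Form → ℕ → ℕ
eval f q = pow f * 3 ^ q + lin f * q + con f

_+ᶠ_ : Form → Form → Form
f +ᶠ g = form (pow f + pow g) (lin f + lin g) (con f + con g)

_*ᶠ_ : ℕ → Form → Form
k *ᶠ f = form (k * pow f) (k * lin f) (k * con f)

eval-+ : ∀ f g q → eval (f +ᶠ g) q ≡ eval f q + eval g q
eval-+ f g q = lemma (pow f) (pow g) (lin f) (lin g) (con f) (con g) (3 ^ q) q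
  where
  lemma : ∀ a a' b b' c c' x q → (a + a') * x + (b + b') * q + (c + c') ≡ a * x + b * q + c + (a' * x + b' * q + c')
  lemma = solve-∀

eval-* : ∀ k f q → eval (k *ᶠ f) q ≡ k * eval f q
eval-* k f q = lemma k (pow f) (lin f) (con f) (3 ^ q) q
  where
  lemma : ∀ k a b c x q → k * a * x + k * b * q + k * c ≡ k * (a * x + b * q + c)
  lemma = solve-∀

-- The last conjunct compares the increments at q₀; from there on they can only move further apart.
dominates : ℕ → Form → Form → Bool
dominates q₀ f g = (pow f ≤ᵇ pow g) ∧ (eval f q₀ ≤ᵇ eval g q₀)
                   ∧ (2 * 3 ^ q₀ * pow f + lin f ≤ᵇ 2 * 3 ^ q₀ * pow g + lin g)

-- The surplus of `k'` over `k` multiplies `a ≤ a'`. In this way a comparison of increments made at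
-- one power of 3 persists at all larger powers.
scale-mono : ∀ {a a' k k' l l'} → a ≤ a' → k ≤ k' → k * a + l ≤ k * a' + l' → k' * a + l ≤ k' * a' + l'
scale-mono {a} {a'} {k} {k'} {l} {l'} a≤a' k≤k' h with m≤n⇒∃[o]m+o≡n k≤k'
... | o , refl = begin
  (k + o) * a + l         ≡⟨ lemma k o a l ⟩
  k * a + l + o * a       ≤⟨ +-mono-≤ h (*-monoʳ-≤ o a≤a') ⟩
  k * a' + l' + o * a'    ≡⟨ sym (lemma k o a' l') ⟩
  (k + o) * a' + l'       ∎
  where
  open ≤-Reasoning
  lemma : ∀ k o a l → (k + o) * a + l ≡ k * a + l + o * a
  lemma = solve-∀

dominates⇒≤ : ∀ {q₀ f g} → T (dominates q₀ f g) → ∀ {q} → q₀ ≤ q → eval f q ≤ eval g q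
dominates⇒≤ {q₀} {f} {g} h {q} q₀≤q with ∧⁻ {pow f ≤ᵇ pow g} h
... | h₁ , h with ∧⁻ {eval f q₀ ≤ᵇ eval g q₀} h
... | h₂ , h₃ with m≤n⇒∃[o]m+o≡n q₀≤q
... | o , refl = go o
  where
  open ≤-Reasoning
  step : ∀ a b c x q → a * (3 * x) + b * suc q + c ≡ a * x + b * q + c + (2 * x * a + b)
  step = solve-∀
  go : ∀ o → eval f (q₀ + o) ≤ eval g (q₀ + o)
  go zero    = subst (λ q → eval f q ≤ eval g q) (sym (+-identityʳ q₀)) (≤ᵇ⇒≤ (eval f q₀) _ h₂)
  go (suc o) rewrite +-suc q₀ o = begin
    eval f (suc (q₀ + o))      ≡⟨ step (pow f) (lin f) (con f) (3 ^ (q₀ + o)) (q₀ + o) ⟩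
    eval f (q₀ + o) + (2 * 3 ^ (q₀ + o) * pow f + lin f)
      ≤⟨ +-mono-≤ (go o) (scale-mono (≤ᵇ⇒≤ (pow f) _ h₁) (*-monoʳ-≤ 2 (^-monoʳ-≤ 3 (m≤m+n q₀ o)))
                            (≤ᵇ⇒≤ (2 * 3 ^ q₀ * pow f + lin f) _ h₃)) ⟩
    eval g (q₀ + o) + (2 * 3 ^ (q₀ + o) * pow g + lin g)
      ≡⟨ sym (step (pow g) (lin g) (con g) (3 ^ (q₀ + o)) (q₀ + o)) ⟩
    eval g (suc (q₀ + o))      ∎

-- Graphs with marked vertices

-- The marked vertices are those to which further pieces get attached: the root, for a rooted tree.
record MGraph : Set₁ where
  constructor mgraph
  field
    V    : Set
    edge : V → V → Bool
    mark : V → Bool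
open MGraph public

infix 4 _≃_ _≃ᵐ_

record _≃_ (G H : MGraph) : Set where
  constructor iso
  field
    bij   : V G ↔ V H
    edge≡ : ∀ u v → edge G u v ≡ edge H (Inverse.to bij u) (Inverse.to bij v)
open _≃_ public

record _≃ᵐ_ (G H : MGraph) : Set where
  constructor isoᵐ
  field
    plain : G ≃ H
    mark≡ : ∀ u → mark G u ≡ mark H (Inverse.to (bij plain) u)
open _≃ᵐ_ public

≃-refl : ∀ {G} → G ≃ G
≃-refl = iso ↔-refl λ _ _ → refl

≃-sym : ∀ {G H} → G ≃ H → H ≃ G
≃-sym {G} {H} (iso f e) = iso (↔-sym f) λ u v →
  trans (cong₂ (edge H) (sym (Inverse.strictlyInverseˡ f u)) (sym (Inverse.strictlyInverseˡ f v)))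
        (sym (e (Inverse.from f u) (Inverse.from f v)))

≃-trans : ∀ {G H K} → G ≃ H → H ≃ K → G ≃ K
≃-trans (iso f e) (iso g e') = iso (↔-trans f g) λ u v → trans (e u v) (e' _ _)

≃ᵐ-refl : ∀ {G} → G ≃ᵐ G
≃ᵐ-refl = isoᵐ ≃-refl λ _ → refl

≃ᵐ-trans : ∀ {G H K} → G ≃ᵐ H → H ≃ᵐ K → G ≃ᵐ K
≃ᵐ-trans (isoᵐ f m) (isoᵐ g m') = isoᵐ (≃-trans f g) λ u → trans (m u) (m' _)

point : MGraph
point = mgraph ⊤ (λ _ _ → false) (λ _ → true)

empty : MGraph
empty = mgraph ⊥ (λ ()) (λ ())

-- For rooted trees this hangs H below the root of G.
link : MGraph → MGraph → MGraph
link G H = mgraph (V G ⊎ V H) e [ mark G , (λ _ → false) ]′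
  where
  e : V G ⊎ V H → V G ⊎ V H → Bool
  e (inj₁ u) (inj₁ v) = edge G u v
  e (inj₂ u) (inj₂ v) = edge H u v
  e (inj₁ u) (inj₂ v) = mark G u ∧ mark H v
  e (inj₂ u) (inj₁ v) = mark H u ∧ mark G v

infixr 5 _⊎ᵍ_
_⊎ᵍ_ : MGraph → MGraph → MGraph
G ⊎ᵍ H = mgraph (V G ⊎ V H) e [ mark G , mark H ]′
  where
  e : V G ⊎ V H → V G ⊎ V H → Bool
  e (inj₁ u) (inj₁ v) = edge G u v
  e (inj₂ u) (inj₂ v) = edge H u v
  e (inj₁ u) (inj₂ v) = false
  e (inj₂ u) (inj₁ v) = false

link-cong : ∀ {G G' H H'} → G ≃ᵐ G' → H ≃ᵐ H' → link G H ≃ᵐ link G' H'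
link-cong (isoᵐ (iso f e) m) (isoᵐ (iso g e') m') = isoᵐ (iso (f ⊎-↔ g)
  λ { (inj₁ u) (inj₁ v) → e u v
    ; (inj₂ u) (inj₂ v) → e' u v
    ; (inj₁ u) (inj₂ v) → cong₂ _∧_ (m u) (m' v)
    ; (inj₂ u) (inj₁ v) → cong₂ _∧_ (m' u) (m v) })
  λ { (inj₁ u) → m u ; (inj₂ u) → refl }

⊎ᵍ-cong : ∀ {G G' H H'} → G ≃ G' → H ≃ H' → G ⊎ᵍ H ≃ G' ⊎ᵍ H'
⊎ᵍ-cong (iso f e) (iso g e') = iso (f ⊎-↔ g)
  λ { (inj₁ u) (inj₁ v) → e u v
    ; (inj₂ u) (inj₂ v) → e' u v
    ; (inj₁ u) (inj₂ v) → refl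
    ; (inj₂ u) (inj₁ v) → refl }

⊎-swap : ∀ {A B : Set} → (A ⊎ B) ↔ (B ⊎ A)
⊎-swap = mk↔ₛ′ sw sw invol invol
  where
  sw : ∀ {A B : Set} → A ⊎ B → B ⊎ A
  sw (inj₁ a) = inj₂ a
  sw (inj₂ b) = inj₁ b
  invol : ∀ {A B : Set} (z : A ⊎ B) → sw (sw z) ≡ z
  invol (inj₁ a) = refl
  invol (inj₂ b) = refl

⊎-swapʳ : ∀ {A B C : Set} → ((A ⊎ B) ⊎ C) ↔ ((A ⊎ C) ⊎ B)
⊎-swapʳ = mk↔ₛ′ sw sw invol invol
  where
  sw : ∀ {A B C : Set} → (A ⊎ B) ⊎ C → (A ⊎ C) ⊎ B
  sw (inj₁ (inj₁ a)) = inj₁ (inj₁ a)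
  sw (inj₁ (inj₂ b)) = inj₂ b
  sw (inj₂ c)        = inj₁ (inj₂ c)
  invol : ∀ {A B C : Set} (z : (A ⊎ B) ⊎ C) → sw (sw z) ≡ z
  invol (inj₁ (inj₁ a)) = refl
  invol (inj₁ (inj₂ b)) = refl
  invol (inj₂ c)        = refl

⊎-assoc : ∀ {A B C : Set} → ((A ⊎ B) ⊎ C) ↔ (A ⊎ (B ⊎ C))
⊎-assoc = mk↔ₛ′ to from (λ { (inj₁ a) → refl ; (inj₂ (inj₁ b)) → refl ; (inj₂ (inj₂ c)) → refl })
                        (λ { (inj₁ (inj₁ a)) → refl ; (inj₁ (inj₂ b)) → refl ; (inj₂ c) → refl })
  where
  to : ∀ {A B C : Set} → (A ⊎ B) ⊎ C → A ⊎ (B ⊎ C)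
  to (inj₁ (inj₁ a)) = inj₁ a
  to (inj₁ (inj₂ b)) = inj₂ (inj₁ b)
  to (inj₂ c)        = inj₂ (inj₂ c)
  from : ∀ {A B C : Set} → A ⊎ (B ⊎ C) → (A ⊎ B) ⊎ C
  from (inj₁ a)        = inj₁ (inj₁ a)
  from (inj₂ (inj₁ b)) = inj₁ (inj₂ b)
  from (inj₂ (inj₂ c)) = inj₂ c

⊎-rotate : ∀ {A B C : Set} → (A ⊎ (B ⊎ C)) ↔ (B ⊎ (A ⊎ C))
⊎-rotate = mk↔ₛ′ sw sw invol invol
  where
  sw : ∀ {A B C : Set} → A ⊎ (B ⊎ C) → B ⊎ (A ⊎ C)
  sw (inj₁ a)        = inj₂ (inj₁ a)
  sw (inj₂ (inj₁ b)) = inj₁ b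
  sw (inj₂ (inj₂ c)) = inj₂ (inj₂ c)
  invol : ∀ {A B C : Set} (z : A ⊎ (B ⊎ C)) → sw (sw z) ≡ z
  invol (inj₁ a)        = refl
  invol (inj₂ (inj₁ b)) = refl
  invol (inj₂ (inj₂ c)) = refl

-- Rerooting across the joining edge; the marks move to the other end, hence `≃` rather than `≃ᵐ`.
link-flip : ∀ G H → link G H ≃ link H G
link-flip G H = iso ⊎-swap λ
  { (inj₁ u) (inj₁ v) → refl
  ; (inj₂ u) (inj₂ v) → refl
  ; (inj₁ u) (inj₂ v) → refl
  ; (inj₂ u) (inj₁ v) → refl }

link-swap : ∀ G H K → link (link G H) K ≃ᵐ link (link G K) H
link-swap G H K = isoᵐ (iso ⊎-swapʳ λ
  { (inj₁ (inj₁ u)) (inj₁ (inj₁ v)) → refl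
  ; (inj₁ (inj₁ u)) (inj₁ (inj₂ v)) → refl
  ; (inj₁ (inj₂ u)) (inj₁ (inj₁ v)) → refl
  ; (inj₁ (inj₂ u)) (inj₁ (inj₂ v)) → refl
  ; (inj₁ (inj₁ u)) (inj₂ v) → refl
  ; (inj₁ (inj₂ u)) (inj₂ v) → sym (∧-zeroʳ _)
  ; (inj₂ u) (inj₁ (inj₁ v)) → refl
  ; (inj₂ u) (inj₁ (inj₂ v)) → ∧-zeroʳ _
  ; (inj₂ u) (inj₂ v) → refl })
  λ { (inj₁ (inj₁ u)) → refl ; (inj₁ (inj₂ u)) → refl ; (inj₂ u) → refl }

gr : RT → MGraph
gr leaf    = point
gr (R ▷ C) = link (gr R) (gr C)

attach-cong : ∀ {R R'} cs → gr R ≃ᵐ gr R' → gr (attach R cs) ≃ᵐ gr (attach R' cs)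
attach-cong []       h = h
attach-cong (c ∷ cs) h = attach-cong cs (link-cong h ≃ᵐ-refl)

attach-↭ : ∀ R {cs cs'} → cs ↭ cs' → gr (attach R cs) ≃ᵐ gr (attach R cs')
attach-↭ R ↭.refl                          = ≃ᵐ-refl
attach-↭ R (↭.prep c h)                    = attach-↭ (R ▷ c) h
attach-↭ R {cs' = _ ∷ _ ∷ ds} (↭.swap c c' h) =
  ≃ᵐ-trans (attach-↭ (R ▷ c ▷ c') h) (attach-cong ds (link-swap (gr R) (gr c) (gr c')))
attach-↭ R (↭.trans h h')                  = ≃ᵐ-trans (attach-↭ R h) (attach-↭ R h')

-- Disjoint unions up to rearrangement.
⊎ᵍ-swapˡ : ∀ G H K → G ⊎ᵍ (H ⊎ᵍ K) ≃ H ⊎ᵍ (G ⊎ᵍ K)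
⊎ᵍ-swapˡ G H K = iso ⊎-rotate λ
  { (inj₁ u) (inj₁ v) → refl
  ; (inj₁ u) (inj₂ (inj₁ v)) → refl
  ; (inj₁ u) (inj₂ (inj₂ v)) → refl
  ; (inj₂ (inj₁ u)) (inj₁ v) → refl
  ; (inj₂ (inj₁ u)) (inj₂ (inj₁ v)) → refl
  ; (inj₂ (inj₁ u)) (inj₂ (inj₂ v)) → refl
  ; (inj₂ (inj₂ u)) (inj₁ v) → refl
  ; (inj₂ (inj₂ u)) (inj₂ (inj₁ v)) → refl
  ; (inj₂ (inj₂ u)) (inj₂ (inj₂ v)) → refl }

⊎ᵍ-comm : ∀ G H → G ⊎ᵍ H ≃ H ⊎ᵍ G
⊎ᵍ-comm G H = iso ⊎-swap λ
  { (inj₁ u) (inj₁ v) → refl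
  ; (inj₂ u) (inj₂ v) → refl
  ; (inj₁ u) (inj₂ v) → refl
  ; (inj₂ u) (inj₁ v) → refl }

⊎ᵍ-assoc : ∀ G H K → (G ⊎ᵍ H) ⊎ᵍ K ≃ G ⊎ᵍ (H ⊎ᵍ K)
⊎ᵍ-assoc G H K = iso ⊎-assoc λ
  { (inj₁ (inj₁ u)) (inj₁ (inj₁ v)) → refl
  ; (inj₁ (inj₁ u)) (inj₁ (inj₂ v)) → refl
  ; (inj₁ (inj₁ u)) (inj₂ v) → refl
  ; (inj₁ (inj₂ u)) (inj₁ (inj₁ v)) → refl
  ; (inj₁ (inj₂ u)) (inj₁ (inj₂ v)) → refl
  ; (inj₁ (inj₂ u)) (inj₂ v) → refl
  ; (inj₂ u) (inj₁ (inj₁ v)) → refl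
  ; (inj₂ u) (inj₁ (inj₂ v)) → refl
  ; (inj₂ u) (inj₂ v) → refl }

forest : List RT → MGraph
forest []       = empty
forest (t ∷ ts) = gr t ⊎ᵍ forest ts

forest-↭ : ∀ {ts ts'} → ts ↭ ts' → forest ts ≃ forest ts'
forest-↭ ↭.refl         = ≃-refl
forest-↭ (↭.prep t h)   = ⊎ᵍ-cong ≃-refl (forest-↭ h)
forest-↭ (↭.swap t t' h) = ≃-trans (⊎ᵍ-swapˡ (gr t) (gr t') _) (⊎ᵍ-cong ≃-refl (⊎ᵍ-cong ≃-refl (forest-↭ h)))
forest-↭ (↭.trans h h') = ≃-trans (forest-↭ h) (forest-↭ h')

⟦_⟧ : ∀ {n} → Graph n → MGraph
⟦ G ⟧ = mgraph (Fin _) (adj G) (λ _ → false)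

≃⇒≅ : ∀ {m n} {G : Graph m} {H : Graph n} → ⟦ G ⟧ ≃ ⟦ H ⟧ → G ≅ H
≃⇒≅ (iso f e) = f , e

≅⇒≃ : ∀ {m n} {G : Graph m} {H : Graph n} → G ≅ H → ⟦ G ⟧ ≃ ⟦ H ⟧
≅⇒≃ (f , e) = iso f e

-- Maximality as a local condition

unique-⊆⇒length-≤ : ∀ {A : Set} {xs ys : List A} → Unique xs → (∀ {z} → z ∈ xs → z ∈ ys) → length xs ≤ length ys
unique-⊆⇒length-≤ []            sub = z≤n
unique-⊆⇒length-≤ {xs = z ∷ xs} (z∉xs ∷ u) sub with ∈-∃++ (sub (here refl))
... | as , bs , refl = ≤-trans (s≤s (≤-trans (unique-⊆⇒length-≤ u sub') (≤-reflexive (length-++ as))))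
                               (≤-reflexive (sym (trans (length-++ as) (+-suc (length as) (length bs)))))
  where
  sub' : ∀ {v} → v ∈ xs → v ∈ as ++ bs
  sub' {v} v∈xs with ∈-++⁻ as (sub (there v∈xs))
  ... | inj₁ v∈as          = ∈-++⁺ˡ v∈as
  ... | inj₂ (here refl)   = ⊥-elim (All.lookup z∉xs v∈xs refl)
  ... | inj₂ (there v∈bs)  = ∈-++⁺ʳ as v∈bs

-- Cardinality witnessed by a duplicate-free list, so that numbers of vertices or of sets that are
-- computed in different ways can be compared by injections.
record Card {A : Set} (P : A → Set) (n : ℕ) : Set where
  constructor card
  field
    elements : List A
    unique   : Unique elements
    sound    : ∀ {z} → z ∈ elements → P z
    complete : ∀ {z} → P z → z ∈ elements
    length≡  : length elements ≡ n
open Card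

Card-≤ : ∀ {A B : Set} {P : A → Set} {Q : B → Set} {m n} (f : A → B) →
         (∀ {a a'} → f a ≡ f a' → a ≡ a') → (∀ {a} → P a → Q (f a)) → Card P m → Card Q n → m ≤ n
Card-≤ f inj pres (card xs u so co refl) (card ys u' so' co' refl) =
  ≤-trans (≤-reflexive (sym (length-map f xs))) (unique-⊆⇒length-≤ (Unique.map⁺ inj u) λ z∈ →
    case ∈-map⁻ f z∈ of λ { (a , a∈ , refl) → co' (pres (so a∈)) })

module _ {A : Set} {P : A → Set} where
  Card-∃ : ∀ {n} → Card P n → 1 ≤ n → ∃ P
  Card-∃ (card (z ∷ _) _ so _ refl) _ = z , so (here refl)

  Card-∃₂ : ∀ {n} → Card P n → 2 ≤ n → ∃₂ λ z z' → z ≢ z' × P z × P z'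
  Card-∃₂ (card (_ ∷ []) _ _ _ refl) (s≤s ())
  Card-∃₂ (card (z ∷ z' ∷ _) (z∉ ∷ _) so _ refl) _ =
    z , z' , All.head z∉ , so (here refl) , so (there (here refl))

  Card-≥1 : ∀ {n} → Card P n → ∃ P → 1 ≤ n
  Card-≥1 (card [] _ _ co refl) (_ , h)       with () ← co h
  Card-≥1 (card (_ ∷ _) _ _ co refl) (_ , h)  = s≤s z≤n

  Card-≥2 : ∀ {n} → Card P n → (∃₂ λ z z' → z ≢ z' × P z × P z') → 2 ≤ n
  Card-≥2 (card xs u _ co refl) (z , z' , z≢z' , h , h') =
    unique-⊆⇒length-≤ {xs = z ∷ z' ∷ []} ((z≢z' ∷ []) ∷ [] ∷ []) λ
      { (here refl) → co h ; (there (here refl)) → co h' }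

module _ (G : MGraph) (χ : V G → Bool) where
  Nbr : V G → V G → Set
  Nbr v u = edge G v u ≡ true × χ u ≡ true

  Two : V G → Set
  Two v = ∃₂ λ u u' → u ≢ u' × Nbr v u × Nbr v u'

  -- An outside vertex is blocked if it would have two neighbours in the set, or would be a second
  -- neighbour of a vertex of the set. Subsets of dissociation sets are dissociation sets, so
  -- testing the addition of single vertices decides maximality.
  Local : V G → Set
  Local v = (χ v ≡ true → ¬ Two v)
          × (χ v ≡ false → Two v ⊎ ∃ λ u → Nbr v u × ∃ (Nbr u))

  LocallyMaximal : Set
  LocallyMaximal = ∀ v → Local v

module _ {n} (G : Graph n) where
  private
    H = ⟦ G ⟧

  deg-card : ∀ S v → Card (Nbr H (lookup S) v) (degIn G S v)
  deg-card S v = card (filter P? (allFin n)) (Unique.filter⁺ P? (Unique.allFin⁺ n))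
    (λ z∈ → case ∈-filter⁻ P? {xs = allFin n} z∈ of λ { (_ , z∈S , e) → e , []=⇒lookup z∈S })
    (λ { (e , z∈S) → ∈-filter⁺ P? (∈-allFin _) (lookup⇒[]= _ S z∈S , e) }) refl
    where
    P? = λ u → (u ∈? S) ×-dec (adj G v u B.≟ true)

  at-most-one⇒dissociation : ∀ S → (∀ v → lookup S v ≡ true → ¬ Two H (lookup S) v) → Dissociation G S
  at-most-one⇒dissociation S h v v∈S with degIn G S v ≤? 1
  ... | yes p = p
  ... | no ¬p = ⊥-elim (h v ([]=⇒lookup v∈S) (Card-∃₂ (deg-card S v) (≰⇒> ¬p)))

  dissociation⇒at-most-one : ∀ S → Dissociation G S → ∀ v → lookup S v ≡ true → ¬ Two H (lookup S) v
  dissociation⇒at-most-one S h v v∈S two = ≤⇒≯ (h v (lookup⇒[]= v S v∈S)) (Card-≥2 (deg-card S v) two)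

  locallyMaximal⇒maximal : ∀ S → LocallyMaximal H (lookup S) → MaximalDissociation G S
  locallyMaximal⇒maximal S lm = at-most-one⇒dissociation S (λ v → proj₁ (lm v)) , bad
    where
    bad : ¬ (∃ λ S′ → Dissociation G S′ × S ⊂ S′)
    bad (S′ , dS′ , S⊆S′ , v , v∈S′ , v∉S) with lookup S v in eq
    ... | true  = v∉S (lookup⇒[]= v S eq)
    ... | false with proj₂ (lm v) eq
    ...   | inj₁ (u , u' , u≢u' , (e , c) , (e' , c')) =
            dissociation⇒at-most-one S′ dS′ v ([]=⇒lookup v∈S′) (u , u' , u≢u' , (e , up c) , (e' , up c'))
      where
      up : ∀ {u} → lookup S u ≡ true → lookup S′ u ≡ true
      up c = []=⇒lookup (S⊆S′ (lookup⇒[]= _ S c))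
    ...   | inj₂ (u , (e , c) , u' , e' , c') =
            dissociation⇒at-most-one S′ dS′ u (up c)
              (v , u' , (λ { refl → case trans (sym eq) c' of λ () }) , (trans (adj-sym G u v) e , []=⇒lookup v∈S′) , (e' , up c'))
      where
      up : ∀ {u} → lookup S u ≡ true → lookup S′ u ≡ true
      up c = []=⇒lookup (S⊆S′ (lookup⇒[]= _ S c))

  -- If `v` is outside and not blocked, then `S⁺` is a larger dissociation set: a vertex with two
  -- neighbours in it would be `v` with two neighbours in `S`, a neighbour of `v` that already has
  -- one in `S`, or a violation in `S` itself.
  maximal⇒locallyMaximal : ∀ S → MaximalDissociation G S → LocallyMaximal H (lookup S)
  maximal⇒locallyMaximal S (dS , max) v = dissociation⇒at-most-one S dS v , out
    where
    χ = lookup S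
    out : χ v ≡ false → Two H χ v ⊎ ∃ λ u → Nbr H χ v u × ∃ (Nbr H χ u)
    out v∉S with 2 ≤? degIn G S v
    ... | yes p = inj₁ (Card-∃₂ (deg-card S v) p)
    ... | no ¬two with any? (λ u → ((adj G v u B.≟ true) ×-dec (χ u B.≟ true)) ×-dec (1 ≤? degIn G S u))
    ...   | yes (u , n , p) = inj₂ (u , n , Card-∃ (deg-card S u) p)
    ...   | no ¬snd = ⊥-elim (max (S⁺ , at-most-one⇒dissociation S⁺ atMost , p⊆p∪q ⁅ v ⁆ , v , q⊆p∪q S ⁅ v ⁆ (x∈⁅x⁆ v)
                                    , λ v∈S → case trans (sym v∉S) ([]=⇒lookup v∈S) of λ ()))
      where
      S⁺ = S ∪ ⁅ v ⁆
      split : ∀ {u} → lookup S⁺ u ≡ true → χ u ≡ true ⊎ u ≡ v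
      split {u} c with x∈p∪q⁻ S ⁅ v ⁆ (lookup⇒[]= u S⁺ c)
      ... | inj₁ u∈S = inj₁ ([]=⇒lookup u∈S)
      ... | inj₂ u∈v = inj₂ (x∈⁅y⁆⇒x≡y v u∈v)
      noTwo : ¬ Two H χ v
      noTwo t = ¬two (Card-≥2 (deg-card S v) t)
      noSnd : ∀ {u u'} → Nbr H χ v u → ¬ Nbr H χ u u'
      noSnd n n' = ¬snd (_ , n , Card-≥1 (deg-card S _) (_ , n'))
      loop : ∀ {u} → adj G u u ≢ true
      loop {u} e = case trans (sym (adj-irrefl G u)) e of λ ()
      flip : ∀ {u u'} → adj G u u' ≡ true → adj G u' u ≡ true
      flip {u} {u'} e = trans (adj-sym G u' u) e
      atMost : ∀ u → lookup S⁺ u ≡ true → ¬ Two H (lookup S⁺) u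
      atMost u u∈S⁺ (z , z' , z≢z' , (e , c) , (e' , c')) with split u∈S⁺ | split c | split c'
      ... | inj₂ refl | inj₂ refl | _         = loop e
      ... | inj₂ refl | _         | inj₂ refl = loop e'
      ... | inj₂ refl | inj₁ i    | inj₁ i'   = noTwo (z , z' , z≢z' , (e , i) , (e' , i'))
      ... | inj₁ k    | inj₁ i    | inj₁ i'   = dissociation⇒at-most-one S dS u k (z , z' , z≢z' , (e , i) , (e' , i'))
      ... | inj₁ k    | inj₂ refl | inj₁ i'   = noSnd (flip e , k) (e' , i')
      ... | inj₁ k    | inj₁ i    | inj₂ refl = noSnd (flip e' , k) (e , i)
      ... | inj₁ k    | inj₂ refl | inj₂ refl = z≢z' refl

allSubsets-complete : ∀ {n} (S : Subset n) → S ∈ allSubsets n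
allSubsets-complete []           = here refl
allSubsets-complete {suc n} (false ∷ S) = ∈-++⁺ˡ (∈-map⁺ (outside ∷_) (allSubsets-complete S))
allSubsets-complete {suc n} (true ∷ S)  = ∈-++⁺ʳ (map (outside ∷_) (allSubsets n)) (∈-map⁺ (inside ∷_) (allSubsets-complete S))

allSubsets-unique : ∀ n → Unique (allSubsets n)
allSubsets-unique zero    = [] ∷ []
allSubsets-unique (suc n) = Unique.++⁺ (Unique.map⁺ (λ { refl → refl }) (allSubsets-unique n))
                                       (Unique.map⁺ (λ { refl → refl }) (allSubsets-unique n))
  λ { (i , j) → case (∈-map⁻ _ i , ∈-map⁻ _ j) of λ { ((_ , _ , refl) , (_ , _ , ())) } }

Φ-card : ∀ {n} (G : Graph n) → Card (MaximalDissociation G) (Φ G)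
Φ-card {n} G = card (filter M? (allSubsets n)) (Unique.filter⁺ M? (allSubsets-unique n))
  (λ z∈ → proj₂ (∈-filter⁻ M? {xs = allSubsets n} z∈)) (λ h → ∈-filter⁺ M? (allSubsets-complete _) h) refl
  where M? = maximalDissociation? G

module _ {G H : MGraph} (i : G ≃ H) where
  private
    f = Inverse.to (bij i)
    f⁻¹ = Inverse.from (bij i)

  Nbr⁺ : ∀ {χ v u} → Nbr G (χ ∘ f) v u → Nbr H χ (f v) (f u)
  Nbr⁺ {u = u} (e , c) = trans (sym (edge≡ i _ u)) e , c

  Nbr⁻ : ∀ {χ v u} → Nbr H χ (f v) u → Nbr G (χ ∘ f) v (f⁻¹ u)
  Nbr⁻ {χ} {v} {u} (e , c) = trans (edge≡ i v (f⁻¹ u)) (trans (cong (edge H (f v)) (inv u)) e) , trans (cong χ (inv u)) c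
    where inv = Inverse.strictlyInverseˡ (bij i)

  f-injective : ∀ {u u'} → f u ≡ f u' → u ≡ u'
  f-injective {u} {u'} eq = trans (sym (Inverse.strictlyInverseʳ (bij i) u)) (trans (cong f⁻¹ eq) (Inverse.strictlyInverseʳ (bij i) u'))

  f⁻¹-injective : ∀ {u u'} → f⁻¹ u ≡ f⁻¹ u' → u ≡ u'
  f⁻¹-injective {u} {u'} eq = trans (sym (Inverse.strictlyInverseˡ (bij i) u)) (trans (cong f eq) (Inverse.strictlyInverseˡ (bij i) u'))

  Two⁺ : ∀ {χ v} → Two G (χ ∘ f) v → Two H χ (f v)
  Two⁺ {χ} (u , u' , u≢u' , n , n') = f u , f u' , u≢u' ∘ f-injective , Nbr⁺ {χ} n , Nbr⁺ {χ} n'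

  Two⁻ : ∀ {χ v} → Two H χ (f v) → Two G (χ ∘ f) v
  Two⁻ {χ} (u , u' , u≢u' , n , n') = f⁻¹ u , f⁻¹ u' , u≢u' ∘ f⁻¹-injective , Nbr⁻ {χ} n , Nbr⁻ {χ} n'

  locallyMaximal-≃ : ∀ {χ} → LocallyMaximal H χ → LocallyMaximal G (χ ∘ f)
  locallyMaximal-≃ {χ} lm v with lm (f v)
  ... | inn , out = (λ c t → inn c (Two⁺ {χ} t)) , λ c → case out c of λ
    { (inj₁ t) → inj₁ (Two⁻ {χ} t)
    ; (inj₂ (u , n , u' , e , c')) → inj₂ (f⁻¹ u , Nbr⁻ {χ} n , f⁻¹ u' ,
        Nbr⁻ {χ} (trans (cong (λ z → edge H z u') (Inverse.strictlyInverseˡ (bij i) u)) e , c')) }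

locallyMaximal-≗ : ∀ {G χ χ'} → (∀ v → χ v ≡ χ' v) → LocallyMaximal G χ → LocallyMaximal G χ'
locallyMaximal-≗ {G} {χ} {χ'} eq lm v with lm v
... | inn , out = (λ c t → inn (trans (eq v) c) (two (sym ∘ eq) t)) , λ c → case out (trans (eq v) c) of λ
  { (inj₁ t) → inj₁ (two eq t)
  ; (inj₂ (u , n , u' , n')) → inj₂ (u , nbr eq n , u' , nbr eq n') }
  where
  nbr : ∀ {χ χ' : V G → Bool} → (∀ v → χ v ≡ χ' v) → ∀ {v u} → Nbr G χ v u → Nbr G χ' v u
  nbr eq {u = u} (e , c) = e , trans (sym (eq u)) c
  two : ∀ {χ χ' : V G → Bool} → (∀ v → χ v ≡ χ' v) → ∀ {v} → Two G χ v → Two G χ' v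
  two eq (u , u' , ne , n , n') = u , u' , ne , nbr eq n , nbr eq n'

-- Subsets of a rooted tree seen from its root

root : ∀ t → V (gr t)
root leaf    = tt
root (R ▷ C) = inj₁ (root R)

mark-root : ∀ t → mark (gr t) (root t) ≡ true
mark-root leaf    = refl
mark-root (R ▷ C) = mark-root R

mark⇒root : ∀ t v → mark (gr t) v ≡ true → v ≡ root t
mark⇒root leaf    tt       _ = refl
mark⇒root (R ▷ C) (inj₁ v) m = cong inj₁ (mark⇒root R v m)

∧-true : ∀ {p q} → p ∧ q ≡ true → p ≡ true × q ≡ true
∧-true {true} {true} refl = refl , refl

∨-true : ∀ {p q} → p ∨ q ≡ true → p ≡ true ⊎ q ≡ true
∨-true {true}  _ = inj₁ refl
∨-true {false} h = inj₂ h

∨-trueˡ : ∀ {p q} → p ≡ true → p ∨ q ≡ true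
∨-trueˡ refl = refl

∨-trueʳ : ∀ {p q} → q ≡ true → p ∨ q ≡ true
∨-trueʳ {true}  _ = refl
∨-trueʳ {false} h = h

≤ᵇ-true : ∀ {m n} → (m ≤ᵇ n) ≡ true → m ≤ n
≤ᵇ-true {m} {n} h = ≤ᵇ⇒≤ m n (Equivalence.from T-≡ h)

true-≤ᵇ : ∀ {m n} → m ≤ n → (m ≤ᵇ n) ≡ true
true-≤ᵇ h = Equivalence.to T-≡ (≤⇒≤ᵇ h)

𝟙 : Bool → ℕ
𝟙 true  = 1
𝟙 false = 0

-- dg t χ k v is the number of neighbours of v in χ, when the root of t has k further neighbours in χ outside t.
dg : ∀ t → (V (gr t) → Bool) → ℕ → V (gr t) → ℕ
dg leaf    χ k v        = k
dg (R ▷ C) χ k (inj₁ v) = dg R (χ ∘ inj₁) (k + 𝟙 (χ (inj₂ (root C)))) v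
dg (R ▷ C) χ k (inj₂ v) = dg C (χ ∘ inj₂) (𝟙 (χ (inj₁ (root R)))) v

-- sc t χ k f v: some neighbour of v in χ has a neighbour in χ; f says so for the neighbours of the root outside t.
sc : ∀ t → (V (gr t) → Bool) → ℕ → Bool → V (gr t) → Bool
sc leaf    χ k f v        = f
sc (R ▷ C) χ k f (inj₁ v) = sc R (χ ∘ inj₁) (k + 𝟙 c) (f ∨ (c ∧ (1 ≤ᵇ dg C (χ ∘ inj₂) (𝟙 (χ (inj₁ (root R)))) (root C)))) v
  where c = χ (inj₂ (root C))
sc (R ▷ C) χ k f (inj₂ v) = sc C (χ ∘ inj₂) (𝟙 r) (r ∧ (1 ≤ᵇ dg R (χ ∘ inj₁) (k + 𝟙 (χ (inj₂ (root C)))) (root R))) v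
  where r = χ (inj₁ (root R))

dg-external : ∀ t χ k v → dg t χ k v ≡ dg t χ 0 v + (if mark (gr t) v then k else 0)
dg-external leaf    χ k v = refl
dg-external (R ▷ C) χ k (inj₂ v) = sym (+-identityʳ _)
dg-external (R ▷ C) χ k (inj₁ v)
  rewrite dg-external R (χ ∘ inj₁) (k + 𝟙 (χ (inj₂ (root C)))) v | dg-external R (χ ∘ inj₁) (𝟙 (χ (inj₂ (root C)))) v
  with mark (gr R) v
... | false = sym (+-identityʳ _)
... | true  = trans (cong (dg R (χ ∘ inj₁) 0 v +_) (+-comm k _)) (sym (+-assoc (dg R (χ ∘ inj₁) 0 v) _ k))

nbrs : ∀ t → (V (gr t) → Bool) → V (gr t) → List (V (gr t))
nbrs leaf    χ v        = []
nbrs (R ▷ C) χ (inj₁ v) = map inj₁ (nbrs R (χ ∘ inj₁) v)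
  ++ (if mark (gr R) v ∧ χ (inj₂ (root C)) then inj₂ (root C) ∷ [] else [])
nbrs (R ▷ C) χ (inj₂ v) = map inj₂ (nbrs C (χ ∘ inj₂) v)
  ++ (if mark (gr C) v ∧ χ (inj₁ (root R)) then inj₁ (root R) ∷ [] else [])

length-nbrs : ∀ t χ v → length (nbrs t χ v) ≡ dg t χ 0 v
length-nbrs leaf    χ v        = refl
length-nbrs (R ▷ C) χ (inj₁ v) =
  trans (length-++ (map inj₁ (nbrs R (χ ∘ inj₁) v)))
  (trans (cong₂ _+_ (trans (length-map inj₁ (nbrs R (χ ∘ inj₁) v)) (length-nbrs R (χ ∘ inj₁) v)) (last (mark (gr R) v) (χ (inj₂ (root C)))))
         (sym (dg-external R (χ ∘ inj₁) _ v)))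
  where
  last : ∀ m c → length (if m ∧ c then inj₂ {A = V (gr R)} (root C) ∷ [] else []) ≡ (if m then 𝟙 c else 0)
  last true true = refl
  last true false = refl
  last false c = refl
length-nbrs (R ▷ C) χ (inj₂ v) =
  trans (length-++ (map inj₂ (nbrs C (χ ∘ inj₂) v)))
  (trans (cong₂ _+_ (trans (length-map inj₂ (nbrs C (χ ∘ inj₂) v)) (length-nbrs C (χ ∘ inj₂) v)) (last (mark (gr C) v) (χ (inj₁ (root R)))))
         (sym (dg-external C (χ ∘ inj₂) _ v)))
  where
  last : ∀ m c → length (if m ∧ c then inj₁ {B = V (gr C)} (root R) ∷ [] else []) ≡ (if m then 𝟙 c else 0)
  last true true = refl
  last true false = refl
  last false c = refl

∈-if : ∀ {A : Set} {z y : A} {q} → z ∈ (if q then y ∷ [] else []) → q ≡ true × z ≡ y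
∈-if {q = true} (here e) = refl , e

if-∈ : ∀ {A : Set} {y : A} {q} → q ≡ true → y ∈ (if q then y ∷ [] else [])
if-∈ refl = here refl

nbrs-sound : ∀ t χ v {u} → u ∈ nbrs t χ v → Nbr (gr t) χ v u
nbrs-sound (R ▷ C) χ (inj₁ v) u∈ with ∈-++⁻ (map inj₁ (nbrs R (χ ∘ inj₁) v)) u∈
... | inj₁ i with ∈-map⁻ inj₁ i
...   | u , j , refl = nbrs-sound R (χ ∘ inj₁) v j
nbrs-sound (R ▷ C) χ (inj₁ v) u∈ | inj₂ i with ∈-if i
... | q , refl with ∧-true {mark (gr R) v} q
...   | m , c = cong₂ _∧_ m (mark-root C) , c
nbrs-sound (R ▷ C) χ (inj₂ v) u∈ with ∈-++⁻ (map inj₂ (nbrs C (χ ∘ inj₂) v)) u∈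
... | inj₁ i with ∈-map⁻ inj₂ i
...   | u , j , refl = nbrs-sound C (χ ∘ inj₂) v j
nbrs-sound (R ▷ C) χ (inj₂ v) u∈ | inj₂ i with ∈-if i
... | q , refl with ∧-true {mark (gr C) v} q
...   | m , c = cong₂ _∧_ m (mark-root R) , c

nbrs-complete : ∀ t χ v {u} → Nbr (gr t) χ v u → u ∈ nbrs t χ v
nbrs-complete (R ▷ C) χ (inj₁ v) {inj₁ u} n = ∈-++⁺ˡ (∈-map⁺ inj₁ (nbrs-complete R (χ ∘ inj₁) v n))
nbrs-complete (R ▷ C) χ (inj₁ v) {inj₂ u} (e , c) with ∧-true {mark (gr R) v} e
... | m , m' with refl ← mark⇒root C u m' = ∈-++⁺ʳ (map inj₁ (nbrs R (χ ∘ inj₁) v)) (if-∈ (cong₂ _∧_ m c))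
nbrs-complete (R ▷ C) χ (inj₂ v) {inj₂ u} n = ∈-++⁺ˡ (∈-map⁺ inj₂ (nbrs-complete C (χ ∘ inj₂) v n))
nbrs-complete (R ▷ C) χ (inj₂ v) {inj₁ u} (e , c) with ∧-true {mark (gr C) v} e
... | m , m' with refl ← mark⇒root R u m' = ∈-++⁺ʳ (map inj₂ (nbrs C (χ ∘ inj₂) v)) (if-∈ (cong₂ _∧_ m c))

if-unique : ∀ {A : Set} {y : A} q → Unique (if q then y ∷ [] else [])
if-unique true  = [] ∷ []
if-unique false = []

nbrs-unique : ∀ t χ v → Unique (nbrs t χ v)
nbrs-unique leaf χ v = []
nbrs-unique (R ▷ C) χ (inj₁ v) = Unique.++⁺ (Unique.map⁺ inj₁-injective (nbrs-unique R (χ ∘ inj₁) v)) (if-unique _)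
  λ { (i , j) → case ∈-map⁻ inj₁ i of λ { (_ , _ , refl) → case proj₂ (∈-if j) of λ () } }
nbrs-unique (R ▷ C) χ (inj₂ v) = Unique.++⁺ (Unique.map⁺ inj₂-injective (nbrs-unique C (χ ∘ inj₂) v)) (if-unique _)
  λ { (i , j) → case ∈-map⁻ inj₂ i of λ { (_ , _ , refl) → case proj₂ (∈-if j) of λ () } }

dg-card : ∀ t χ v → Card (Nbr (gr t) χ v) (dg t χ 0 v)
dg-card t χ v = card (nbrs t χ v) (nbrs-unique t χ v) (nbrs-sound t χ v) (nbrs-complete t χ v) (length-nbrs t χ v)

Second : ∀ t → (V (gr t) → Bool) → ℕ → V (gr t) → Set
Second t χ k v = ∃ λ u → Nbr (gr t) χ v u × 1 ≤ dg t χ k u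

sc-sound : ∀ t χ k f v → sc t χ k f v ≡ true → Second t χ k v ⊎ (mark (gr t) v ≡ true × f ≡ true)
sc-sound leaf    χ k f v h = inj₂ (refl , h)
sc-sound (R ▷ C) χ k f (inj₁ v) h with sc-sound R _ _ _ v h
... | inj₁ (u , n , g) = inj₁ (inj₁ u , n , g)
... | inj₂ (m , g) with ∨-true {f} g
...   | inj₁ hf = inj₂ (m , hf)
...   | inj₂ hc with ∧-true {χ (inj₂ (root C))} hc
...     | c , l = inj₁ (inj₂ (root C) , (cong₂ _∧_ m (mark-root C) , c) , ≤ᵇ-true l)
sc-sound (R ▷ C) χ k f (inj₂ v) h with sc-sound C _ _ _ v h
... | inj₁ (u , n , g) = inj₁ (inj₂ u , n , g)
... | inj₂ (m , g) with ∧-true {χ (inj₁ (root R))} g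
...   | c , l = inj₁ (inj₁ (root R) , (cong₂ _∧_ m (mark-root R) , c) , ≤ᵇ-true l)

sc-complete : ∀ t χ k f v → Second t χ k v ⊎ (mark (gr t) v ≡ true × f ≡ true) → sc t χ k f v ≡ true
sc-complete leaf    χ k f v (inj₁ (_ , (() , _) , _))
sc-complete leaf    χ k f v (inj₂ (_ , h)) = h
sc-complete (R ▷ C) χ k f (inj₁ v) (inj₁ (inj₁ u , n , g)) = sc-complete R _ _ _ v (inj₁ (u , n , g))
sc-complete (R ▷ C) χ k f (inj₁ v) (inj₁ (inj₂ u , (e , c) , g)) with ∧-true {mark (gr R) v} e
... | m , m' with refl ← mark⇒root C u m' = sc-complete R _ _ _ v (inj₂ (m , ∨-trueʳ {f} (cong₂ _∧_ c (true-≤ᵇ g))))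
sc-complete (R ▷ C) χ k f (inj₁ v) (inj₂ (m , h)) = sc-complete R _ _ _ v (inj₂ (m , ∨-trueˡ h))
sc-complete (R ▷ C) χ k f (inj₂ v) (inj₁ (inj₂ u , n , g)) = sc-complete C _ _ _ v (inj₁ (u , n , g))
sc-complete (R ▷ C) χ k f (inj₂ v) (inj₁ (inj₁ u , (e , c) , g)) with ∧-true {mark (gr C) v} e
... | m , m' with refl ← mark⇒root R u m' = sc-complete C _ _ _ v (inj₂ (m , cong₂ _∧_ c (true-≤ᵇ g)))
sc-complete (R ▷ C) χ k f (inj₂ v) (inj₂ (() , _))

-- The local condition at a vertex with `g` neighbours in the set, where `f` tells whether one of
-- these has a neighbour in the set.
ok : Bool → ℕ → Bool → Bool
ok true  g f = g ≤ᵇ 1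
ok false g f = (2 ≤ᵇ g) ∨ f

Fine : ∀ t → (V (gr t) → Bool) → ℕ → Bool → Set
Fine t χ k f = ∀ v → ok (χ v) (dg t χ k v) (sc t χ k f v) ≡ true

fine⇒locallyMaximal : ∀ t χ → Fine t χ 0 false → LocallyMaximal (gr t) χ
fine⇒locallyMaximal t χ fine v = inn , out
  where
  inn : χ v ≡ true → ¬ Two (gr t) χ v
  inn c two with χ v | fine v
  ... | true | h = ≤⇒≯ (≤ᵇ-true h) (Card-≥2 (dg-card t χ v) two)
  out : χ v ≡ false → Two (gr t) χ v ⊎ ∃ λ u → Nbr (gr t) χ v u × ∃ (Nbr (gr t) χ u)
  out c with χ v | fine v
  ... | false | h with ∨-true {2 ≤ᵇ dg t χ 0 v} h
  ...   | inj₁ two = inj₁ (Card-∃₂ (dg-card t χ v) (≤ᵇ-true two))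
  ...   | inj₂ s with sc-sound t χ 0 false v s
  ...     | inj₁ (u , n , g) = inj₂ (u , n , Card-∃ (dg-card t χ u) g)

locallyMaximal⇒fine : ∀ t χ → LocallyMaximal (gr t) χ → Fine t χ 0 false
locallyMaximal⇒fine t χ lm v with χ v | lm v
... | true  | inn , _ with dg t χ 0 v in eq
...   | 0 = refl
...   | 1 = refl
...   | suc (suc _) = ⊥-elim (inn refl (Card-∃₂ (dg-card t χ v) (subst (2 ≤_) (sym eq) (s≤s (s≤s z≤n)))))
locallyMaximal⇒fine t χ lm v | false | _ , out with out refl
... | inj₁ two = ∨-trueˡ (true-≤ᵇ (Card-≥2 (dg-card t χ v) two))
... | inj₂ (u , n , w) = ∨-trueʳ {2 ≤ᵇ dg t χ 0 v} (sc-complete t χ 0 false v (inj₁ (u , n , Card-≥1 (dg-card t χ u) w)))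

-- What a set looks like from the root of a subtree, all other vertices of the subtree being settled:
-- the root is in the set with no neighbour (alone), likewise but some child still needs it to get one
-- (needy), in the set with one neighbour (paired), or outside it and blocked (blocked), in want of one
-- more neighbour in the set (half), or without neighbours in the set (bare).
data Class : Set where
  alone needy paired blocked half bare dead : Class

-- For example, under an `alone` root a `bare` child has the root as its only neighbour in the set
-- and is blocked only once the root gets a partner, hence `needy`; under a root outside the set a
-- `half` child can no longer get its missing neighbour, hence `dead`.
comb : Class → Class → Class
comb alone   blocked = alone
comb alone   half    = alone
comb alone   bare    = needy
comb alone   alone   = paired
comb alone   needy   = paired
comb needy   blocked = needy
comb needy   half    = needy
comb needy   bare    = needy
comb needy   alone   = paired
comb needy   needy   = paired
comb paired  blocked = paired
comb paired  half    = paired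
comb paired  bare    = paired
comb blocked alone   = blocked
comb blocked paired  = blocked
comb blocked blocked = blocked
comb half    alone   = blocked
comb half    paired  = blocked
comb half    blocked = half
comb bare    alone   = half
comb bare    paired  = blocked
comb bare    blocked = bare
comb _       _       = dead

inside? : Class → Bool
inside? alone  = true
inside? needy  = true
inside? paired = true
inside? _      = false

inner : Class → ℕ
inner paired = 1
inner _      = 0

-- Here `k` is the number of neighbours of the root in the set outside the subtree, and `f` tells
-- whether one of these has a neighbour in the set. A `needy` root wants `k` to be exactly 1: its
-- child is owed one, and two would exceed the degree bound.
accepts : Class → ℕ → Bool → Bool
accepts alone   k f = k ≤ᵇ 1
accepts needy   k f = k ≡ᵇ 1
accepts paired  k f = k ≡ᵇ 0
accepts blocked k f = true
accepts half    k f = (1 ≤ᵇ k) ∨ f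
accepts bare    k f = (2 ≤ᵇ k) ∨ f
accepts dead    k f = false

every : (Class → Bool) → Bool
every P = P alone ∧ P needy ∧ P paired ∧ P blocked ∧ P half ∧ P bare ∧ P dead

every⇒ : ∀ P → T (every P) → ∀ c → T (P c)
every⇒ P h c with P alone in e₁ | P needy in e₂ | P paired in e₃ | P blocked in e₄ | P half in e₅ | P bare in e₆ | P dead in e₇
every⇒ P h alone   | true | true | true | true | true | true | true rewrite e₁ = tt
every⇒ P h needy   | true | true | true | true | true | true | true rewrite e₂ = tt
every⇒ P h paired  | true | true | true | true | true | true | true rewrite e₃ = tt
every⇒ P h blocked | true | true | true | true | true | true | true rewrite e₄ = tt
every⇒ P h half    | true | true | true | true | true | true | true rewrite e₅ = tt
every⇒ P h bare    | true | true | true | true | true | true | true rewrite e₆ = tt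
every⇒ P h dead    | true | true | true | true | true | true | true rewrite e₇ = tt

same : Bool → Bool → Bool
same p q = not (p xor q)

same⇒≡ : ∀ p q → T (same p q) → p ≡ q
same⇒≡ true  true  _ = refl
same⇒≡ false false _ = refl

-- The environment of `R ▷ C` distributed over the two halves, each of which enters the environment
-- of the other through its root.
split : Class → Class → ℕ → Bool → Bool
split c c' k f = accepts c (k + 𝟙 (inside? c')) (f ∨ (inside? c' ∧ (1 ≤ᵇ 𝟙 (inside? c) + inner c')))
               ∧ accepts c' (𝟙 (inside? c)) (inside? c ∧ (1 ≤ᵇ k + 𝟙 (inside? c') + inner c))

accepts-comb : ∀ c c' k f → accepts (comb c c') k f ≡ split c c' k f
accepts-comb c c' k f = same⇒≡ _ _ (every⇒ (P k f c) (every⇒ (λ c → every (P k f c)) (table k f) c) c')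
  where
  P : ℕ → Bool → Class → Class → Bool
  P k f c c' = same (accepts (comb c c') k f) (split c c' k f)
  -- From `k = 2` on every test computes with the rest of `k` left symbolic, so these six cases
  -- cover all environments.
  table : ∀ k f → T (every λ c → every (P k f c))
  table 0 false = _
  table 0 true = _
  table 1 false = _
  table 1 true = _
  table (suc (suc k)) false = _
  table (suc (suc k)) true = _

cls : ∀ t → (V (gr t) → Bool) → Class
cls leaf    χ = if χ tt then alone else bare
cls (R ▷ C) χ = comb (cls R (χ ∘ inj₁)) (cls C (χ ∘ inj₂))

children : ∀ t → (V (gr t) → Bool) → ℕ
children leaf    χ = 0
children (R ▷ C) χ = children R (χ ∘ inj₁) + 𝟙 (χ (inj₂ (root C)))

dg-root : ∀ t χ k → dg t χ k (root t) ≡ k + children t χ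
dg-root leaf    χ k = sym (+-identityʳ k)
dg-root (R ▷ C) χ k = trans (dg-root R _ _) (trans (+-assoc k _ _) (cong (k +_) (+-comm _ (children R _))))

alive : Class → Bool
alive dead = false
alive _    = true

-- For a root outside the set the class does not determine the number of its children in the set:
-- `blocked` arises from one paired child as well as from several children. The count is therefore
-- claimed for roots inside only.
record RootState (c : Class) (r : Bool) (n : ℕ) : Set where
  constructor rootState
  field
    in≡ : r ≡ inside? c
    ch≡ : inside? c ≡ true → n ≡ inner c
open RootState

comb-state : ∀ c c' → alive (comb c c') ≡ true →
  alive c ≡ true × alive c' ≡ true × inside? (comb c c') ≡ inside? c
  × (inside? c ≡ true → inner c + 𝟙 (inside? c') ≡ inner (comb c c'))
comb-state c c' a with every⇒ (P c) (every⇒ (λ c → every (P c)) _ c) c'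
  where
  P : Class → Class → Bool
  P c c' = not (alive (comb c c')) ∨ (alive c ∧ alive c' ∧ same (inside? (comb c c')) (inside? c)
                                    ∧ (not (inside? c) ∨ (inner c + 𝟙 (inside? c') ≡ᵇ inner (comb c c'))))
... | h rewrite a with ∧-true {alive c} (Equivalence.to T-≡ h)
...   | a₁ , h₁ with ∧-true {alive c'} h₁
...     | a₂ , h₂ with ∧-true {same (inside? (comb c c')) (inside? c)} h₂
...       | s , h₃ = a₁ , a₂ , same⇒≡ _ _ (Equivalence.from T-≡ s) , λ i →
  ≡ᵇ⇒≡ _ _ (Equivalence.from T-≡ (subst (λ z → not z ∨ (inner c + 𝟙 (inside? c') ≡ᵇ inner (comb c c')) ≡ true) i h₃))

cls-state : ∀ t χ → alive (cls t χ) ≡ true → RootState (cls t χ) (χ (root t)) (children t χ)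
cls-state leaf χ a with χ tt
... | true  = rootState refl λ _ → refl
... | false = rootState refl λ ()
cls-state (R ▷ C) χ a with comb-state (cls R (χ ∘ inj₁)) (cls C (χ ∘ inj₂)) a
... | a₁ , a₂ , e , n with cls-state R (χ ∘ inj₁) a₁ | cls-state C (χ ∘ inj₂) a₂
...   | rootState i j | rootState i' j' = rootState (trans i (sym e)) λ h →
  trans (cong₂ _+_ (j (trans (sym e) h)) (cong 𝟙 i')) (n (trans (sym e) h))

-- A dead half says nothing about its root, so root states are assumed for live halves; with a dead
-- half both sides are `false`.
settle : ∀ c c' {r r' n n'} k f → (alive c ≡ true → RootState c r n) → (alive c' ≡ true → RootState c' r' n') →
  accepts c (k + 𝟙 r') (f ∨ (r' ∧ (1 ≤ᵇ 𝟙 r + n'))) ∧ accepts c' (𝟙 r) (r ∧ (1 ≤ᵇ k + 𝟙 r' + n))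
  ≡ accepts (comb c c') k f
settle c c' {r} {r'} {n} {n'} k f h h' = trans (lemma c c' h h') (sym (accepts-comb c c' k f))
  where
  guard : ∀ i {m m'} {g : ℕ → ℕ} → (i ≡ true → m ≡ m') → (i ∧ (1 ≤ᵇ g m)) ≡ (i ∧ (1 ≤ᵇ g m'))
  guard true  e rewrite e refl = refl
  guard false e = refl
  live : ∀ c c' → RootState c r n → RootState c' r' n' →
    accepts c (k + 𝟙 r') (f ∨ (r' ∧ (1 ≤ᵇ 𝟙 r + n'))) ∧ accepts c' (𝟙 r) (r ∧ (1 ≤ᵇ k + 𝟙 r' + n)) ≡ split c c' k f
  live c c' (rootState refl j) (rootState refl j') =
    cong₂ (λ p q → accepts c (k + 𝟙 (inside? c')) (f ∨ p) ∧ accepts c' (𝟙 (inside? c)) q)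
      (guard (inside? c') {g = 𝟙 (inside? c) +_} j') (guard (inside? c) {g = k + 𝟙 (inside? c') +_} j)
  lemma : ∀ c c' → (alive c ≡ true → RootState c r n) → (alive c' ≡ true → RootState c' r' n') →
    accepts c (k + 𝟙 r') (f ∨ (r' ∧ (1 ≤ᵇ 𝟙 r + n'))) ∧ accepts c' (𝟙 r) (r ∧ (1 ≤ᵇ k + 𝟙 r' + n)) ≡ split c c' k f
  lemma c c' h h' with alive c in e | alive c' in e'
  ... | true  | true  = live c c' (h refl) (h' refl)
  lemma dead c' h h' | false | _ = refl
  lemma c dead h h' | true | false = trans (∧-zeroʳ _) (sym (∧-zeroʳ _))

fine⇔accepts : ∀ t χ k f → Fine t χ k f ⇔ (accepts (cls t χ) k f ≡ true)
fine⇔accepts leaf χ k f with χ tt in e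
... | true  = mk⇔ (λ h → subst (λ c → ok c k f ≡ true) e (h tt)) (λ h _ → subst (λ c → ok c k f ≡ true) (sym e) h)
... | false = mk⇔ (λ h → subst (λ c → ok c k f ≡ true) e (h tt)) (λ h _ → subst (λ c → ok c k f ≡ true) (sym e) h)
fine⇔accepts (R ▷ C) χ k f = mk⇔
  (λ h → trans (sym eq) (cong₂ _∧_ (Equivalence.to (fine⇔accepts R _ _ _) (h ∘ inj₁)) (Equivalence.to (fine⇔accepts C _ _ _) (h ∘ inj₂))))
  (λ h → case ∧-true {accepts (cls R (χ ∘ inj₁)) _ _} (trans eq h) of λ (p , q) → λ
    { (inj₁ v) → Equivalence.from (fine⇔accepts R _ _ _) p v
    ; (inj₂ v) → Equivalence.from (fine⇔accepts C _ _ _) q v })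
  where
  ρ = χ (inj₁ (root R))
  ρ' = χ (inj₂ (root C))
  eq : accepts (cls R (χ ∘ inj₁)) (k + 𝟙 ρ') (f ∨ (ρ' ∧ (1 ≤ᵇ dg C (χ ∘ inj₂) (𝟙 ρ) (root C))))
       ∧ accepts (cls C (χ ∘ inj₂)) (𝟙 ρ) (ρ ∧ (1 ≤ᵇ dg R (χ ∘ inj₁) (k + 𝟙 ρ') (root R)))
       ≡ accepts (cls (R ▷ C) χ) k f
  eq rewrite dg-root C (χ ∘ inj₂) (𝟙 ρ) | dg-root R (χ ∘ inj₁) (k + 𝟙 ρ') =
    settle (cls R (χ ∘ inj₁)) (cls C (χ ∘ inj₂)) k f (cls-state R _) (cls-state C _)

-- Subsets as nested pairs instead of functions: pointwise equal ones are then equal without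
-- function extensionality, and those of `R ▷ C` form a cartesian product, which makes counting
-- bilinear.
Sub : RT → Set
Sub leaf    = Bool
Sub (R ▷ C) = Sub R × Sub C

⟪_⟫ : ∀ {t} → Sub t → V (gr t) → Bool
⟪_⟫ {leaf}  σ        tt       = σ
⟪_⟫ {R ▷ C} (σ , τ) (inj₁ v) = ⟪ σ ⟫ v
⟪_⟫ {R ▷ C} (σ , τ) (inj₂ v) = ⟪ τ ⟫ v

encode : ∀ {t} → (V (gr t) → Bool) → Sub t
encode {leaf}  χ = χ tt
encode {R ▷ C} χ = encode (χ ∘ inj₁) , encode (χ ∘ inj₂)

⟪encode⟫ : ∀ {t} χ v → ⟪ encode {t} χ ⟫ v ≡ χ v
⟪encode⟫ {leaf}  χ tt       = refl
⟪encode⟫ {R ▷ C} χ (inj₁ v) = ⟪encode⟫ {R} (χ ∘ inj₁) v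
⟪encode⟫ {R ▷ C} χ (inj₂ v) = ⟪encode⟫ {C} (χ ∘ inj₂) v

⟪⟫-injective : ∀ {t} {σ τ : Sub t} → (∀ v → ⟪ σ ⟫ v ≡ ⟪ τ ⟫ v) → σ ≡ τ
⟪⟫-injective {leaf}  h = h tt
⟪⟫-injective {R ▷ C} h = cong₂ _,_ (⟪⟫-injective (h ∘ inj₁)) (⟪⟫-injective (h ∘ inj₂))

subs : ∀ t → List (Sub t)
subs leaf    = false ∷ true ∷ []
subs (R ▷ C) = cartesianProduct (subs R) (subs C)

subs-complete : ∀ {t} (σ : Sub t) → σ ∈ subs t
subs-complete {leaf}  false = here refl
subs-complete {leaf}  true  = there (here refl)
subs-complete {R ▷ C} (σ , τ) = ∈-cartesianProduct⁺ (subs-complete σ) (subs-complete τ)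

subs-unique : ∀ t → Unique (subs t)
subs-unique leaf    = ((λ ()) ∷ []) ∷ [] ∷ []
subs-unique (R ▷ C) = Unique.cartesianProduct⁺ (subs-unique R) (subs-unique C)

∑ : ∀ {A : Set} → (A → ℕ) → List A → ℕ
∑ f []       = 0
∑ f (z ∷ zs) = f z + ∑ f zs

∑-++ : ∀ {A : Set} (f : A → ℕ) xs ys → ∑ f (xs ++ ys) ≡ ∑ f xs + ∑ f ys
∑-++ f []       ys = refl
∑-++ f (x ∷ xs) ys = trans (cong (f x +_) (∑-++ f xs ys)) (sym (+-assoc (f x) _ _))

∑-map : ∀ {A B : Set} (f : B → ℕ) (g : A → B) xs → ∑ f (map g xs) ≡ ∑ (f ∘ g) xs
∑-map f g []       = refl
∑-map f g (x ∷ xs) = cong (f (g x) +_) (∑-map f g xs)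

∑-cong : ∀ {A : Set} {f g : A → ℕ} → (∀ z → f z ≡ g z) → ∀ xs → ∑ f xs ≡ ∑ g xs
∑-cong h []       = refl
∑-cong h (x ∷ xs) = cong₂ _+_ (h x) (∑-cong h xs)

∑-product : ∀ {A B : Set} (f : A × B → ℕ) xs ys → ∑ f (cartesianProduct xs ys) ≡ ∑ (λ a → ∑ (λ b → f (a , b)) ys) xs
∑-product f []       ys = refl
∑-product f (x ∷ xs) ys = trans (∑-++ f (map (x ,_) ys) _) (cong₂ _+_ (∑-map f (x ,_) ys) (∑-product f xs ys))

∑-scale : ∀ {A : Set} k (f : A → ℕ) xs → ∑ (λ z → k * f z) xs ≡ k * ∑ f xs
∑-scale k f []       = sym (*-zeroʳ k)
∑-scale k f (x ∷ xs) = trans (cong (k * f x +_) (∑-scale k f xs)) (sym (*-distribˡ-+ k (f x) _))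

∑-card : ∀ {A : Set} {P : A → Bool} {xs} → Unique xs → (∀ z → z ∈ xs) → Card (λ z → P z ≡ true) (∑ (𝟙 ∘ P) xs)
∑-card {A} {P} {xs} u co = card (filter P? xs) (Unique.filter⁺ P? u) (λ z∈ → proj₂ (∈-filter⁻ P? {xs = xs} z∈))
  (λ h → ∈-filter⁺ P? (co _) h) (len xs)
  where
  P? = λ z → P z B.≟ true
  len : ∀ xs → length (filter P? xs) ≡ ∑ (𝟙 ∘ P) xs
  len [] = refl
  len (x ∷ xs) with P x
  ... | true  = cong suc (len xs)
  ... | false = len xs

is : Class → Class → Bool
is alone alone = true
is needy needy = true
is paired paired = true
is blocked blocked = true
is half half = true
is bare bare = true
is dead dead = true
is _ _ = false

# : ∀ t → Class → ℕ
# t c = ∑ (λ σ → 𝟙 (is c (cls t ⟪ σ ⟫))) (subs t)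

-- The zero coefficients come first in the products, so that they disappear by computation.
total : (Class → ℕ) → ℕ
total g = g alone + (g needy + (g paired + (g blocked + (g half + (g bare + (g dead + 0))))))

∑-class : ∀ {A : Set} (h : A → Class) (g : Class → ℕ) xs →
  ∑ (g ∘ h) xs ≡ total λ c → g c * ∑ (λ z → 𝟙 (is c (h z))) xs
∑-class h g [] = lemma (g alone) (g needy) (g paired) (g blocked) (g half) (g bare) (g dead)
  where
  lemma : ∀ a b d e i j k → 0 ≡ a * 0 + (b * 0 + (d * 0 + (e * 0 + (i * 0 + (j * 0 + (k * 0 + 0))))))
  lemma = solve-∀
∑-class h g (x ∷ xs) = trans (cong₂ _+_ (unit (h x)) (∑-class h g xs))
  (add (g alone) (g needy) (g paired) (g blocked) (g half) (g bare) (g dead)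
    (δ alone) (δ needy) (δ paired) (δ blocked) (δ half) (δ bare) (δ dead)
    (N alone) (N needy) (N paired) (N blocked) (N half) (N bare) (N dead))
  where
  N δ : Class → ℕ
  N c = ∑ (λ z → 𝟙 (is c (h z))) xs
  δ c = 𝟙 (is c (h x))
  add : ∀ g₁ g₂ g₃ g₄ g₅ g₆ g₇ u₁ u₂ u₃ u₄ u₅ u₆ u₇ n₁ n₂ n₃ n₄ n₅ n₆ n₇ →
    (u₁ * g₁ + (u₂ * g₂ + (u₃ * g₃ + (u₄ * g₄ + (u₅ * g₅ + (u₆ * g₆ + (u₇ * g₇ + 0)))))))
    + (g₁ * n₁ + (g₂ * n₂ + (g₃ * n₃ + (g₄ * n₄ + (g₅ * n₅ + (g₆ * n₆ + (g₇ * n₇ + 0)))))))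
    ≡ g₁ * (u₁ + n₁) + (g₂ * (u₂ + n₂) + (g₃ * (u₃ + n₃) + (g₄ * (u₄ + n₄) + (g₅ * (u₅ + n₅) + (g₆ * (u₆ + n₆) + (g₇ * (u₇ + n₇) + 0))))))
  add = solve-∀
  unit : ∀ c → g c ≡ total λ c' → 𝟙 (is c' c) * g c'
  unit alone   = sym (trans (+-identityʳ _) (+-identityʳ _))
  unit needy   = sym (trans (+-identityʳ _) (+-identityʳ _))
  unit paired  = sym (trans (+-identityʳ _) (+-identityʳ _))
  unit blocked = sym (trans (+-identityʳ _) (+-identityʳ _))
  unit half    = sym (trans (+-identityʳ _) (+-identityʳ _))
  unit bare    = sym (trans (+-identityʳ _) (+-identityʳ _))
  unit dead    = sym (trans (+-identityʳ _) (+-identityʳ _))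

-- Dead sets have no field in `Counts`, so their number stands for itself. It never enters another
-- class, since `comb` with a dead argument is dead.
count : RT → Class → ℕ
count t alone   = Counts.a₀ (cnt t)
count t needy   = Counts.a₁ (cnt t)
count t paired  = Counts.b (cnt t)
count t blocked = Counts.d (cnt t)
count t half    = Counts.x (cnt t)
count t bare    = Counts.y (cnt t)
count t dead    = # t dead

combine : (Class → ℕ) → (Class → ℕ) → Class → ℕ
combine M N c = total λ c₀ → (total λ c' → 𝟙 (is c (comb c₀ c')) * N c') * M c₀

#-▷ : ∀ R C c → # (R ▷ C) c ≡ combine (# R) (# C) c
#-▷ R C c = trans (∑-product _ (subs R) (subs C))
  (trans (∑-cong (λ σ → ∑-class (λ τ → cls C ⟪ τ ⟫) (λ c' → 𝟙 (is c (comb (cls R ⟪ σ ⟫) c'))) (subs C)) (subs R))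
         (∑-class (λ σ → cls R ⟪ σ ⟫) (λ c₀ → total λ c' → 𝟙 (is c (comb c₀ c')) * # C c') (subs R)))

combine-cong : ∀ {M M' N N'} → (∀ c → M c ≡ M' c) → (∀ c → N c ≡ N' c) → ∀ c → combine M N c ≡ combine M' N' c
combine-cong hM hN c rewrite hM alone | hM needy | hM paired | hM blocked | hM half | hM bare | hM dead
  | hN alone | hN needy | hN paired | hN blocked | hN half | hN bare | hN dead = refl

#≡count : ∀ t c → # t c ≡ count t c
#≡count leaf    alone   = refl
#≡count leaf    needy   = refl
#≡count leaf    paired  = refl
#≡count leaf    blocked = refl
#≡count leaf    half    = refl
#≡count leaf    bare    = refl
#≡count t       dead    = refl
#≡count (R ▷ C) c       = trans (#-▷ R C c) (trans (combine-cong (#≡count R) (#≡count C) c) (formula c))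
  where
  open Counts
  formula : ∀ c → combine (count R) (count C) c ≡ count (R ▷ C) c
  formula alone = lemma (a₀ (cnt R)) (d (cnt C)) (x (cnt C))
    where
    lemma : ∀ A d x → (1 * d + (1 * x + 0)) * A + 0 ≡ A * (d + x)
    lemma = solve-∀
  formula needy = lemma (a₀ (cnt R)) (a₁ (cnt R)) (d (cnt C)) (x (cnt C)) (y (cnt C))
    where
    lemma : ∀ A A' d x y → (1 * y + 0) * A + ((1 * d + (1 * x + (1 * y + 0))) * A' + 0) ≡ A * y + A' * (d + x + y)
    lemma = solve-∀
  formula paired = lemma (a₀ (cnt R)) (a₁ (cnt R)) (b (cnt R)) (a₀ (cnt C)) (a₁ (cnt C)) (d (cnt C)) (x (cnt C)) (y (cnt C))
    where
    lemma : ∀ A A' B a a' d x y → (1 * a + (1 * a' + 0)) * A + ((1 * a + (1 * a' + 0)) * A' + ((1 * d + (1 * x + (1 * y + 0))) * B + 0))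
      ≡ B * (d + x + y) + (A + A') * (a + a')
    lemma = solve-∀
  formula blocked = lemma (d (cnt R)) (x (cnt R)) (y (cnt R)) (a₀ (cnt C)) (b (cnt C)) (d (cnt C))
    where
    lemma : ∀ D X Y a b d → (1 * a + (1 * b + (1 * d + 0))) * D + ((1 * a + (1 * b + 0)) * X + ((1 * b + 0) * Y + 0))
      ≡ D * (a + b + d) + X * (a + b) + Y * b
    lemma = solve-∀
  formula half = lemma (x (cnt R)) (y (cnt R)) (a₀ (cnt C)) (d (cnt C))
    where
    lemma : ∀ X Y a d → (1 * d + 0) * X + ((1 * a + 0) * Y + 0) ≡ X * d + Y * a
    lemma = solve-∀
  formula bare = lemma (y (cnt R)) (d (cnt C))
    where
    lemma : ∀ Y d → (1 * d + 0) * Y + 0 ≡ Y * d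
    lemma = solve-∀
  formula dead = trans (sym (combine-cong (#≡count R) (#≡count C) dead)) (sym (#-▷ R C dead))

good : ∀ t → Sub t → Bool
good t σ = accepts (cls t ⟪ σ ⟫) 0 false

∑-good : ∀ t → ∑ (𝟙 ∘ good t) (subs t) ≡ φ t
∑-good t = trans (∑-class (λ σ → cls t ⟪ σ ⟫) (λ c → 𝟙 (accepts c 0 false)) (subs t))
  (trans (cong₂ _+_ (cong (_+ 0) (#≡count t alone)) (cong₂ _+_ (cong (_+ 0) (#≡count t paired)) (cong (λ z → z + 0 + 0) (#≡count t blocked))))
         (lemma (count t alone) (count t paired) (count t blocked)))
  where
  lemma : ∀ a b d → 1 * a + (1 * b + (1 * d + 0)) ≡ a + b + d
  lemma = solve-∀

good⇔ : ∀ t σ → good t σ ≡ true ⇔ LocallyMaximal (gr t) ⟪ σ ⟫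
good⇔ t σ = mk⇔ (λ h → fine⇒locallyMaximal t _ (Equivalence.from (fine⇔accepts t _ 0 false) h))
                (λ h → Equivalence.to (fine⇔accepts t _ 0 false) (locallyMaximal⇒fine t _ h))

-- Multiplicativity over components and invariance under isomorphism

∏φ : List RT → ℕ
∏φ []       = 1
∏φ (t ∷ ts) = φ t * ∏φ ts

Subᶠ : List RT → Set
Subᶠ []       = ⊤
Subᶠ (t ∷ ts) = Sub t × Subᶠ ts

charᶠ : ∀ ts → Subᶠ ts → V (forest ts) → Bool
charᶠ (t ∷ ts) (σ , τ) (inj₁ v) = ⟪ σ ⟫ v
charᶠ (t ∷ ts) (σ , τ) (inj₂ v) = charᶠ ts τ v

encodeᶠ : ∀ ts → (V (forest ts) → Bool) → Subᶠ ts
encodeᶠ []       χ = tt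
encodeᶠ (t ∷ ts) χ = encode (χ ∘ inj₁) , encodeᶠ ts (χ ∘ inj₂)

char-encodeᶠ : ∀ ts χ v → charᶠ ts (encodeᶠ ts χ) v ≡ χ v
char-encodeᶠ (t ∷ ts) χ (inj₁ v) = ⟪encode⟫ {t} (χ ∘ inj₁) v
char-encodeᶠ (t ∷ ts) χ (inj₂ v) = char-encodeᶠ ts (χ ∘ inj₂) v

char-injective : ∀ ts {σ τ} → (∀ v → charᶠ ts σ v ≡ charᶠ ts τ v) → σ ≡ τ
char-injective []       h = refl
char-injective (t ∷ ts) h = cong₂ _,_ (⟪⟫-injective {t} (h ∘ inj₁)) (char-injective ts (h ∘ inj₂))

subsᶠ : ∀ ts → List (Subᶠ ts)
subsᶠ []       = tt ∷ []
subsᶠ (t ∷ ts) = cartesianProduct (subs t) (subsᶠ ts)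

subsᶠ-complete : ∀ ts σ → σ ∈ subsᶠ ts
subsᶠ-complete []       tt      = here refl
subsᶠ-complete (t ∷ ts) (σ , τ) = ∈-cartesianProduct⁺ (subs-complete {t} σ) (subsᶠ-complete ts τ)

subsᶠ-unique : ∀ ts → Unique (subsᶠ ts)
subsᶠ-unique []       = [] ∷ []
subsᶠ-unique (t ∷ ts) = Unique.cartesianProduct⁺ (subs-unique t) (subsᶠ-unique ts)

goodᶠ : ∀ ts → Subᶠ ts → Bool
goodᶠ []       _       = true
goodᶠ (t ∷ ts) (σ , τ) = good t σ ∧ goodᶠ ts τ

𝟙-∧ : ∀ p q → 𝟙 (p ∧ q) ≡ 𝟙 p * 𝟙 q
𝟙-∧ true  q = sym (+-identityʳ _)
𝟙-∧ false q = refl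

∑-goodᶠ : ∀ ts → ∑ (𝟙 ∘ goodᶠ ts) (subsᶠ ts) ≡ ∏φ ts
∑-goodᶠ []       = refl
∑-goodᶠ (t ∷ ts) = begin
  ∑ (𝟙 ∘ goodᶠ (t ∷ ts)) (cartesianProduct (subs t) (subsᶠ ts))
    ≡⟨ ∑-product _ (subs t) (subsᶠ ts) ⟩
  ∑ (λ σ → ∑ (λ τ → 𝟙 (good t σ ∧ goodᶠ ts τ)) (subsᶠ ts)) (subs t)
    ≡⟨ ∑-cong (λ σ → trans (∑-cong (λ τ → 𝟙-∧ (good t σ) (goodᶠ ts τ)) (subsᶠ ts))
                     (trans (∑-scale (𝟙 (good t σ)) (𝟙 ∘ goodᶠ ts) (subsᶠ ts)) (*-comm (𝟙 (good t σ)) _))) (subs t) ⟩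
  ∑ (λ σ → ∑ (𝟙 ∘ goodᶠ ts) (subsᶠ ts) * 𝟙 (good t σ)) (subs t)
    ≡⟨ ∑-scale (∑ (𝟙 ∘ goodᶠ ts) (subsᶠ ts)) (𝟙 ∘ good t) (subs t) ⟩
  ∑ (𝟙 ∘ goodᶠ ts) (subsᶠ ts) * ∑ (𝟙 ∘ good t) (subs t)
    ≡⟨ cong₂ _*_ (∑-goodᶠ ts) (∑-good t) ⟩
  ∏φ ts * φ t
    ≡⟨ *-comm (∏φ ts) (φ t) ⟩
  φ t * ∏φ ts ∎
  where open ≡-Reasoning

module _ (G H : MGraph) (χ : V (G ⊎ᵍ H) → Bool) where
  private
    U = G ⊎ᵍ H

  locallyMaximal-⊎⁺ : LocallyMaximal G (χ ∘ inj₁) → LocallyMaximal H (χ ∘ inj₂) → LocallyMaximal U χ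
  locallyMaximal-⊎⁺ g h (inj₁ v) = (λ c → λ
      { (inj₁ u , inj₁ u' , ne , n , n') → proj₁ (g v) c (u , u' , ne ∘ cong inj₁ , n , n')
      ; (inj₁ _ , inj₂ _ , _ , _ , () , _)
      ; (inj₂ _ , _ , _ , (() , _) , _) })
    , λ c → case proj₂ (g v) c of λ
      { (inj₁ (u , u' , ne , n , n')) → inj₁ (inj₁ u , inj₁ u' , ne ∘ inj₁-injective , n , n')
      ; (inj₂ (u , n , u' , n')) → inj₂ (inj₁ u , n , inj₁ u' , n') }
  locallyMaximal-⊎⁺ g h (inj₂ v) = (λ c → λ
      { (inj₂ u , inj₂ u' , ne , n , n') → proj₁ (h v) c (u , u' , ne ∘ cong inj₂ , n , n')
      ; (inj₂ _ , inj₁ _ , _ , _ , () , _)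
      ; (inj₁ _ , _ , _ , (() , _) , _) })
    , λ c → case proj₂ (h v) c of λ
      { (inj₁ (u , u' , ne , n , n')) → inj₁ (inj₂ u , inj₂ u' , ne ∘ inj₂-injective , n , n')
      ; (inj₂ (u , n , u' , n')) → inj₂ (inj₂ u , n , inj₂ u' , n') }

  locallyMaximal-⊎⁻ : LocallyMaximal U χ → LocallyMaximal G (χ ∘ inj₁) × LocallyMaximal H (χ ∘ inj₂)
  locallyMaximal-⊎⁻ lm =
    (λ v → (λ { c (u , u' , ne , n , n') → proj₁ (lm (inj₁ v)) c (inj₁ u , inj₁ u' , ne ∘ inj₁-injective , n , n') })
      , λ c → case proj₂ (lm (inj₁ v)) c of λ
        { (inj₁ (inj₁ u , inj₁ u' , ne , n , n')) → inj₁ (u , u' , ne ∘ cong inj₁ , n , n')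
        ; (inj₁ (inj₁ _ , inj₂ _ , _ , _ , () , _))
        ; (inj₁ (inj₂ _ , _ , _ , (() , _) , _))
        ; (inj₂ (inj₁ u , n , inj₁ u' , n')) → inj₂ (u , n , u' , n')
        ; (inj₂ (inj₁ u , n , inj₂ u' , () , _))
        ; (inj₂ (inj₂ _ , (() , _) , _)) })
    , (λ v → (λ { c (u , u' , ne , n , n') → proj₁ (lm (inj₂ v)) c (inj₂ u , inj₂ u' , ne ∘ inj₂-injective , n , n') })
      , λ c → case proj₂ (lm (inj₂ v)) c of λ
        { (inj₁ (inj₂ u , inj₂ u' , ne , n , n')) → inj₁ (u , u' , ne ∘ cong inj₂ , n , n')
        ; (inj₁ (inj₂ _ , inj₁ _ , _ , _ , () , _))
        ; (inj₁ (inj₁ _ , _ , _ , (() , _) , _))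
        ; (inj₂ (inj₂ u , n , inj₂ u' , n')) → inj₂ (u , n , u' , n')
        ; (inj₂ (inj₂ u , n , inj₁ u' , () , _))
        ; (inj₂ (inj₁ _ , (() , _) , _)) })

goodᶠ⇒ : ∀ ts σ → goodᶠ ts σ ≡ true → LocallyMaximal (forest ts) (charᶠ ts σ)
goodᶠ⇒ []       σ       h ()
goodᶠ⇒ (t ∷ ts) (σ , τ) h with ∧-true {good t σ} h
... | p , q = locallyMaximal-⊎⁺ (gr t) (forest ts) (charᶠ (t ∷ ts) (σ , τ)) (Equivalence.to (good⇔ t σ) p) (goodᶠ⇒ ts τ q)

⇒goodᶠ : ∀ ts σ → LocallyMaximal (forest ts) (charᶠ ts σ) → goodᶠ ts σ ≡ true
⇒goodᶠ []       σ       h = refl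
⇒goodᶠ (t ∷ ts) (σ , τ) h with locallyMaximal-⊎⁻ (gr t) (forest ts) (charᶠ (t ∷ ts) (σ , τ)) h
... | p , q = cong₂ _∧_ (Equivalence.from (good⇔ t σ) p) (⇒goodᶠ ts τ q)

-- Transport along the isomorphism gives injections in both directions between maximal dissociation
-- sets and good encoded subsets, so the cardinalities agree by antisymmetry.
Φ≡∏φ : ∀ {n} (G : Graph n) ts → ⟦ G ⟧ ≃ forest ts → Φ G ≡ ∏φ ts
Φ≡∏φ {n} G ts i = ≤-antisym
  (Card-≤ to (λ {S} {S'} e → to-injective e) (λ {S} m → ⇒goodᶠ ts (to S)
      (locallyMaximal-≗ {forest ts} (λ v → sym (char-encodeᶠ ts _ v)) (locallyMaximal-≃ (≃-sym i) (maximal⇒locallyMaximal G S m))))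
    (Φ-card G) target)
  (Card-≤ from (λ e → from-injective e) (λ {σ} h → locallyMaximal⇒maximal G (from σ)
      (locallyMaximal-≗ {⟦ G ⟧} (λ v → sym (lookup∘tabulate _ v)) (locallyMaximal-≃ i (goodᶠ⇒ ts σ h))))
    target (Φ-card G))
  where
  f = Inverse.to (bij i)
  f⁻¹ = Inverse.from (bij i)
  target : Card (λ σ → goodᶠ ts σ ≡ true) (∏φ ts)
  target = subst (Card _) (∑-goodᶠ ts) (∑-card (subsᶠ-unique ts) (subsᶠ-complete ts))
  to : Subset n → Subᶠ ts
  to S = encodeᶠ ts (lookup S ∘ f⁻¹)
  from : Subᶠ ts → Subset n
  from σ = tabulate (charᶠ ts σ ∘ f)
  to-injective : ∀ {S S'} → to S ≡ to S' → S ≡ S'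
  to-injective {S} {S'} e = trans (sym (tabulate∘lookup S)) (trans (tabulate-cong same-at) (tabulate∘lookup S'))
    where
    at : ∀ S v → charᶠ ts (to S) (f v) ≡ lookup S v
    at S v = trans (char-encodeᶠ ts _ (f v)) (cong (lookup S) (Inverse.strictlyInverseʳ (bij i) v))
    same-at : ∀ v → lookup S v ≡ lookup S' v
    same-at v = trans (sym (at S v)) (trans (cong (λ σ → charᶠ ts σ (f v)) e) (at S' v))
  from-injective : ∀ {σ τ} → from σ ≡ from τ → σ ≡ τ
  from-injective {σ} {τ} e = char-injective ts λ v → trans (sym (at σ v)) (trans (cong (λ S → lookup S (f⁻¹ v)) e) (at τ v))
    where
    at : ∀ σ v → lookup (from σ) (f⁻¹ v) ≡ charᶠ ts σ v
    at σ v = trans (lookup∘tabulate _ (f⁻¹ v)) (cong (charᶠ ts σ) (Inverse.strictlyInverseˡ (bij i) v))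

⊎ᵍ-empty : ∀ G → G ⊎ᵍ empty ≃ G
⊎ᵍ-empty G = iso (mk↔ₛ′ (λ { (inj₁ v) → v ; (inj₂ ()) }) inj₁ (λ _ → refl) (λ { (inj₁ v) → refl ; (inj₂ ()) })) λ { (inj₁ u) (inj₁ v) → refl ; (inj₂ ()) _ ; _ (inj₂ ()) }

single : ∀ t → forest (t ∷ []) ≃ gr t
single t = ⊎ᵍ-empty (gr t)

Φ≡φ : ∀ {n} (G : Graph n) t → ⟦ G ⟧ ≃ gr t → Φ G ≡ φ t
Φ≡φ G t i = trans (Φ≡∏φ G (t ∷ []) (≃-trans i (≃-sym (single t)))) (*-identityʳ (φ t))

V↔Fin : ∀ t → V (gr t) ↔ Fin (size t)
V↔Fin leaf    = ↔-sym 1↔⊤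
V↔Fin (R ▷ C) = ↔-trans (V↔Fin R ⊎-↔ V↔Fin C) (↔-sym +↔⊎)

Vᶠ↔Fin : ∀ ts → V (forest ts) ↔ Fin (sizes ts)
Vᶠ↔Fin []       = ↔-sym 0↔⊥
Vᶠ↔Fin (t ∷ ts) = ↔-trans (V↔Fin t ⊎-↔ Vᶠ↔Fin ts) (↔-sym +↔⊎)

order≡sizes : ∀ {n} (G : Graph n) ts → ⟦ G ⟧ ≃ forest ts → n ≡ sizes ts
order≡sizes G ts i = ↔⇒≡ (↔-trans (bij i) (Vᶠ↔Fin ts))

order≡size : ∀ {n} (G : Graph n) t → ⟦ G ⟧ ≃ gr t → n ≡ size t
order≡size G t i = ↔⇒≡ (↔-trans (bij i) (V↔Fin t))

size-≃ : ∀ {t t'} → gr t ≃ gr t' → size t ≡ size t'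
size-≃ {t} {t'} i = ↔⇒≡ (↔-trans (↔-sym (V↔Fin t)) (↔-trans (bij i) (V↔Fin t')))

gr-sym : ∀ t u v → edge (gr t) u v ≡ edge (gr t) v u
gr-sym leaf    u        v        = refl
gr-sym (R ▷ C) (inj₁ u) (inj₁ v) = gr-sym R u v
gr-sym (R ▷ C) (inj₂ u) (inj₂ v) = gr-sym C u v
gr-sym (R ▷ C) (inj₁ u) (inj₂ v) = ∧-comm (mark (gr R) u) (mark (gr C) v)
gr-sym (R ▷ C) (inj₂ u) (inj₁ v) = ∧-comm (mark (gr C) u) (mark (gr R) v)

gr-irrefl : ∀ t u → edge (gr t) u u ≡ false
gr-irrefl leaf    u        = refl
gr-irrefl (R ▷ C) (inj₁ u) = gr-irrefl R u
gr-irrefl (R ▷ C) (inj₂ u) = gr-irrefl C u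

toGraph : ∀ t → Graph (size t)
toGraph t = record
  { adj = λ u v → edge (gr t) (f u) (f v) ; adj-sym = λ u v → gr-sym t _ _ ; adj-irrefl = λ u → gr-irrefl t _ }
  where f = Inverse.from (V↔Fin t)

toGraph≃ : ∀ t → ⟦ toGraph t ⟧ ≃ gr t
toGraph≃ t = iso (↔-sym (V↔Fin t)) λ u v → refl

-- The recursions for two rootings need not be compared: both numbers are `Φ` of one graph.
φ-≃ : ∀ {t t'} → gr t ≃ gr t' → φ t ≡ φ t'
φ-≃ {t} {t'} i = trans (sym (Φ≡φ (toGraph t) t (toGraph≃ t))) (Φ≡φ (toGraph t) t' (≃-trans (toGraph≃ t) i))

-- Forests are disjoint unions of rooted trees

-- Reinserts a deleted vertex, with neighbourhood `N`. It is unmarked, so that old roots remain the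
-- only roots.
ext : (H : MGraph) → (V H → Bool) → MGraph
ext H N = mgraph (⊤ ⊎ V H) e m
  where
  e : ⊤ ⊎ V H → ⊤ ⊎ V H → Bool
  e (inj₁ _) (inj₁ _) = false
  e (inj₁ _) (inj₂ v) = N v
  e (inj₂ u) (inj₁ _) = N u
  e (inj₂ u) (inj₂ v) = edge H u v
  m : ⊤ ⊎ V H → Bool
  m (inj₁ _) = false
  m (inj₂ v) = mark H v

ext-cong : ∀ {H H'} (i : H ≃ H') N → ext H (N ∘ Inverse.to (bij i)) ≃ ext H' N
ext-cong i N = iso (mk↔ₛ′ to from (λ { (inj₁ _) → refl ; (inj₂ v) → cong inj₂ (Inverse.strictlyInverseˡ (bij i) v) })
                                  (λ { (inj₁ _) → refl ; (inj₂ v) → cong inj₂ (Inverse.strictlyInverseʳ (bij i) v) }))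
  λ { (inj₁ _) (inj₁ _) → refl ; (inj₁ _) (inj₂ v) → refl ; (inj₂ u) (inj₁ _) → refl ; (inj₂ u) (inj₂ v) → edge≡ i u v }
  where
  to : _ → _
  to (inj₁ _) = inj₁ tt
  to (inj₂ v) = inj₂ (Inverse.to (bij i) v)
  from : _ → _
  from (inj₁ _) = inj₁ tt
  from (inj₂ v) = inj₂ (Inverse.from (bij i) v)

Only : ∀ {A : Set} → (A → Bool) → A → Set
Only N w = N w ≡ true × ∀ u → N u ≡ true → u ≡ w

ext-linkˡ : ∀ G H N → (∀ v → N (inj₂ v) ≡ false) → ext (link G H) N ≃ᵐ link (ext G (N ∘ inj₁)) H
ext-linkˡ G H N h = isoᵐ (iso (↔-sym ⊎-assoc) λ
  { (inj₁ _) (inj₁ _) → refl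
  ; (inj₁ _) (inj₂ (inj₁ v)) → refl
  ; (inj₁ _) (inj₂ (inj₂ v)) → h v
  ; (inj₂ (inj₁ u)) (inj₁ _) → refl
  ; (inj₂ (inj₂ u)) (inj₁ _) → trans (h u) (sym (∧-zr (mark H u)))
  ; (inj₂ (inj₁ u)) (inj₂ (inj₁ v)) → refl
  ; (inj₂ (inj₁ u)) (inj₂ (inj₂ v)) → refl
  ; (inj₂ (inj₂ u)) (inj₂ (inj₁ v)) → refl
  ; (inj₂ (inj₂ u)) (inj₂ (inj₂ v)) → refl })
  λ { (inj₁ _) → refl ; (inj₂ (inj₁ _)) → refl ; (inj₂ (inj₂ _)) → refl }
  where
  ∧-zr : ∀ p → p ∧ false ≡ false
  ∧-zr p = ∧-comm p false

ext-linkʳ : ∀ G H N → (∀ v → N (inj₁ v) ≡ false) → ext (link G H) N ≃ᵐ link G (ext H (N ∘ inj₂))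
ext-linkʳ G H N h = isoᵐ (iso ⊎-rotate λ
  { (inj₁ _) (inj₁ _) → refl
  ; (inj₁ _) (inj₂ (inj₁ v)) → h v
  ; (inj₁ _) (inj₂ (inj₂ v)) → refl
  ; (inj₂ (inj₁ u)) (inj₁ _) → trans (h u) (sym (∧-comm (mark G u) false))
  ; (inj₂ (inj₂ u)) (inj₁ _) → refl
  ; (inj₂ (inj₁ u)) (inj₂ (inj₁ v)) → refl
  ; (inj₂ (inj₁ u)) (inj₂ (inj₂ v)) → refl
  ; (inj₂ (inj₂ u)) (inj₂ (inj₁ v)) → refl
  ; (inj₂ (inj₂ u)) (inj₂ (inj₂ v)) → refl })
  λ { (inj₁ _) → refl ; (inj₂ (inj₁ _)) → refl ; (inj₂ (inj₂ _)) → refl }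

false-else : ∀ {A : Set} {N : A → Bool} {w u} → Only N w → u ≢ w → N u ≡ false
false-else {u = u} (_ , only) u≢w = ¬-not (u≢w ∘ only u)

only₁ : ∀ {A B : Set} {N : A ⊎ B → Bool} {w} → Only N (inj₁ w) → Only (N ∘ inj₁) w
only₁ (h , only) = h , λ u c → case only (inj₁ u) c of λ { refl → refl }

only₂ : ∀ {A B : Set} {N : A ⊎ B → Bool} {w} → Only N (inj₂ w) → Only (N ∘ inj₂) w
only₂ (h , only) = h , λ u c → case only (inj₂ u) c of λ { refl → refl }

-- Each vertex of `gr t` is one `leaf` of the term `t`; replacing that one by `leaf ▷ leaf` adds a
-- pendant vertex there and keeps all roots.
sprout : ∀ t N w → Only N w → ∃ λ t' → ext (gr t) N ≃ᵐ gr t'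
sprout leaf N tt (h , _) = leaf ▷ leaf , isoᵐ (iso ⊎-swap λ
  { (inj₁ _) (inj₁ _) → refl ; (inj₁ _) (inj₂ tt) → h ; (inj₂ tt) (inj₁ _) → h ; (inj₂ _) (inj₂ _) → refl })
  λ { (inj₁ _) → refl ; (inj₂ _) → refl }
sprout (R ▷ C) N (inj₁ w) o with sprout R (N ∘ inj₁) w (only₁ {N = N} o)
... | R' , i = R' ▷ C , ≃ᵐ-trans (ext-linkˡ (gr R) (gr C) N (λ v → false-else {N = N} o λ ())) (link-cong i ≃ᵐ-refl)
sprout (R ▷ C) N (inj₂ w) o with sprout C (N ∘ inj₂) w (only₂ {N = N} o)
... | C' , i = R ▷ C' , ≃ᵐ-trans (ext-linkʳ (gr R) (gr C) N (λ v → false-else {N = N} o λ ())) (link-cong ≃ᵐ-refl i)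

ext-⊎ˡ : ∀ G H N → (∀ v → N (inj₂ v) ≡ false) → ext (G ⊎ᵍ H) N ≃ ext G (N ∘ inj₁) ⊎ᵍ H
ext-⊎ˡ G H N h = iso (↔-sym ⊎-assoc) λ
  { (inj₁ _) (inj₁ _) → refl
  ; (inj₁ _) (inj₂ (inj₁ v)) → refl
  ; (inj₁ _) (inj₂ (inj₂ v)) → h v
  ; (inj₂ (inj₁ u)) (inj₁ _) → refl
  ; (inj₂ (inj₂ u)) (inj₁ _) → h u
  ; (inj₂ (inj₁ u)) (inj₂ (inj₁ v)) → refl
  ; (inj₂ (inj₁ u)) (inj₂ (inj₂ v)) → refl
  ; (inj₂ (inj₂ u)) (inj₂ (inj₁ v)) → refl
  ; (inj₂ (inj₂ u)) (inj₂ (inj₂ v)) → refl }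

ext-⊎ʳ : ∀ G H N → (∀ v → N (inj₁ v) ≡ false) → ext (G ⊎ᵍ H) N ≃ G ⊎ᵍ ext H (N ∘ inj₂)
ext-⊎ʳ G H N h = iso ⊎-rotate λ
  { (inj₁ _) (inj₁ _) → refl
  ; (inj₁ _) (inj₂ (inj₁ v)) → h v
  ; (inj₁ _) (inj₂ (inj₂ v)) → refl
  ; (inj₂ (inj₁ u)) (inj₁ _) → h u
  ; (inj₂ (inj₂ u)) (inj₁ _) → refl
  ; (inj₂ (inj₁ u)) (inj₂ (inj₁ v)) → refl
  ; (inj₂ (inj₁ u)) (inj₂ (inj₂ v)) → refl
  ; (inj₂ (inj₂ u)) (inj₂ (inj₁ v)) → refl
  ; (inj₂ (inj₂ u)) (inj₂ (inj₂ v)) → refl }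

ext-isolated : ∀ H N → (∀ v → N v ≡ false) → ext H N ≃ point ⊎ᵍ H
ext-isolated H N h = iso ↔-refl λ
  { (inj₁ _) (inj₁ _) → refl ; (inj₁ _) (inj₂ v) → h v ; (inj₂ u) (inj₁ _) → h u ; (inj₂ u) (inj₂ v) → refl }

sproutᶠ : ∀ ts N w → Only N w → ∃ λ ts' → ext (forest ts) N ≃ forest ts'
sproutᶠ (t ∷ ts) N (inj₁ w) o with sprout t (N ∘ inj₁) w (only₁ {N = N} o)
... | t' , i = t' ∷ ts , ≃-trans (ext-⊎ˡ (gr t) (forest ts) N (λ v → false-else {N = N} o λ ())) (⊎ᵍ-cong (plain i) ≃-refl)
sproutᶠ (t ∷ ts) N (inj₂ w) o with sproutᶠ ts (N ∘ inj₂) w (only₂ {N = N} o)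
... | ts' , i = t ∷ ts' , ≃-trans (ext-⊎ʳ (gr t) (forest ts) N (λ v → false-else {N = N} o λ ())) (⊎ᵍ-cong ≃-refl i)

module _ {n} (G : Graph n) where

  Pair : Fin n → Set
  Pair v = ∃₂ λ u u' → u ≢ u' × Adj G v u × Adj G v u'

  pair? : ∀ v → Dec (Pair v)
  pair? v = any? λ u → any? λ u' → ¬? (u F.≟ u') ×-dec ((adj G v u B.≟ true) ×-dec (adj G v u' B.≟ true))

  close : ∀ {a b} ys {v zs} → Linked (Adj G) (a ∷ ys ++ v ∷ zs) → Adj G v b → Linked (Adj G) ((a ∷ ys ++ v ∷ []) ∷ʳ b)
  close []       (e ∷ _) h = e ∷ h ∷ [-]
  close (y ∷ ys) (e ∷ l) h = e ∷ close ys l h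

  prefix-unique : ∀ xs {zs : List (Fin n)} → Unique (xs ++ zs) → Unique xs
  prefix-unique []       _        = []
  prefix-unique (x ∷ xs) (h ∷ u) = ++⁻ˡ xs h ∷ prefix-unique xs u

  irrefl : ∀ {u} → ¬ Adj G u u
  irrefl {u} e = case trans (sym (adj-irrefl G u)) e of λ ()

  -- A path can be extended at x until it runs into itself; k bounds the number of steps left.
  grow : (∀ v → Pair v) → ∀ k x xs → Unique (x ∷ xs) → Linked (Adj G) (x ∷ xs) → n < length (x ∷ xs) + k → Cycle G
  grow pairs zero x xs u l h = ⊥-elim (<⇒≱ h (≤-trans (≤-reflexive (+-identityʳ _))
    (≤-trans (unique-⊆⇒length-≤ u (λ {z} _ → ∈-allFin z)) (≤-reflexive (length-tabulate {n = n} (λ i → i))))))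
  grow pairs (suc k) x xs u l h with next xs
    where
    next : ∀ xs → ∃ λ v → Adj G x v × (∀ {y ys} → xs ≡ y ∷ ys → v ≢ y)
    next [] with pairs x
    ... | v , _ , _ , e , _ = v , e , λ ()
    next (y ∷ ys) with pairs x
    ... | v , v' , v≢v' , e , e' with v F.≟ y
    ...   | yes refl = v' , e' , λ { refl refl → v≢v' refl }
    ...   | no v≢y   = v , e , λ { refl → v≢y }
  ... | v , e , v≢head with mem? F._≟_ v xs
  ...   | no v∉xs = grow pairs k v (x ∷ xs) (((λ { refl → irrefl e }) ∷ All.tabulate (λ i v≡ → v∉xs (subst (_∈ xs) (sym v≡) i))) ∷ u)
                         (trans (adj-sym G v x) e ∷ l) (subst (n <_) (+-suc (suc (length xs)) k) h)
  ...   | yes v∈xs with ∈-∃++ v∈xs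
  ...     | [] , zs , refl = ⊥-elim (v≢head refl refl)
  ...     | y ∷ ys , zs , refl = record
    { start = x ; rest = y ∷ ys ++ v ∷ []
    ; long = s≤s (subst (1 ≤_) (sym (length-++ ys)) (m≤n+m 1 (length ys)))
    ; distinct = prefix-unique (x ∷ y ∷ ys ++ v ∷ []) (subst Unique (cong (λ l → x ∷ y ∷ l) (sym (++-assoc ys (v ∷ []) zs))) u)
    ; linked = close (y ∷ ys) l (trans (adj-sym G v x) e) }

low-degree : ∀ {n} (G : Graph (suc n)) → Forest G →
  ∃ λ v → (∀ u → adj G v u ≡ false) ⊎ ∃ (Only (adj G v))
low-degree G acyclic with any? (λ v → ¬? (pair? G v))
... | no ¬low = ⊥-elim (acyclic (grow G pairs _ zero [] ([] ∷ []) [-] ≤-refl))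
  where
  pairs : ∀ v → Pair G v
  pairs v with pair? G v
  ... | yes p = p
  ... | no ¬p = ⊥-elim (¬low (v , ¬p))
... | yes (v , low) with any? (λ u → adj G v u B.≟ true)
...   | no none = v , inj₁ λ u → ¬-not (λ e → none (u , e))
...   | yes (w , e) = v , inj₂ (w , e , λ u e' → case u F.≟ w of λ { (yes p) → p ; (no ne) → ⊥-elim (low (u , w , ne , e' , e)) })

remove : ∀ {n} → Graph (suc n) → Fin (suc n) → Graph n
remove G v = record
  { adj = λ i j → adj G (punchIn v i) (punchIn v j)
  ; adj-sym = λ i j → adj-sym G _ _ ; adj-irrefl = λ i → adj-irrefl G _ }

remove-forest : ∀ {n} (G : Graph (suc n)) v → Forest G → Forest (remove G v)
remove-forest G v acyclic c = acyclic record
  { start = punchIn v (start c) ; rest = map (punchIn v) (rest c)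
  ; long = subst (2 ≤_) (sym (length-map (punchIn v) (rest c))) (long c)
  ; distinct = Unique.map⁺ (punchIn-injective v _ _) (distinct c)
  ; linked = subst (Linked (Adj G)) (map-++ (punchIn v) (start c ∷ rest c) (start c ∷ [])) (Linked.map⁺ (linked c)) }
  where open Cycle

restore : ∀ {n} (G : Graph (suc n)) v → ext ⟦ remove G v ⟧ (adj G v ∘ punchIn v) ≃ ⟦ G ⟧
restore G v = iso (mk↔ₛ′ to from to-from from-to) λ
  { (inj₁ _) (inj₁ _) → sym (adj-irrefl G v) ; (inj₁ _) (inj₂ j) → refl
  ; (inj₂ i) (inj₁ _) → adj-sym G v _ ; (inj₂ i) (inj₂ j) → refl }
  where
  to : ⊤ ⊎ Fin _ → Fin (suc _)
  to (inj₁ _) = v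
  to (inj₂ i) = punchIn v i
  from : Fin (suc _) → ⊤ ⊎ Fin _
  from u with v F.≟ u
  ... | yes _ = inj₁ tt
  ... | no ne = inj₂ (punchOut ne)
  to-from : ∀ u → to (from u) ≡ u
  to-from u with v F.≟ u
  ... | yes p = p
  ... | no ne = punchIn-punchOut ne
  from-to : ∀ z → from (to z) ≡ z
  from-to (inj₁ _) with v F.≟ v
  ... | yes _ = refl
  ... | no ne = ⊥-elim (ne refl)
  from-to (inj₂ i) with v F.≟ punchIn v i
  ... | yes p = ⊥-elim (punchInᵢ≢i v i (sym p))
  ... | no ne = cong inj₂ (trans (punchOut-cong v refl) (punchOut-punchIn v))

-- By deletion of a vertex with at most one neighbour: put back, it is a new component of order 1 or
-- a pendant vertex of an old component.
decompose : ∀ n (G : Graph n) → Forest G → ∃ λ ts → ⟦ G ⟧ ≃ forest ts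
decompose zero G _ = [] , iso (mk↔ₛ′ (λ ()) (λ ()) (λ ()) (λ ())) λ ()
decompose (suc n) G acyclic with low-degree G acyclic
... | v , low with decompose n (remove G v) (remove-forest G v acyclic)
...   | ts , i = finish low
  where
  N : V (forest ts) → Bool
  N w = adj G v (punchIn v (Inverse.from (bij i) w))
  whole : ⟦ G ⟧ ≃ ext (forest ts) N
  whole = ≃-trans (≃-sym (restore G v)) (≃-trans (≃-sym (ext-cong (≃-sym i) (adj G v ∘ punchIn v))) ≃-refl)
  finish : (∀ u → adj G v u ≡ false) ⊎ ∃ (Only (adj G v)) → ∃ λ ts → ⟦ G ⟧ ≃ forest ts
  finish (inj₁ none) = leaf ∷ ts , ≃-trans whole (ext-isolated (forest ts) N λ w → none _)
  finish (inj₂ (w , e , only)) with sproutᶠ ts N w' (trans (cong (adj G v) back) e , λ u h →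
      trans (sym (Inverse.strictlyInverseˡ (bij i) u)) (cong (Inverse.to (bij i))
        (punchIn-injective v _ _ (trans (only _ h) (sym (punchIn-punchOut v≢w))))))
    where
    v≢w : v ≢ w
    v≢w refl = irrefl G e
    w' : V (forest ts)
    w' = Inverse.to (bij i) (punchOut v≢w)
    back : punchIn v (Inverse.from (bij i) w') ≡ w
    back = trans (cong (punchIn v) (Inverse.strictlyInverseʳ (bij i) _)) (punchIn-punchOut v≢w)
  ... | ts' , j = ts' , ≃-trans whole j

-- Lying in the first component is constant along walks, yet separates the roots of the first two.
connected⇒single : ∀ {n} (G : Graph n) → Connected G → ∀ {t t' ts} → ¬ (⟦ G ⟧ ≃ forest (t ∷ t' ∷ ts))
connected⇒single G conn {t} {t'} {ts} i = case trans (sym (lhs)) (trans (walk (conn v₁ v₂)) rhs) of λ ()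
  where
  f = Inverse.to (bij i)
  left : V (forest (t ∷ t' ∷ ts)) → Bool
  left (inj₁ _) = true
  left (inj₂ _) = false
  v₁ = Inverse.from (bij i) (inj₁ (root t))
  v₂ = Inverse.from (bij i) (inj₂ (inj₁ (root t')))
  lhs : left (f v₁) ≡ true
  lhs = cong left (Inverse.strictlyInverseˡ (bij i) _)
  rhs : left (f v₂) ≡ false
  rhs = cong left (Inverse.strictlyInverseˡ (bij i) _)
  stay : ∀ u v → edge (forest (t ∷ t' ∷ ts)) u v ≡ true → left u ≡ left v
  stay (inj₁ _) (inj₁ _) _ = refl
  stay (inj₂ _) (inj₂ _) _ = refl
  walk : ∀ {u v} → Walk G u v → left (f u) ≡ left (f v)
  walk Walk.here              = refl
  walk (Walk.step {u} {w} e p) = trans (stay (f u) (f w) (trans (sym (edge≡ i u w)) e)) (walk p)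

-- Linear certificates


path₂ path₃ path₄ cherry claw broom : RT
path₂  = leaf ▷ leaf
path₃  = leaf ▷ path₂
path₄  = leaf ▷ path₃
cherry = leaf ▷ leaf ▷ leaf
claw   = leaf ▷ cherry
broom  = leaf ▷ claw

-- The cap of order 3q + r + 1 is α r · 3^q + 60 q + β r, sixty times the bound on φ; slack is what trees
-- other than T* must leave. The sharp leading constants for r = 1, 2 would be 80 and 320/3, but with
-- them the reductions below do not close.
α β slack : ℕ → ℕ
α 0 = 60
α 1 = 85
α 2 = 123
α (suc (suc (suc e))) = 3 * α e
β 0 = 0
β 1 = 45
β 2 = 42
β (suc (suc (suc e))) = 60 + β e
slack 0 = 60
slack 1 = 0
slack 2 = 0
slack (suc (suc (suc e))) = slack e

cap : ℕ → ℕ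
cap zero    = 0
cap (suc e) = α e + β e

capForm : ℕ → Form
capForm e = form (α e) 60 (β e)

cap≡eval : ∀ q e → cap (suc (q * 3 + e)) ≡ eval (capForm e) q
cap≡eval zero    e = lemma (α e) (β e)
  where
  lemma : ∀ a b → a + b ≡ a * 1 + 60 * 0 + b
  lemma = solve-∀
cap≡eval (suc q) e = trans (cong₂ _+_ (α-step q) (β-step q)) (lemma (α e) (β e) (3 ^ q) q)
  where
  α-step : ∀ q → α (suc q * 3 + e) ≡ 3 * 3 ^ q * α e
  α-step zero    = refl
  α-step (suc q) = trans (cong (3 *_) (α-step q)) (sym (*-assoc 3 (3 * 3 ^ q) (α e)))
  β-step : ∀ q → β (suc q * 3 + e) ≡ 60 * suc q + β e
  β-step zero    = refl
  β-step (suc q) = trans (cong (60 +_) (β-step q)) (lemma' q (β e))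
    where
    lemma' : ∀ q b → 60 + (60 * suc q + b) ≡ 60 * suc (suc q) + b
    lemma' = solve-∀
  lemma : ∀ a b x q → 3 * x * a + (60 * suc q + b) ≡ a * (3 * x) + 60 * suc q + b
  lemma = solve-∀

slack≡ : ∀ q e → slack (q * 3 + e) ≡ slack e
slack≡ zero    e = refl
slack≡ (suc q) e = slack≡ q e

-- The least `q` with `3q + r + 1 ≥ 11`.
base : ℕ → ℕ
base 0 = 4
base _ = 3

-- The pieces that may replace a larger one at the root of `E`. The order of the list matters: a
-- certificate puts its weights on an initial segment.
reductions : List (List RT)
reductions = [] ∷ (leaf ∷ []) ∷ (leaf ∷ leaf ∷ []) ∷ (cherry ∷ []) ∷ (claw ∷ []) ∷ (cherry ∷ cherry ∷ []) ∷ []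

record Cert : Set where
  constructor cert
  field
    scale   : ℕ
    weights : List ℕ
    μ₁ μ₂ μ₃ : ℕ
open Cert

weighted : List ℕ → List (List RT) → Counts
weighted (k ∷ ks) (cs ∷ css) = k ⊠ functional (map cnt cs) ⊞ weighted ks css
weighted _        _          = ⟨ 0 , 0 , 0 , 0 , 0 , 0 ⟩

weightedForm : ℕ → List ℕ → List (List RT) → Form
weightedForm r (k ∷ ks) (cs ∷ css) = (k *ᶠ capForm (r + sizes cs)) +ᶠ weightedForm r ks css
weightedForm r _        _          = form 0 0 0

Reduced : Counts → ℕ → ℕ → List RT → Set
Reduced c q r cs = 60 * dot (functional (map cnt cs)) c ≤ eval (capForm (r + sizes cs)) q

weighted-≤ : ∀ c q r ks css → All (Reduced c q r) (take (length ks) css) → 60 * dot (weighted ks css) c ≤ eval (weightedForm r ks css) q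
weighted-≤ c q r []       css        _        = z≤n
weighted-≤ c q r (k ∷ ks) []         _        = z≤n
weighted-≤ c q r (k ∷ ks) (cs ∷ css) (h ∷ hs) = begin
  60 * dot (k ⊠ f ⊞ g) c                ≡⟨ cong (60 *_) (trans (dot-⊞ (k ⊠ f) g c) (cong (_+ dot g c) (dot-⊠ k f c))) ⟩
  60 * (k * dot f c + dot g c)          ≡⟨ lemma k (dot f c) (dot g c) ⟩
  k * (60 * dot f c) + 60 * dot g c     ≤⟨ +-mono-≤ (*-monoʳ-≤ k h) (weighted-≤ c q r ks css hs) ⟩
  k * eval F q + eval G q               ≡⟨ sym (trans (eval-+ (k *ᶠ F) G q) (cong (_+ eval G q) (eval-* k F q))) ⟩
  eval ((k *ᶠ F) +ᶠ G) q                ∎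
  where
  open ≤-Reasoning
  f = functional (map cnt cs)
  g = weighted ks css
  F = capForm (r + sizes cs)
  G = weightedForm r ks css
  lemma : ∀ k a b → 60 * (k * a + b) ≡ k * (60 * a) + 60 * b
  lemma = solve-∀

basicˡ basicʳ : Cert → Counts
basicˡ C = μ₁ C ⊠ ⟨ 0 , 0 , 0 , 0 , 0 , 1 ⟩ ⊞ μ₂ C ⊠ ⟨ 1 , 1 , 0 , 0 , 0 , 0 ⟩ ⊞ μ₃ C ⊠ ⟨ 0 , 0 , 0 , 0 , 1 , 0 ⟩
basicʳ C = μ₁ C ⊠ ⟨ 1 , 0 , 0 , 0 , 0 , 0 ⟩ ⊞ μ₂ C ⊠ ⟨ 0 , 0 , 0 , 1 , 1 , 1 ⟩ ⊞ μ₃ C ⊠ ⟨ 0 , 0 , 1 , 0 , 0 , 0 ⟩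

basicˡ≤basicʳ : ∀ C {c} → Nice c → dot (basicˡ C) c ≤ dot (basicʳ C) c
basicˡ≤basicʳ C {c} n = begin
  dot (basicˡ C) c                                        ≡⟨ e₁ (μ₁ C) (μ₂ C) (μ₃ C) (a₀ c) (a₁ c) (b c) (d c) (x c) (y c) ⟩
  μ₁ C * y c + μ₂ C * p c + μ₃ C * x c                   ≤⟨ +-mono-≤ (+-mono-≤ (*-monoʳ-≤ (μ₁ C) (y≤a₀ n)) (*-monoʳ-≤ (μ₂ C) (p≤w n))) (*-monoʳ-≤ (μ₃ C) (x≤b n)) ⟩
  μ₁ C * a₀ c + μ₂ C * w c + μ₃ C * b c                  ≡⟨ e₂ (μ₁ C) (μ₂ C) (μ₃ C) (a₀ c) (a₁ c) (b c) (d c) (x c) (y c) ⟩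
  dot (basicʳ C) c                                        ∎
  where
  open ≤-Reasoning
  e₁ : ∀ m n o a a' b d x y →
    (m * 0 + n * 1 + o * 0) * a + (m * 0 + n * 1 + o * 0) * a' + (m * 0 + n * 0 + o * 0) * b
    + (m * 0 + n * 0 + o * 0) * d + (m * 0 + n * 0 + o * 1) * x + (m * 1 + n * 0 + o * 0) * y
    ≡ m * y + n * (a + a') + o * x
  e₁ = solve-∀
  e₂ : ∀ m n o a a' b d x y →
    m * a + n * (d + x + y) + o * b
    ≡ (m * 1 + n * 0 + o * 0) * a + (m * 0 + n * 0 + o * 0) * a' + (m * 0 + n * 0 + o * 1) * b
    + (m * 0 + n * 1 + o * 0) * d + (m * 0 + n * 1 + o * 0) * x + (m * 0 + n * 1 + o * 0) * y
  e₂ = solve-∀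

-- Farkas: the caps of the reductions, weighted, and the inequalities of Nice, with multipliers μᵢ, imply
-- scale · f ≤ scale · goal.
covers : Cert → Counts → Bool
covers C f = (scale C ⊠ f ⊞ basicʳ C) ≤ᶜ (weighted (weights C) reductions ⊞ basicˡ C)

meets : Cert → ℕ → ℕ → Form → Bool
meets C σ r goal = (1 ≤ᵇ scale C) ∧
  dominates (base r) (weightedForm r (weights C) reductions +ᶠ form 0 0 (scale C * σ)) (scale C *ᶠ goal)

cert-sound : ∀ C f σ r goal → T (covers C f) → T (meets C σ r goal) →
  ∀ {c q} → Nice c → base r ≤ q → All (Reduced c q r) (take (length (weights C)) reductions) → 60 * dot f c + σ ≤ eval goal q
cert-sound C f σ r goal h₁ h₂ {c} {q} n b≤q ih with ∧⁻ {1 ≤ᵇ scale C} h₂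
... | D>0 , h₃ = *-cancelˡ-≤ (scale C) {{>-nonZero (≤ᵇ⇒≤ 1 _ D>0)}} (begin
  D * (60 * dot f c + σ)                  ≡⟨ lemma D (dot f c) σ ⟩
  60 * (D * dot f c) + D * σ              ≤⟨ +-monoˡ-≤ (D * σ) (*-monoʳ-≤ 60 covered) ⟩
  60 * dot W c + D * σ                    ≤⟨ +-monoˡ-≤ (D * σ) (weighted-≤ c q r (weights C) reductions ih) ⟩
  eval F q + D * σ                        ≡⟨ sym (eval-+ F (form 0 0 (D * σ)) q) ⟩
  eval (F +ᶠ form 0 0 (D * σ)) q          ≤⟨ dominates⇒≤ {base r} {F +ᶠ form 0 0 (D * σ)} {D *ᶠ goal} h₃ b≤q ⟩
  eval (D *ᶠ goal) q                      ≡⟨ eval-* D goal q ⟩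
  D * eval goal q                         ∎)
  where
  open ≤-Reasoning
  D = scale C
  W = weighted (weights C) reductions
  F = weightedForm r (weights C) reductions
  lemma : ∀ D k σ → D * (60 * k + σ) ≡ 60 * (D * k) + D * σ
  lemma = solve-∀
  covered : D * dot f c ≤ dot W c
  covered = +-cancelʳ-≤ (dot (basicʳ C) c) _ _ (begin
    D * dot f c + dot (basicʳ C) c         ≡⟨ sym (trans (dot-⊞ (D ⊠ f) (basicʳ C) c) (cong (_+ dot (basicʳ C) c) (dot-⊠ D f c))) ⟩
    dot (D ⊠ f ⊞ basicʳ C) c               ≤⟨ dot-mono {D ⊠ f ⊞ basicʳ C} {W ⊞ basicˡ C} c h₁ ⟩
    dot (W ⊞ basicˡ C) c                   ≡⟨ dot-⊞ W (basicˡ C) c ⟩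
    dot W c + dot (basicˡ C) c             ≤⟨ +-monoʳ-≤ (dot W c) (basicˡ≤basicʳ C n) ⟩
    dot W c + dot (basicʳ C) c             ∎)

Pattern : Set
Pattern = List RT × Cert

-- Each certificate serves all three residues of the order of `E`. Combinations with `path₃` are
-- absent because they are dominated by those with `cherry` in its place.
patterns : List Pattern
patterns =
    (leaf ∷ leaf ∷ leaf ∷ [] , cert 3 (0 ∷ 0 ∷ 4 ∷ []) 0 1 0)
  ∷ ((leaf ▷ path₄) ∷ []     , cert 1 (2 ∷ 1 ∷ 1 ∷ []) 0 0 1)
  ∷ ((leaf ▷ broom) ∷ []     , cert 1 (0 ∷ 0 ∷ 2 ∷ 0 ∷ 1 ∷ []) 0 0 1)
  ∷ (leaf ∷ path₂ ∷ []       , cert 1 (0 ∷ 0 ∷ 1 ∷ []) 0 0 0)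
  ∷ (leaf ∷ cherry ∷ []      , cert 3 (0 ∷ 2 ∷ 1 ∷ 2 ∷ []) 1 0 2)
  ∷ (leaf ∷ claw ∷ []        , cert 6 (0 ∷ 13 ∷ 5 ∷ 2 ∷ []) 3 0 2)
  ∷ (leaf ∷ broom ∷ []       , cert 1 (0 ∷ 1 ∷ 3 ∷ []) 0 0 0)
  ∷ (path₂ ∷ path₂ ∷ []      , cert 3 (0 ∷ 0 ∷ 4 ∷ []) 0 1 0)
  ∷ (path₂ ∷ cherry ∷ []     , cert 5 (0 ∷ 0 ∷ 6 ∷ 3 ∷ []) 3 0 3)
  ∷ (path₂ ∷ claw ∷ []       , cert 1 (0 ∷ 0 ∷ 2 ∷ 1 ∷ []) 0 0 0)
  ∷ (path₂ ∷ broom ∷ []      , cert 3 (0 ∷ 0 ∷ 13 ∷ []) 0 1 0)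
  ∷ (cherry ∷ claw ∷ []      , cert 3 (0 ∷ 1 ∷ 0 ∷ 9 ∷ 2 ∷ []) 7 0 7)
  ∷ (cherry ∷ broom ∷ []     , cert 2 (0 ∷ 3 ∷ 3 ∷ 6 ∷ []) 3 0 4)
  ∷ (claw ∷ claw ∷ []        , cert 9 (0 ∷ 34 ∷ 0 ∷ 10 ∷ 11 ∷ 4 ∷ []) 9 0 0)
  ∷ (claw ∷ broom ∷ []       , cert 1 (0 ∷ 6 ∷ 4 ∷ 2 ∷ []) 1 0 0)
  ∷ (broom ∷ broom ∷ []      , cert 3 (4 ∷ 11 ∷ 34 ∷ []) 0 1 1)
  ∷ []

shrinks : ℕ → Cert → Bool
shrinks k C = all (λ cs → sizes cs <ᵇ k) (take (length (weights C)) reductions)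

certified : Pattern → Bool
certified (cs , C) = covers C (functional (map cnt cs)) ∧ shrinks (sizes cs) C ∧
  all (λ r → meets C (slack (r + sizes cs)) r (capForm (r + sizes cs))) (0 ∷ 1 ∷ 2 ∷ [])

patterns-certified : T (all certified patterns)
patterns-certified = _

-- With i legs of order 3 hung below E, φ = 3^i s + i w + x + a₁ (counts of E): the value at i = 2, and the
-- increment from i = 2 to 3.
spiderBase spiderStep : Counts
spiderBase = ⟨ 9 , 1 , 9 , 11 , 3 , 2 ⟩
spiderStep = ⟨ 18 , 0 , 18 , 19 , 1 , 1 ⟩

-- The cap when a new vertex with two legs is added to `E`, which is `7` vertices, and the growth of
-- the cap from the second to the third leg; `18` is `27 - 9`.
baseGoal stepGoal : ℕ → Form
baseGoal r = capForm (r + 7)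
stepGoal r = form (18 * α (r + 1)) 0 60

certBase certStep : Cert
certBase = cert 8 (47 ∷ 0 ∷ 0 ∷ 0 ∷ 8 ∷ 1 ∷ []) 0 0 0
certStep = cert 8 (143 ∷ 0 ∷ 0 ∷ 0 ∷ 0 ∷ 1 ∷ []) 0 0 0

spider-certified : T (covers certBase spiderBase ∧ covers certStep spiderStep ∧ shrinks 7 certBase ∧ shrinks 7 certStep ∧
  all (λ r → meets certBase (slack (r + 7)) r (baseGoal r) ∧ meets certStep 0 r (stepGoal r)) (0 ∷ 1 ∷ 2 ∷ []))
spider-certified = _

-- The first argument is fuel. Children are ordered, so a tree is listed in all its presentations;
-- in return, completeness is an induction on the term.
trees : ℕ → ℕ → List RT
trees zero    n = []
trees (suc k) 1 = leaf ∷ []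
trees (suc k) n = concatMap (λ i → cartesianProductWith _▷_ (trees k i) (trees k (n ∸ i))) (upTo n)

size>0 : ∀ t → 1 ≤ size t
size>0 leaf    = ≤-refl
size>0 (R ▷ C) = ≤-trans (size>0 R) (m≤m+n _ _)

trees-complete : ∀ k t → size t ≤ k → t ∈ trees k (size t)
trees-complete zero    t       h = ⊥-elim (<⇒≱ (size>0 t) h)
trees-complete (suc k) leaf    h = here refl
trees-complete (suc k) (R ▷ C) h with size R + size C in eq | size>0 R | size>0 C
... | 0             | r | c = ⊥-elim (<⇒≢ (≤-trans r (m≤m+n _ (size C))) (sym eq))
... | 1             | r | c = ⊥-elim (1+n≰n (≤-trans (+-mono-≤ r c) (≤-reflexive eq)))
... | n@(suc (suc _)) | r | c = ∈-concatMap⁺ (λ i → cartesianProductWith _▷_ (trees k i) (trees k (n ∸ i))) (lose (∈-upTo⁺ (subst (size R <_) eq (m<m+n (size R) c)))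
        (∈-cartesianProductWith⁺ _▷_
          (trees-complete k R (s≤s⁻¹ (≤-trans (subst (size R <_) eq (m<m+n (size R) c)) h)))
          (subst (λ j → C ∈ trees k j) (trans (sym (m+n∸m≡n (size R) (size C))) (cong (_∸ size R) eq))
            (trees-complete k C (s≤s⁻¹ (≤-trans (subst (size C <_) eq (m<n+m (size C) r)) h))))))


≤10-by-cases : (f : RT → Bool) → T (all (λ n → all f (trees 10 n)) (upTo 11)) → ∀ E → size E ≤ 10 → T (f E)
≤10-by-cases f h E h' = All.lookup (all⁺ f (trees 10 (size E)) (All.lookup (all⁺ (λ n → all f (trees 10 n)) (upTo 11) h) (∈-upTo⁺ (s≤s h'))))
  (trees-complete 10 E h')

-- A pattern's functional and order, computed once for all trees.
row : Pattern → Counts × ℕ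
row (cs , _) = functional (map cnt cs) , sizes cs

rowHolds : Counts → ℕ → Counts × ℕ → Bool
rowHolds c m (f , k) = (m + k <ᵇ 11) ∨ (60 * dot f c + slack (m + k ∸ 1) ≤ᵇ cap (m + k))

isCherry : RT → Bool
isCherry (leaf ▷ leaf ▷ leaf) = true
isCherry _                    = false

spiderHolds : Counts → ℕ → Bool
spiderHolds c zero    = true
spiderHolds c (suc e) = (60 * dot spiderBase c + slack (e + 7) ≤ᵇ cap (e + 8))
                      ∧ (60 * dot spiderStep c ≤ᵇ 18 * α (e + 1) + 60)

-- For small `E` the reduced trees can have orders at which no cap is known, so the conclusions of
-- the certificates are evaluated directly. `cherry` is exempt from the spider test, since with it
-- the spiders attain the bound.
smallCase : List (Counts × ℕ) → RT → Bool
smallCase rows E = all (rowHolds (cnt E) (size E)) rows ∧ (isCherry E ∨ spiderHolds (cnt E) (size E))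

smallCases : ∀ E → size E ≤ 10 → T (smallCase (map row patterns) E)
smallCases = ≤10-by-cases (smallCase (map row patterns)) _


-- The induction hypothesis starts at order 11: at order 3, for instance, the cap is 165, while
-- `60 * φ` is 180 for `P₃`.
CappedBelow : ℕ → Set
CappedBelow n = ∀ t → 11 ≤ size t → size t < n → 60 * φ t ≤ cap (size t)

record Large (m : ℕ) : Set where
  constructor large
  field
    r q  : ℕ
    m≡   : m ≡ suc (q * 3 + r)
    r∈   : r ∈ (0 ∷ 1 ∷ 2 ∷ [])
    b≤q  : base r ≤ q
open Large

large-order : ∀ m → 11 ≤ m → Large m
large-order (suc e) (s≤s h) = record { r = e % 3 ; q = e / 3
  ; m≡ = cong suc (trans (m≡m%n+[m/n]*n e 3) (+-comm (e % 3) _)) ; r∈ = r∈' (e % 3) (m%n<n e 3)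
  ; b≤q = b≤q' (e % 3) (e / 3) (m%n<n e 3) (subst (10 ≤_) (m≡m%n+[m/n]*n e 3) h) }
  where
  r∈' : ∀ r → r < 3 → r ∈ (0 ∷ 1 ∷ 2 ∷ [])
  r∈' 0 _ = here refl
  r∈' 1 _ = there (here refl)
  r∈' 2 _ = there (there (here refl))
  r∈' (suc (suc (suc _))) (s≤s (s≤s (s≤s ())))
  contra : ∀ r q {k} → q * 3 ≤ k * 3 → 10 ≤ r + q * 3 → 10 ≤ r + k * 3
  contra r q a b = ≤-trans b (+-monoʳ-≤ r a)
  tooSmall : ∀ {k j : ℕ} → k < j → ¬ (j ≤ k)
  tooSmall = <⇒≱
  b≤q' : ∀ r q → r < 3 → 10 ≤ r + q * 3 → base r ≤ q
  b≤q' 0 q _ h with 4 ≤? q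
  ... | yes p = p
  ... | no ¬p = ⊥-elim (tooSmall {9} {10} ≤-refl (contra 0 q {3} (*-monoˡ-≤ 3 (s≤s⁻¹ (≰⇒> ¬p))) h))
  b≤q' 1 q _ h with 3 ≤? q
  ... | yes p = p
  ... | no ¬p = ⊥-elim (tooSmall {7} {10} (≤ᵇ⇒≤ 8 10 _) (contra 1 q {2} (*-monoˡ-≤ 3 (s≤s⁻¹ (≰⇒> ¬p))) h))
  b≤q' 2 q _ h with 3 ≤? q
  ... | yes p = p
  ... | no ¬p = ⊥-elim (tooSmall {8} {10} (≤ᵇ⇒≤ 9 10 _) (contra 2 q {2} (*-monoˡ-≤ 3 (s≤s⁻¹ (≰⇒> ¬p))) h))
  b≤q' (suc (suc (suc _))) q (s≤s (s≤s (s≤s ()))) h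

order+ : ∀ {m} (L : Large m) k → m + k ≡ suc (q L * 3 + (r L + k))
order+ L k = trans (cong (_+ k) (m≡ L)) (cong suc (+-assoc (q L * 3) (r L) k))

cap-order+ : ∀ {m} (L : Large m) k → cap (m + k) ≡ eval (capForm (r L + k)) (q L)
cap-order+ L k = trans (cong cap (order+ L k)) (cap≡eval (q L) (r L + k))

reduce : ∀ E (L : Large (size E)) k C → 11 ≤ size E → T (shrinks k C) → CappedBelow (size E + k) →
  All (Reduced (cnt E) (q L) (r L)) (take (length (Cert.weights C)) reductions)
reduce E L k C big sh ih = All.map (λ {cs} → use cs) (all⁺ (λ cs → sizes cs <ᵇ k) (take (length (Cert.weights C)) reductions) sh)
  where
  use : ∀ cs → T (sizes cs <ᵇ k) → Reduced (cnt E) (q L) (r L) cs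
  use cs lt = begin
    60 * dot (functional (map cnt cs)) (cnt E)   ≡⟨ cong (60 *_) (sym (φ-attach E cs)) ⟩
    60 * φ (attach E cs)                         ≤⟨ ih (attach E cs) (subst (11 ≤_) (sym (size-attach E cs)) (≤-trans big (m≤m+n _ _)))
                                                      (subst (_< size E + k) (sym (size-attach E cs)) (+-monoʳ-< (size E) (<ᵇ⇒< (sizes cs) k lt))) ⟩
    cap (size (attach E cs))                     ≡⟨ cong cap (size-attach E cs) ⟩
    cap (size E + sizes cs)                      ≡⟨ cap-order+ L (sizes cs) ⟩
    eval (capForm (r L + sizes cs)) (q L)        ∎
    where open ≤-Reasoning

order-1 : ∀ {m} (L : Large m) k → slack (m + k ∸ 1) ≡ slack (r L + k)
order-1 L k = trans (cong (λ n → slack (n ∸ 1)) (order+ L k)) (slack≡ (q L) (r L + k))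

pattern-bound : ∀ {cs C} → (cs , C) ∈ patterns → ∀ E → 11 ≤ size E + sizes cs → CappedBelow (size E + sizes cs) →
  60 * dot (functional (map cnt cs)) (cnt E) + slack (size E + sizes cs ∸ 1) ≤ cap (size E + sizes cs)
pattern-bound {cs} {C} pat∈ E h ih with size E ≤? 10
... | yes small = use (Equivalence.to T-∨ (All.lookup (all⁺ (rowHolds (cnt E) (size E)) (map row patterns) (proj₁ (∧⁻ (smallCases E small)))) (∈-map⁺ row pat∈)))
  where
  use : T (size E + sizes cs <ᵇ 11) ⊎ T (60 * dot (functional (map cnt cs)) (cnt E) + slack (size E + sizes cs ∸ 1) ≤ᵇ cap (size E + sizes cs)) → _
  use (inj₁ lt) = ⊥-elim (<⇒≱ (<ᵇ⇒< (size E + sizes cs) 11 lt) h)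
  use (inj₂ le) = ≤ᵇ⇒≤ _ _ le
... | no ¬small = subst₂ _≤_ (cong (60 * dot f (cnt E) +_) (sym (order-1 L k))) (sym (cap-order+ L k))
    (cert-sound C f (slack (r L + k)) (r L) (capForm (r L + k)) (proj₁ parts)
      (All.lookup (all⁺ (λ r → meets C (slack (r + k)) r (capForm (r + k))) (0 ∷ 1 ∷ 2 ∷ []) (proj₂ parts₂)) (r∈ L)) (cnt-nice E) (b≤q L)
      (reduce E L k C big (proj₁ parts₂) ih))
  where
  big = ≰⇒> ¬small
  L = large-order (size E) big
  k = sizes cs
  f = functional (map cnt cs)
  parts = ∧⁻ {covers C f} (All.lookup (all⁺ certified patterns patterns-certified) pat∈)
  parts₂ = ∧⁻ {shrinks k C} (proj₂ parts)

SpiderConditions : RT → Set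
SpiderConditions E = ∃ λ e → size E ≡ suc e
  × 60 * dot spiderBase (cnt E) + slack (e + 7) ≤ cap (e + 8)
  × 60 * dot spiderStep (cnt E) ≤ 18 * α (e + 1) + 60

spider-conditions : ∀ E → E ≢ cherry → CappedBelow (size E + 7) → SpiderConditions E
spider-conditions E ≢c ih with size E ≤? 10
... | yes small = use (size E) refl (Equivalence.to T-∨ (proj₂ (∧⁻ {all (rowHolds (cnt E) (size E)) (map row patterns)} (smallCases E small))))
  where
  cherry! : ∀ t → T (isCherry t) → t ≡ cherry
  cherry! (leaf ▷ leaf ▷ leaf) _ = refl
  use : ∀ m → size E ≡ m → T (isCherry E) ⊎ T (spiderHolds (cnt E) m) → SpiderConditions E
  use m       eq (inj₁ c) = ⊥-elim (≢c (cherry! E c))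
  use zero    eq (inj₂ _) = ⊥-elim (<⇒≱ (size>0 E) (≤-reflexive eq))
  use (suc e) eq (inj₂ h) with ∧⁻ {60 * dot spiderBase (cnt E) + slack (e + 7) ≤ᵇ cap (e + 8)} h
  ... | h₁ , h₂ = e , eq , ≤ᵇ⇒≤ _ _ h₁ , ≤ᵇ⇒≤ _ _ h₂
... | no ¬small = e , m≡ L , first , second
  where
  big = ≰⇒> ¬small
  L = large-order (size E) big
  e = q L * 3 + r L
  p₁ = ∧⁻ {covers certBase spiderBase} spider-certified
  p₂ = ∧⁻ {covers certStep spiderStep} (proj₂ p₁)
  p₃ = ∧⁻ {shrinks 7 certBase} (proj₂ p₂)
  p₄ = ∧⁻ {shrinks 7 certStep} (proj₂ p₃)
  residue = ∧⁻ {meets certBase (slack (r L + 7)) (r L) (baseGoal (r L))}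
    (All.lookup (all⁺ (λ r → meets certBase (slack (r + 7)) r (baseGoal r) ∧ meets certStep 0 r (stepGoal r)) (0 ∷ 1 ∷ 2 ∷ []) (proj₂ p₄)) (r∈ L))
  first : 60 * dot spiderBase (cnt E) + slack (e + 7) ≤ cap (e + 8)
  first = subst₂ _≤_
    (cong (60 * dot spiderBase (cnt E) +_) (sym (trans (cong slack (+-assoc (q L * 3) (r L) 7)) (slack≡ (q L) (r L + 7)))))
    (sym (trans (cong cap (trans (+-suc e 7) (cong suc (+-assoc (q L * 3) (r L) 7)))) (cap≡eval (q L) (r L + 7))))
    (cert-sound certBase spiderBase (slack (r L + 7)) (r L) (baseGoal (r L)) (proj₁ p₁) (proj₁ residue) (cnt-nice E) (b≤q L)
      (reduce E L 7 certBase big (proj₁ p₃) ih))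
  α-shift : ∀ q e → α (q * 3 + e) ≡ 3 ^ q * α e
  α-shift zero    e = sym (+-identityʳ _)
  α-shift (suc q) e = trans (cong (3 *_) (α-shift q e)) (sym (*-assoc 3 (3 ^ q) (α e)))
  lemma : ∀ a x q → 18 * a * x + 0 * q + 60 ≡ 18 * (x * a) + 60
  lemma = solve-∀
  second : 60 * dot spiderStep (cnt E) ≤ 18 * α (e + 1) + 60
  second = subst₂ _≤_ (+-identityʳ _)
    (trans (lemma (α (r L + 1)) (3 ^ q L) (q L)) (cong (λ z → 18 * z + 60) (sym (trans (cong α (+-assoc (q L * 3) (r L) 1)) (α-shift (q L) (r L + 1))))))
    (cert-sound certStep spiderStep 0 (r L) (stepGoal (r L)) (proj₁ p₂) (proj₂ residue) (cnt-nice E) (b≤q L)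
      (reduce E L 7 certStep big (proj₁ p₄) ih))

w>0 : ∀ t → 1 ≤ w (cnt t)
w>0 leaf    = ≤-refl
w>0 (R ▷ C) = subst (1 ≤_) (e (d (cnt R)) (x (cnt R)) (y (cnt R)) (a₀ (cnt C)) (b (cnt C)) (d (cnt C)))
  (*-mono-≤ (w>0 R) (≤-trans (w>0 C) (w≤s (cnt-nice C))))
  where
  e : ∀ D X Y a b d → (D + X + Y) * (a + b + d) ≡ D * (a + b + d) + X * (a + b) + Y * b + (X * d + Y * a) + Y * d
  e = solve-∀

-- A further leg, added to `j` legs, raises the count by `2 * 3^j * s + w` and the cap by
-- `2 * 3^j * A + 60`. Once `60 * s ≤ A`, the comparison of these increments at `j = 2` implies all
-- later ones.
spider-bound : ∀ E → SpiderConditions E → ∀ i → let c = cnt E in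
  60 * (3 ^ (2 + i) * s c + (2 + i) * w c + (x c + a₁ c)) + slack (size E + (2 + i) * 3) ≤ cap (size E + 1 + (2 + i) * 3)
spider-bound E (e , m≡ , h₀ , h₁) i =
  subst₂ _≤_ (cong (60 * (3 ^ (2 + i) * S + (2 + i) * W + Z) +_) (sym sl)) (sym cp) (go i)
  where
  c = cnt E
  S = s c
  W = w c
  Z = x c + a₁ c
  A = α (e + 1)
  B = β (e + 1)
  σ = slack (e + 1)
  open ≤-Reasoning
  sl : slack (size E + (2 + i) * 3) ≡ σ
  sl = trans (cong slack (trans (cong (_+ (2 + i) * 3) m≡) (lemma e ((2 + i) * 3)))) (slack≡ (2 + i) (e + 1))
    where
    lemma : ∀ e k → suc e + k ≡ k + (e + 1)
    lemma = solve-∀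
  cp : cap (size E + 1 + (2 + i) * 3) ≡ eval (capForm (e + 1)) (2 + i)
  cp = trans (cong cap (trans (cong (λ z → z + 1 + (2 + i) * 3) m≡) (lemma e ((2 + i) * 3)))) (cap≡eval (2 + i) (e + 1))
    where
    lemma : ∀ e k → suc e + 1 + k ≡ suc (k + (e + 1))
    lemma = solve-∀
  base₂ : 60 * (9 * S + 2 * W + Z) + σ ≤ A * 9 + 120 + B
  base₂ = subst₂ _≤_ (cong₂ _+_ (cong (60 *_) (lemma₁ (a₀ c) (a₁ c) (b c) (d c) (x c) (y c))) lemma₃)
    (trans (cong cap lemma₂) (cap≡eval 2 (e + 1))) h₀
    where
    lemma₁ : ∀ a a' b d x y → 9 * a + 1 * a' + 9 * b + 11 * d + 3 * x + 2 * y ≡ 9 * (a + b + d) + 2 * (d + x + y) + (x + a')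
    lemma₁ = solve-∀
    lemma₂ : e + 8 ≡ suc (6 + (e + 1))
    lemma₂ = trans (+-comm e 8) (cong (7 +_) (+-comm 1 e))
    lemma₃ : slack (e + 7) ≡ σ
    lemma₃ = cong slack (trans (+-comm e 7) (cong (6 +_) (+-comm 1 e)))
  step₁ : 18 * (60 * S) + 60 * W ≤ 18 * A + 60
  step₁ = subst (_≤ 18 * A + 60) (lemma (a₀ c) (a₁ c) (b c) (d c) (x c) (y c)) h₁
    where
    lemma : ∀ a a' b d x y → 60 * (18 * a + 0 * a' + 18 * b + 19 * d + 1 * x + 1 * y) ≡ 18 * (60 * (a + b + d)) + 60 * (d + x + y)
    lemma = solve-∀
  -- At least one set has its root outside, so `60 * W` already uses up the constant 60.
  S≤A : 60 * S ≤ A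
  S≤A = *-cancelˡ-≤ 18 (+-cancelʳ-≤ 60 _ _ (≤-trans (+-monoʳ-≤ (18 * (60 * S)) (*-monoʳ-≤ 60 (w>0 E))) step₁))
  go : ∀ i → 60 * (3 ^ (2 + i) * S + (2 + i) * W + Z) + σ ≤ eval (capForm (e + 1)) (2 + i)
  go zero    = base₂
  go (suc i) = begin
    60 * (3 * X * S + (3 + i) * W + Z) + σ                          ≡⟨ l₁ X S i W Z σ ⟩
    60 * (X * S + (2 + i) * W + Z) + σ + (2 * X * (60 * S) + 60 * W) ≤⟨ +-mono-≤ (go i) (scale-mono S≤A (*-monoʳ-≤ 2 (^-monoʳ-≤ 3 (m≤m+n 2 i))) step₁) ⟩
    A * X + 60 * (2 + i) + B + (2 * X * A + 60)                     ≡⟨ l₂ A X i B ⟩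
    A * (3 * X) + 60 * (3 + i) + B                                  ∎
    where
    X = 3 ^ (2 + i)
    l₁ : ∀ X S i W Z σ → 60 * (3 * X * S + (3 + i) * W + Z) + σ ≡ 60 * (X * S + (2 + i) * W + Z) + σ + (2 * X * (60 * S) + 60 * W)
    l₁ = solve-∀
    l₂ : ∀ A X i B → A * X + 60 * (2 + i) + B + (2 * X * A + 60) ≡ A * (3 * X) + 60 * (3 + i) + B
    l₂ = solve-∀

-- Trees of order at least 11


infix 4 _≈_
_≈_ : RT → RT → Set
t ≈ t' = gr t ≃ gr t'

spider : ℕ → RT
spider k = attach leaf (replicate k cherry)

record Capped (t : RT) : Set where
  constructor capped
  field bound : 60 * φ t + slack (size t ∸ 1) ≤ cap (size t)

Good : RT → Set
Good t = Capped t ⊎ ∃ λ k → size t ≡ k * 3 + 1 × t ≈ spider k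

good-≈ : ∀ {t t'} → t ≈ t' → Good t → Good t'
good-≈ {t} {t'} i (inj₁ (capped h)) = inj₁ (capped (subst₂ (λ n m → 60 * n + slack (m ∸ 1) ≤ cap m) (φ-≃ {t} {t'} i) (size-≃ {t} {t'} i) h))
good-≈ {t} {t'} i (inj₂ (k , e , j)) = inj₂ (k , trans (sym (size-≃ {t} {t'} i)) e , ≃-trans (≃-sym i) j)

flip-≈ : ∀ R C → R ▷ C ≈ C ▷ R
flip-≈ R C = link-flip (gr R) (gr C)

↭-≈ : ∀ {cs cs'} → cs ↭ cs' → attach leaf cs ≈ attach leaf cs'
↭-≈ h = plain (attach-↭ leaf h)

attach-∷ʳ : ∀ R cs c → attach R (cs ∷ʳ c) ≡ attach R cs ▷ c
attach-∷ʳ R cs c = foldl-∷ʳ _▷_ R c cs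

-- Rerooting at the lower end of the edge turns the rest `E` of the tree into one more child, on an
-- equal footing with the pieces.
hang-≈ : ∀ E cs → E ▷ attach leaf cs ≈ attach leaf (E ∷ cs)
hang-≈ E cs = ≃-trans (flip-≈ E (attach leaf cs))
  (subst (_≈ attach leaf (E ∷ cs)) (attach-∷ʳ leaf cs E) (↭-≈ (↭-sym (∷↭∷ʳ E cs))))

attach-++ : ∀ R cs cs' → attach R (cs ++ cs') ≡ attach (attach R cs) cs'
attach-++ = foldl-++ _▷_

Leg : RT → Set
Leg c = c ∈ cherry ∷ path₃ ∷ []

-- The rooted pieces that survive the reductions. Legs may hang at one vertex in any number, whereas
-- an odd piece next to any other surviving piece is reducible, a pair of leaves excepted.
odds irreducibles : List RT
odds = leaf ∷ path₂ ∷ path₄ ∷ claw ∷ broom ∷ []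
irreducibles = cherry ∷ path₃ ∷ odds

-- A certificate for a dominating functional of the same order is enough. This accounts for permuted
-- pieces and for `path₃` in place of `cherry`.
covered : List RT → Bool
covered cs = any (λ (cs' , _) → (functional (map cnt cs) ≤ᶜ functional (map cnt cs')) ∧ (sizes cs ≡ᵇ sizes cs')) patterns

record Covered (cs : List RT) : Set where
  constructor cover
  field
    model : Pattern
    model∈ : model ∈ patterns
    below  : T (functional (map cnt cs) ≤ᶜ functional (map cnt (proj₁ model)))
    sizes≡ : sizes cs ≡ sizes (proj₁ model)

covered⇒Covered : ∀ cs → T (covered cs) → Covered cs
covered⇒Covered cs h = find patterns (λ i → i) h
  where
  find : ∀ ps → (∀ {p} → p ∈ ps → p ∈ patterns) →
    T (any (λ (cs' , _) → (functional (map cnt cs) ≤ᶜ functional (map cnt cs')) ∧ (sizes cs ≡ᵇ sizes cs')) ps) → Covered cs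
  find (p ∷ ps) sub h with Equivalence.to (T-∨ {(functional (map cnt cs) ≤ᶜ functional (map cnt (proj₁ p))) ∧ (sizes cs ≡ᵇ sizes (proj₁ p))}) h
  ... | inj₁ hp with ∧⁻ {functional (map cnt cs) ≤ᶜ functional (map cnt (proj₁ p))} hp
  ...   | le , sz = cover p (sub (here refl)) le (≡ᵇ⇒≡ _ _ sz)
  find (p ∷ ps) sub h | inj₂ hps = find ps (sub ∘ there) hps

covered⇒capped : ∀ cs → Covered cs → ∀ E → 11 ≤ size E + sizes cs → CappedBelow (size E + sizes cs) → Capped (attach E cs)
covered⇒capped cs (cover (cs' , C) p∈ le k≡) E big ih = capped (begin
  60 * φ (attach E cs) + slack (size (attach E cs) ∸ 1)
    ≡⟨ cong₂ (λ a m → 60 * a + slack (m ∸ 1)) (φ-attach E cs) size≡ ⟩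
  60 * dot (functional (map cnt cs)) (cnt E) + slack (size E + sizes cs' ∸ 1)
    ≤⟨ +-monoˡ-≤ _ (*-monoʳ-≤ 60 (dot-mono {functional (map cnt cs)} (cnt E) le)) ⟩
  60 * dot (functional (map cnt cs')) (cnt E) + slack (size E + sizes cs' ∸ 1)
    ≤⟨ pattern-bound p∈ E (subst (λ k → 11 ≤ size E + k) k≡ big) (subst (λ k → CappedBelow (size E + k)) k≡ ih) ⟩
  cap (size E + sizes cs')
    ≡⟨ cong cap (sym size≡) ⟩
  cap (size (attach E cs)) ∎)
  where
  open ≤-Reasoning
  size≡ : size (attach E cs) ≡ size E + sizes cs'
  size≡ = trans (size-attach E cs) (cong (size E +_) k≡)

isLeaf : RT → Bool
isLeaf leaf = true
isLeaf _    = false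

isLeaf⇒ : ∀ t → T (isLeaf t) → t ≡ leaf
isLeaf⇒ leaf _ = refl

pair-check : RT → RT → Bool
pair-check c c' = (isLeaf c ∧ isLeaf c') ∨ covered (c ∷ c' ∷ [])

pair-checks : T (all (λ c → all (pair-check c) irreducibles) odds)
pair-checks = _

pairs-covered : ∀ {c c'} → c ∈ odds → c' ∈ irreducibles → (c ≡ leaf × c' ≡ leaf) ⊎ Covered (c ∷ c' ∷ [])
pairs-covered {c} {c'} i j = use (Equivalence.to T-∨ (All.lookup (all⁺ (pair-check c) irreducibles
    (All.lookup (all⁺ (λ c → all (pair-check c) irreducibles) odds pair-checks) i)) j))
  where
  use : T (isLeaf c ∧ isLeaf c') ⊎ T (covered (c ∷ c' ∷ [])) → (c ≡ leaf × c' ≡ leaf) ⊎ Covered (c ∷ c' ∷ [])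
  use (inj₁ h) = inj₁ (isLeaf⇒ c (proj₁ (∧⁻ {isLeaf c} h)) , isLeaf⇒ c' (proj₂ (∧⁻ {isLeaf c} h)))
  use (inj₂ h) = inj₂ (covered⇒Covered (c ∷ c' ∷ []) h)

three-leaves : Covered (leaf ∷ leaf ∷ leaf ∷ [])
three-leaves = covered⇒Covered (leaf ∷ leaf ∷ leaf ∷ []) _

singles-covered : ∀ {c} → c ∈ irreducibles → leaf ▷ c ∈ irreducibles ⊎ Covered (leaf ▷ c ∷ [])
singles-covered (here refl) = inj₁ (there (there (there (there (there (here refl))))))
singles-covered (there (here refl)) = inj₁ (there (there (there (there (here refl)))))
singles-covered (there (there (here refl))) = inj₁ (there (there (there (here refl))))
singles-covered (there (there (there (here refl)))) = inj₁ (there (here refl))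
singles-covered (there (there (there (there (here refl))))) = inj₂ (covered⇒Covered (leaf ▷ path₄ ∷ []) _)
singles-covered (there (there (there (there (there (here refl)))))) = inj₁ (there (there (there (there (there (there (here refl)))))))
singles-covered (there (there (there (there (there (there (here refl))))))) = inj₂ (covered⇒Covered (leaf ▷ broom ∷ []) _)

leg-or-odd : ∀ {c} → c ∈ irreducibles → Leg c ⊎ c ∈ odds
leg-or-odd (here e)          = inj₁ (here e)
leg-or-odd (there (here e))  = inj₁ (there (here e))
leg-or-odd (there (there i)) = inj₂ i

find-odd : ∀ cs → All (_∈ irreducibles) cs → All Leg cs ⊎ ∃₂ λ c rest → cs ↭ c ∷ rest × c ∈ odds × All (_∈ irreducibles) rest
find-odd []       []       = inj₁ []
find-odd (c ∷ cs) (i ∷ is) with leg-or-odd i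
... | inj₂ o = inj₂ (c , cs , ↭-refl , o , is)
... | inj₁ l with find-odd cs is
...   | inj₁ ls = inj₁ (l ∷ ls)
...   | inj₂ (o , rest , p , i' , is') = inj₂ (o , c ∷ rest , ↭-trans (prep c p) (↭.swap c o ↭-refl) , i' , i ∷ is')

sizes-legs : ∀ {cs} → All Leg cs → sizes cs ≡ length cs * 3
sizes-legs []                       = refl
sizes-legs (here refl ∷ ls)         = cong (3 +_) (sizes-legs ls)
sizes-legs (there (here refl) ∷ ls) = cong (3 +_) (sizes-legs ls)

bent : ∀ {cs} → All Leg cs → ℕ
bent []                       = 0
bent (here _ ∷ ls)            = bent ls
bent (there _ ∷ ls)           = suc (bent ls)

unbent : ∀ {cs} (ls : All Leg cs) → bent ls ≡ 0 → cs ≡ replicate (length cs) cherry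
unbent []               _ = refl
unbent (here refl ∷ ls) h = cong (cherry ∷_) (unbent ls h)

-- Legs attached by an end (path₃) instead of the centre (cherry) cost y each.
φ-legs : ∀ R {cs} (ls : All Leg cs) → let c = cnt R ; i = length cs in
  φ (attach R cs) + x c + y c + bent ls * y c ≡ a₀ c + b c + i * p c + 3 ^ i * w c
φ-legs R [] = lemma (a₀ (cnt R)) (a₁ (cnt R)) (b (cnt R)) (d (cnt R)) (x (cnt R)) (y (cnt R))
  where
  lemma : ∀ a a' b d x y → a + b + d + x + y + 0 ≡ a + b + 0 + 1 * (d + x + y)
  lemma = solve-∀
φ-legs R {_ ∷ cs} (here refl ∷ ls) = +-cancelʳ-≡ 0 _ _ (trans (lemma₁ f (a₀ c) (a₁ c) (b c) (d c) (x c) (y c) (bent ls)) (trans (φ-legs (R ▷ cherry) ls)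
    (lemma₂ (a₀ c) (a₁ c) (b c) (d c) (x c) (y c) i (3 ^ i))))
  where
  c = cnt R
  i = length cs
  f = φ (attach (R ▷ cherry) cs)
  lemma₁ : ∀ f a a' b d x y k → f + x + y + k * y + 0 ≡ f + (x * 1 + y * 0) + (y * 1) + k * (y * 1)
  lemma₁ = solve-∀
  lemma₂ : ∀ a a' b d x y i q → a * 1 + (b * 1 + (a + a') * 1) + i * (a * 1 + (a * 0 + a' * 1))
    + q * (d * 3 + x * 2 + y * 2 + (x * 1 + y * 0) + y * 1)
    ≡ a + b + ((a + a') + i * (a + a')) + 3 * q * (d + x + y) + 0
  lemma₂ = solve-∀
φ-legs R {_ ∷ cs} (there (here refl) ∷ ls) = +-cancelʳ-≡ (x c) _ _ (trans (lemma₁ f (a₀ c) (a₁ c) (b c) (d c) (x c) (y c) (bent ls)) (trans (cong (_+ x c) (φ-legs (R ▷ path₃) ls))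
    (lemma₂ (a₀ c) (a₁ c) (b c) (d c) (x c) (y c) i (3 ^ i))))
  where
  c = cnt R
  i = length cs
  f = φ (attach (R ▷ path₃) cs)
  lemma₁ : ∀ f a a' b d x y k → f + x + y + (1 + k) * y + x ≡ f + (x * 1 + y * 1) + (y * 1) + k * (y * 1) + x
  lemma₁ = solve-∀
  lemma₂ : ∀ a a' b d x y i q → a * 1 + (b * 1 + (a + a') * 1) + i * (a * 1 + (a * 0 + a' * 1))
    + q * (d * 3 + x * 2 + y * 1 + (x * 1 + y * 1) + y * 1) + x
    ≡ a + b + ((a + a') + i * (a + a')) + 3 * q * (d + x + y) + x
  lemma₂ = solve-∀

-- An instance of `φ-legs`: a bent leg costs `d` of `E` here because `y (cnt (leaf ▷ E))` is
-- `d (cnt E)`.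
φ-legs-at : ∀ E {cs} (ls : All Leg cs) → let c = cnt E ; i = length cs in
  φ (attach leaf (E ∷ cs)) + bent ls * d c ≡ 3 ^ i * s c + i * w c + (x c + a₁ c)
φ-legs-at E {cs} ls = +-cancelʳ-≡ (a₀ c + d c) _ _ (trans
  (lemma₁ f (a₀ c) (a₁ c) (b c) (d c) (x c) (y c) (bent ls))
  (trans (φ-legs (leaf ▷ E) ls) (lemma₂ (a₀ c) (a₁ c) (b c) (d c) (x c) (y c) i (3 ^ i))))
  where
  c = cnt E
  i = length cs
  f = φ (attach leaf (E ∷ cs))
  lemma₁ : ∀ f a a' b d x y k → f + k * d + (a + d) ≡ f + (0 * d + 1 * a) + 1 * d + k * (1 * d)
  lemma₁ = solve-∀
  lemma₂ : ∀ a a' b d x y i q →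
    1 * (d + x) + (0 * (d + x + y) + (1 + 0) * (a + a')) + i * (1 * (d + x) + (1 * y + 0 * (d + x + y)))
    + q * (0 * (a + b + d) + 0 * (a + b) + 1 * b + (0 * d + 1 * a) + 1 * d)
    ≡ q * (a + b + d) + i * (d + x + y) + (x + a') + (a + d)
  lemma₂ = solve-∀

capped-below-mono : ∀ {m n} → m ≤ n → CappedBelow n → CappedBelow m
capped-below-mono m≤n ih t big lt = ih t big (≤-trans lt m≤n)

size-legs : ∀ E {cs} → All Leg cs → size (attach leaf (E ∷ cs)) ≡ size E + 1 + length cs * 3
size-legs E {cs} ls = trans (size-attach leaf (E ∷ cs)) (trans (cong (λ k → 1 + (size E + k)) (sizes-legs ls)) (lemma (size E) (length cs * 3)))
  where
  lemma : ∀ e k → 1 + (e + k) ≡ e + 1 + k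
  lemma = solve-∀

-- Counting `cherry` as a leg, the formula gives `3^(i+1) + (i+1)` minus the number of bent legs, as
-- `d (cnt cherry)` is 1. Without bent legs the tree is `T*`; a single bent leg pays the whole
-- slack.
legs-cherry : ∀ {cs} (ls : All Leg cs) → Good (attach leaf (cherry ∷ cs))
legs-cherry {cs} ls with bent ls in be
... | zero  = inj₂ (suc i , trans (size-legs cherry ls) (lemma (i * 3))
                   , subst (λ ds → attach leaf (cherry ∷ ds) ≈ spider (suc i)) (sym (unbent ls be)) ≃-refl)
  where
  i = length cs
  lemma : ∀ k → 3 + 1 + k ≡ 3 + k + 1
  lemma = solve-∀
... | suc k = inj₁ (capped (begin
  60 * f + slack (size T' ∸ 1)                     ≡⟨ cong (λ m → 60 * f + slack (m ∸ 1)) size≡ ⟩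
  60 * f + slack (suc i * 3 + 0)                   ≡⟨ cong (60 * f +_) (slack≡ (suc i) 0) ⟩
  60 * f + 60                                      ≤⟨ +-monoʳ-≤ (60 * f) (m≤m+n 60 (60 * k)) ⟩
  60 * f + (60 + 60 * k)                           ≡⟨ lemma₁ f k ⟩
  60 * (f + suc k * 1)                             ≡⟨ cong (60 *_) exact ⟩
  60 * (3 ^ i * 3 + i * 1 + 1)                     ≡⟨ lemma₂ (3 ^ i) i ⟩
  eval (capForm 0) (suc i)                         ≡⟨ sym (cap≡eval (suc i) 0) ⟩
  cap (suc (suc i * 3 + 0))                        ≡⟨ cong cap (sym size≡) ⟩
  cap (size T')                                    ∎))
  where
  open ≤-Reasoning
  T' = attach leaf (cherry ∷ cs)
  f = φ T'
  i = length cs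
  exact : f + suc k * 1 ≡ 3 ^ i * 3 + i * 1 + 1
  exact = trans (cong (λ z → f + z * 1) (sym be)) (φ-legs-at cherry ls)
  lemma₀ : ∀ k → 3 + 1 + k ≡ suc (3 + k + 0)
  lemma₀ = solve-∀
  size≡ : size T' ≡ suc (suc i * 3 + 0)
  size≡ = trans (size-legs cherry ls) (lemma₀ (i * 3))
  lemma₁ : ∀ f k → 60 * f + (60 + 60 * k) ≡ 60 * (f + suc k * 1)
  lemma₁ = solve-∀
  lemma₂ : ∀ q i → 60 * (q * 3 + i * 1 + 1) ≡ 60 * (3 * q) + 60 * suc i + 0
  lemma₂ = solve-∀

legs-capped : ∀ E → E ≢ cherry → ∀ {cs} (ls : All Leg cs) → 2 ≤ length cs →
  CappedBelow (size E + size (attach leaf cs)) → Capped (attach leaf (E ∷ cs))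
legs-capped E ≢c {cs} ls two ih with m≤n⇒∃[o]m+o≡n two
... | j , 2+j≡ = capped (begin
  60 * f + slack (size T' ∸ 1)                                        ≡⟨ cong (λ m → 60 * f + slack (m ∸ 1)) size≡ ⟩
  60 * f + slack (size E + 1 + (2 + j) * 3 ∸ 1)                       ≡⟨ cong (λ m → 60 * f + slack (m ∸ 1)) (lemma (size E) ((2 + j) * 3)) ⟩
  60 * f + slack (size E + (2 + j) * 3)                               ≤⟨ +-monoˡ-≤ _ (*-monoʳ-≤ 60 (≤-trans (m≤m+n f _)
      (≤-reflexive (trans (φ-legs-at E ls) (cong (λ i → 3 ^ i * s c + i * w c + (x c + a₁ c)) (sym 2+j≡)))))) ⟩
  60 * (3 ^ (2 + j) * s c + (2 + j) * w c + (x c + a₁ c)) + slack (size E + (2 + j) * 3)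
                                                                      ≤⟨ spider-bound E (spider-conditions E ≢c (capped-below-mono size≤ ih)) j ⟩
  cap (size E + 1 + (2 + j) * 3)                                      ≡⟨ cong cap (sym size≡) ⟩
  cap (size T')                                                       ∎)
  where
  open ≤-Reasoning
  c = cnt E
  T' = attach leaf (E ∷ cs)
  f = φ T'
  size≡ : size T' ≡ size E + 1 + (2 + j) * 3
  size≡ = trans (size-legs E ls) (cong (λ i → size E + 1 + i * 3) (sym 2+j≡))
  lemma : ∀ e k → e + 1 + k ≡ suc (e + k)
  lemma = solve-∀
  size≤ : size E + 7 ≤ size E + size (attach leaf cs)
  size≤ = +-monoʳ-≤ (size E) (≤-trans (s≤s (*-monoˡ-≤ 3 two)) (≤-reflexive (sym (trans (size-attach leaf cs) (cong suc (sizes-legs ls))))))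

legs-good : ∀ E {cs} → All Leg cs → 2 ≤ length cs → CappedBelow (size E + size (attach leaf cs)) → Good (attach leaf (E ∷ cs))
legs-good E ls two ih with cherry? E
  where
  cherry? : ∀ t → t ≡ cherry ⊎ t ≢ cherry
  cherry? leaf = inj₂ λ ()
  cherry? (leaf ▷ C) = inj₂ λ ()
  cherry? (leaf ▷ leaf ▷ leaf) = inj₁ refl
  cherry? (leaf ▷ leaf ▷ (_ ▷ _)) = inj₂ λ ()
  cherry? (leaf ▷ (_ ▷ _) ▷ C) = inj₂ λ ()
  cherry? (_ ▷ _ ▷ _ ▷ C) = inj₂ λ ()
... | inj₁ refl = legs-cherry ls
... | inj₂ ≢c   = inj₁ (legs-capped E ≢c ls two ih)

-- Seen from the vertex that carries the pieces, `E` and the other children together are the tree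
-- `F` to which the pattern applies.
cover-good : ∀ E cs {ds rest} → ds ↭ cs ++ rest → Covered cs → 11 ≤ size E + size (attach leaf ds) →
  CappedBelow (size E + size (attach leaf ds)) → Good (E ▷ attach leaf ds)
cover-good E cs {ds} {rest} p h big ih = good-≈ (≃-sym i)
  (inj₁ (covered⇒capped cs h F (subst (11 ≤_) order≡ big) (subst CappedBelow order≡ ih)))
  where
  F = attach leaf (E ∷ rest)
  i : E ▷ attach leaf ds ≈ attach F cs
  i = ≃-trans (hang-≈ E ds) (subst (attach leaf (E ∷ ds) ≈_) (attach-++ leaf (E ∷ rest) cs)
        (↭-≈ (prep E (↭-trans p (++-comm cs rest)))))
  order≡ : size E + size (attach leaf ds) ≡ size F + sizes cs
  order≡ = trans (size-≃ {E ▷ attach leaf ds} {attach F cs} i) (size-attach F cs)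

leaves : ∀ {ds} → leaf ∷ leaf ∷ [] ↭ ds → attach leaf ds ≡ cherry
leaves {ds} p with All-resp-↭ {P = _≡ leaf} p (refl ∷ refl ∷ []) | ↭-length p
leaves {_ ∷ _ ∷ []} p | refl ∷ refl ∷ [] | _ = refl
leaves {[]} p | _ | ()
leaves {_ ∷ []} p | _ | ()
leaves {_ ∷ _ ∷ _ ∷ _} p | _ | ()

module _ (E : RT) where
  private
    Reduces : RT → Set
    Reduces t = Good (E ▷ t) ⊎ t ∈ irreducibles

  -- Two leaves alone make a cherry, which is irreducible. A third child is again a leaf, giving
  -- three leaves, or forms a covered pair with one of the two.
  classify-leaves : ∀ ds rest → All (_∈ irreducibles) rest → ds ↭ leaf ∷ leaf ∷ rest → 11 ≤ size E + size (attach leaf ds) →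
    CappedBelow (size E + size (attach leaf ds)) → Reduces (attach leaf ds)
  classify-leaves ds []         _       p big ih = inj₂ (subst (_∈ irreducibles) (sym (leaves (↭-sym p))) (here refl))
  classify-leaves ds (c ∷ rest) (j ∷ _) p big ih = inj₁ (third (pairs-covered (here refl) j))
    where
    third : (leaf ≡ leaf × c ≡ leaf) ⊎ Covered (leaf ∷ c ∷ []) → Good (E ▷ attach leaf ds)
    third (inj₂ h)          = cover-good E (leaf ∷ c ∷ []) (↭-trans p (prep leaf (↭.swap leaf c ↭-refl))) h big ih
    third (inj₁ (_ , refl)) = cover-good E (leaf ∷ leaf ∷ leaf ∷ []) p three-leaves big ih

  classify-many : ∀ ds → 2 ≤ length ds → 11 ≤ size E + size (attach leaf ds) → CappedBelow (size E + size (attach leaf ds)) →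
    (All Leg ds ⊎ ∃₂ λ c rest → ds ↭ c ∷ rest × c ∈ odds × All (_∈ irreducibles) rest) → Reduces (attach leaf ds)
  classify-many ds two big ih (inj₁ ls) = inj₁ (good-≈ (≃-sym (hang-≈ E ds)) (legs-good E ls two ih))
  classify-many ds two big ih (inj₂ (c , [] , p , _)) = ⊥-elim (1+n≰n (≤-trans two (≤-reflexive (↭-length p))))
  classify-many ds two big ih (inj₂ (c , c' ∷ rest , p , o , i ∷ js)) = pair (pairs-covered o i)
    where
    pair : (c ≡ leaf × c' ≡ leaf) ⊎ Covered (c ∷ c' ∷ []) → Reduces (attach leaf ds)
    pair (inj₂ h)             = inj₁ (cover-good E (c ∷ c' ∷ []) p h big ih)
    pair (inj₁ (refl , refl)) = classify-leaves ds rest js p big ih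

  classify : ∀ cs → All (_∈ irreducibles) cs → 11 ≤ size E + size (attach leaf cs) →
    CappedBelow (size E + size (attach leaf cs)) → Reduces (attach leaf cs)
  classify []       _        big ih = inj₂ (there (there (here refl)))
  classify (c ∷ []) (i ∷ []) big ih = only (singles-covered i)
    where
    order≡ : size E + size (leaf ▷ c) ≡ size E + sizes (leaf ▷ c ∷ [])
    order≡ = cong (size E +_) (sym (+-identityʳ _))
    only : leaf ▷ c ∈ irreducibles ⊎ Covered (leaf ▷ c ∷ []) → Reduces (leaf ▷ c)
    only (inj₁ j) = inj₂ j
    only (inj₂ h) = inj₁ (inj₁ (covered⇒capped (leaf ▷ c ∷ []) h E (subst (11 ≤_) order≡ big) (subst CappedBelow order≡ ih)))
  classify ds@(_ ∷ _ ∷ _) is big ih = classify-many ds (s≤s (s≤s z≤n)) big ih (find-odd ds is)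

kids : RT → List RT
kids leaf    = []
kids (R ▷ C) = kids R ∷ʳ C

attach-kids : ∀ t → attach leaf (kids t) ≡ t
attach-kids leaf    = refl
attach-kids (R ▷ C) = trans (attach-∷ʳ leaf (kids R) C) (cong (_▷ C) (attach-kids R))

-- A bottom-up search for a reducible piece. The complement of a child consists of its parent, its
-- siblings and the outer part; `X` collects these, so the recursion is structural although each
-- subtree is confronted with its own complement.
irreducible : ∀ t E → 11 ≤ size E + size t → CappedBelow (size E + size t) → Good (E ▷ t) ⊎ t ∈ irreducibles
kids-irreducible : ∀ t X → let n = size (attach leaf (kids t ++ X)) in
  11 ≤ n → CappedBelow n → Good (attach leaf (kids t ++ X)) ⊎ All (_∈ irreducibles) (kids t)

irreducible t E big ih with kids-irreducible t (E ∷ []) (subst (11 ≤_) order≡ big) (subst CappedBelow order≡ ih)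
  where
  order≡ : size E + size t ≡ size (attach leaf (kids t ++ E ∷ []))
  order≡ = sym (trans (cong size (trans (attach-∷ʳ leaf (kids t) E) (cong (_▷ E) (attach-kids t)))) (+-comm (size t) (size E)))
... | inj₁ g = inj₁ (good-≈ (flip-≈ t E) (subst Good (trans (attach-∷ʳ leaf (kids t) E) (cong (_▷ E) (attach-kids t))) g))
... | inj₂ is = subst (λ t → Good (E ▷ t) ⊎ t ∈ irreducibles) (attach-kids t)
  (classify E (kids t) is (subst (λ t → 11 ≤ size E + size t) (sym (attach-kids t)) big)
                          (subst (λ t → CappedBelow (size E + size t)) (sym (attach-kids t)) ih))

kids-irreducible leaf    X big ih = inj₂ []
kids-irreducible (R ▷ C) X big ih with kids-irreducible R (C ∷ X)
    (subst (λ l → 11 ≤ size (attach leaf l)) (++-assoc (kids R) (C ∷ []) X) big)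
    (subst (λ l → CappedBelow (size (attach leaf l))) (++-assoc (kids R) (C ∷ []) X) ih)
... | inj₁ g = inj₁ (subst (λ l → Good (attach leaf l)) (sym (++-assoc (kids R) (C ∷ []) X)) g)
... | inj₂ is with irreducible C (attach leaf (kids R ++ X)) (subst (11 ≤_) (sym order≡) big) (subst CappedBelow (sym order≡) ih)
  where
  i : attach leaf (kids R ++ X) ▷ C ≈ attach leaf (kids (R ▷ C) ++ X)
  i = subst₂ _≈_ (attach-∷ʳ leaf (kids R ++ X) C) (cong (attach leaf) (sym (++-assoc (kids R) (C ∷ []) X)))
        (↭-≈ (↭-trans (↭-sym (∷↭∷ʳ C (kids R ++ X))) (↭-sym (↭.shift C (kids R) X))))
  order≡ : size (attach leaf (kids R ++ X)) + size C ≡ size (attach leaf (kids (R ▷ C) ++ X))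
  order≡ = size-≃ {attach leaf (kids R ++ X) ▷ C} i
...   | inj₂ j = inj₂ (All.++⁺ is (j ∷ []))
...   | inj₁ g = inj₁ (good-≈ i g)
  where
  i : attach leaf (kids R ++ X) ▷ C ≈ attach leaf (kids (R ▷ C) ++ X)
  i = subst₂ _≈_ (attach-∷ʳ leaf (kids R ++ X) C) (cong (attach leaf) (sym (++-assoc (kids R) (C ∷ []) X)))
        (↭-≈ (↭-trans (↭-sym (∷↭∷ʳ C (kids R ++ X))) (↭-sym (↭.shift C (kids R) X))))

φ-spider : ∀ k → φ (spider k) ≡ 3 ^ k + k
φ-spider k = +-cancelʳ-≡ 1 _ _ (trans (trans (lemma₁ (φ (spider k))) (cong (λ z → φ (spider k) + 0 + 1 + z * 1) (sym (bent-straight k))))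
    (trans (φ-legs leaf (straight k)) (trans (cong (λ i → 1 + 0 + i * 1 + 3 ^ i * 1) (length-replicate k)) (lemma₂ (3 ^ k) k))))
  where
  straight : ∀ k → All Leg (replicate k cherry)
  straight zero    = []
  straight (suc k) = here refl ∷ straight k
  bent-straight : ∀ k → bent (straight k) ≡ 0
  bent-straight zero    = refl
  bent-straight (suc k) = bent-straight k
  lemma₁ : ∀ f → f + 1 ≡ f + 0 + 1 + 0
  lemma₁ = solve-∀
  lemma₂ : ∀ x k → 1 + 0 + k * 1 + x * 1 ≡ x + k + 1
  lemma₂ = solve-∀

good⇒capped : ∀ t → Good t → 60 * φ t ≤ cap (size t)
good⇒capped t (inj₁ (capped h)) = ≤-trans (m≤m+n _ _) h
good⇒capped t (inj₂ (k , e , i)) = ≤-reflexive (trans (cong (60 *_) (trans (φ-≃ {t} {spider k} i) (φ-spider k)))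
  (sym (trans (cong cap (trans e (lemma (k * 3)))) (trans (cap≡eval k 0) (lemma' (3 ^ k) k)))))
  where
  lemma : ∀ k → k + 1 ≡ suc (k + 0)
  lemma = solve-∀
  lemma' : ∀ x k → 60 * x + 60 * k + 0 ≡ 60 * (x + k)
  lemma' = solve-∀

irreducible-small : ∀ {t} → t ∈ irreducibles → size t ≤ 5
irreducible-small i = ≤ᵇ⇒≤ _ 5 (All.lookup (all⁺ (λ t → size t ≤ᵇ 5) irreducibles _) i)

-- Strong induction on the order. If neither side of the last edge reduces, both have order at most
-- 5, which contradicts order 11.
large-good : ∀ t → 11 ≤ size t → Good t
large-good t = go t (<-wellFounded (size t))
  where
  go : ∀ t → Acc _<_ (size t) → 11 ≤ size t → Good t
  go leaf    _         (s≤s ())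
  go (R ▷ C) (acc rec) big with irreducible C R big (λ t' big' lt → good⇒capped t' (go t' (rec lt) big'))
  ... | inj₁ g = g
  ... | inj₂ i with irreducible R C (subst (11 ≤_) (+-comm (size R) (size C)) big)
        (λ t' big' lt → good⇒capped t' (go t' (rec (subst (size t' <_) (+-comm (size C) (size R)) lt)) big'))
  ...   | inj₁ g = good-≈ (flip-≈ C R) g
  ...   | inj₂ j = ⊥-elim (<⇒≱ big (≤-trans (+-mono-≤ (irreducible-small j) (irreducible-small i)) ≤-refl))

-- Trees of order at most 10

_==_ : RT → RT → Bool
leaf    == leaf      = true
(R ▷ C) == (R' ▷ C') = (R == R') ∧ (C == C')
_       == _         = false

==⇒≡ : ∀ t t' → T (t == t') → t ≡ t'
==⇒≡ leaf    leaf      _ = refl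
==⇒≡ (R ▷ C) (R' ▷ C') h with ∧⁻ {R == R'} h
... | h₁ , h₂ = cong₂ _▷_ (==⇒≡ R R' h₁) (==⇒≡ C C' h₂)

reorderings : ∀ t → List (Σ RT λ t' → gr t ≃ᵐ gr t')
reorderings leaf    = []
reorderings (R ▷ C) = map (λ (R' , i) → R' ▷ C , link-cong i ≃ᵐ-refl) (reorderings R)
                   ++ map (λ (C' , i) → R ▷ C' , link-cong ≃ᵐ-refl i) (reorderings C)
                   ++ swap R
  where
  swap : ∀ R → List (Σ RT λ t' → gr (R ▷ C) ≃ᵐ gr t')
  swap leaf      = []
  swap (R ▷ C')  = (R ▷ C ▷ C' , link-swap (gr R) (gr C') (gr C)) ∷ []

moves : ∀ t → List (∃ (t ≈_))
moves leaf    = []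
moves (R ▷ C) = (C ▷ R , flip-≈ R C) ∷ map (λ (t' , i) → t' , plain i) (reorderings (R ▷ C))

extend : ∀ {t} → List (∃ (t ≈_)) → List (∃ (t ≈_)) → List (∃ (t ≈_))
extend known []             = known
extend known ((t' , i) ∷ l) with any (λ (t'' , _) → t' == t'') known
... | true  = extend known l
... | false = extend ((t' , i) ∷ known) l

-- The terms reachable in at most the given number of rerootings and exchanges of children, each
-- with its isomorphism. Searching this list for a given term takes the place of an isomorphism
-- test.
presentations : ∀ t → ℕ → List (∃ (t ≈_))
presentations t zero    = (t , ≃-refl) ∷ []
presentations t (suc k) = extend (presentations t k)
  (concatMap (λ (t' , i) → map (λ (t'' , j) → t'' , ≃-trans i j) (moves t')) (presentations t k))

search : ∀ {t} t' → List (∃ (t ≈_)) → Maybe (t ≈ t')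
search t' []              = nothing
search t' ((t'' , i) ∷ l) with t'' == t' in eq
... | true  = just (subst (_ ≈_) (==⇒≡ t'' t' (Equivalence.from T-≡ eq)) i)
... | false = search t' l

-- Correct for n ≤ 10 only.
best : ℕ → ℕ
best 3  = 3
best 4  = 4
best 5  = 5
best 6  = 6
best 7  = 11
best 8  = 15
best 9  = 19
best 10 = 30
best _  = 1

quad dumbbell : RT
quad     = attach leaf (replicate 4 leaf)
dumbbell = claw ▷ claw

-- Recorded at orders 4, 7 and 10 for equality with `t(n)`, and at 3, 4, 5, 7 and 8 for the
-- components of optimal and second best forests.
champion : ℕ → Maybe RT
champion 3  = just cherry
champion 4  = just (spider 1)
champion 5  = just quad
champion 7  = just (spider 2)
champion 8  = just dumbbell
champion 10 = just (spider 3)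
champion _  = nothing

-- Large enough to reach every presentation of every champion, as the evaluation in `smallTrees`
-- confirms.
depth : ℕ
depth = 6

recognises : Maybe RT → RT → Bool
recognises nothing  t' = true
recognises (just t) t' = is-just (search t' (presentations t depth))

smallTree : RT → Bool
smallTree t = (φ t ≤ᵇ best (size t)) ∧ ((φ t <ᵇ best (size t)) ∨ recognises (champion (size t)) t)

smallTrees : ∀ t → size t ≤ 10 → T (smallTree t)
smallTrees = ≤10-by-cases smallTree _

split-facts : ∀ m n r → T ((m ≤ᵇ n) ∧ ((m <ᵇ n) ∨ r)) → m ≤ n × (m < n ⊎ T r)
split-facts m n r h with ∧⁻ {m ≤ᵇ n} h
... | h₁ , h₂ with Equivalence.to (T-∨ {m <ᵇ n}) h₂
...   | inj₁ lt = ≤ᵇ⇒≤ m n h₁ , inj₁ (<ᵇ⇒< m n lt)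
...   | inj₂ hr = ≤ᵇ⇒≤ m n h₁ , inj₂ hr

small-facts : ∀ t → size t ≤ 10 → φ t ≤ best (size t) × (φ t < best (size t) ⊎ T (recognises (champion (size t)) t))
small-facts t h = split-facts (φ t) (best (size t)) (recognises (champion (size t)) t) (smallTrees t h)

recognised : ∀ t t' k → T (is-just (search t' (presentations t k))) → t' ≈ t
recognised t t' k h = found (search t' (presentations t k)) h
  where
  found : (m : Maybe (t ≈ t')) → T (is-just m) → t' ≈ t
  found (just i) _ = ≃-sym i

recognises⇒≈ : ∀ c t τ → c ≡ just τ → T (recognises c t) → t ≈ τ
recognises⇒≈ (just τ) t τ refl h = recognised τ t depth h

small-champion : ∀ t τ → size t ≤ 10 → champion (size t) ≡ just τ → φ t < best (size t) ⊎ t ≈ τ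
small-champion t τ h eq = map₂ (recognises⇒≈ (champion (size t)) t τ eq) (proj₂ (small-facts t h))


-- Comparison of the bounds for trees with t(n)

Below : ℕ → ℕ → Set
Below m n = (3 * m ∸ (n ∸ 1)) ^ 3 < 3 ^ (n + 2)

-- A rational `b/a` below the cube root of `3^j` replaces that root: `y` is at most `(b/a) * 3^q`,
-- hence below `3^(q + j/3)`.
cube-< : ∀ a b j q y → a ^ 3 * 3 ^ j > b ^ 3 → a * y ≤ b * 3 ^ q → y ^ 3 < 3 ^ (q * 3 + j)
cube-< a b j q y lt h = *-cancelˡ-< (a ^ 3) _ _ (begin-strict
  a ^ 3 * y ^ 3              ≡⟨ sym (cubes a y) ⟩
  (a * y) ^ 3                ≤⟨ ^-monoˡ-≤ 3 h ⟩
  (b * 3 ^ q) ^ 3            ≡⟨ cubes b (3 ^ q) ⟩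
  b ^ 3 * (3 ^ q) ^ 3        <⟨ *-monoˡ-< ((3 ^ q) ^ 3) {{m^n≢0 (3 ^ q) 3 {{m^n≢0 3 q}}}} lt ⟩
  a ^ 3 * 3 ^ j * (3 ^ q) ^ 3 ≡⟨ *-assoc (a ^ 3) (3 ^ j) _ ⟩
  a ^ 3 * (3 ^ j * (3 ^ q) ^ 3) ≡⟨ cong (a ^ 3 *_) (trans (*-comm (3 ^ j) _) (trans (cong (_* 3 ^ j) (^-*-assoc 3 q 3)) (sym (^-distribˡ-+-* 3 (q * 3) j)))) ⟩
  a ^ 3 * 3 ^ (q * 3 + j)    ∎)
  where
  open ≤-Reasoning
  cubes : ∀ m n → (m * n) ^ 3 ≡ m ^ 3 * n ^ 3
  cubes = lemma
    where
    lemma : ∀ m n → m * n * (m * n * (m * n * 1)) ≡ m * (m * (m * 1)) * (n * (n * (n * 1)))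
    lemma = solve-∀

scaled-∸ : ∀ a m k n → a * m ≤ a * k + n → a * (m ∸ k) ≤ n
scaled-∸ a m k n h = ≤-trans (≤-reflexive (*-distribˡ-∸ a m k)) (m≤n+o⇒m∸n≤o (a * m) (a * k) h)

large-below : ∀ q r m → r < 3 → base r ≤ q → 60 * m + slack (q * 3 + r) ≤ cap (suc (q * 3 + r)) → Below m (suc (q * 3 + r))
large-below q r m r<3 b≤q h = go r r<3 b≤q (subst₂ _≤_ (cong (60 * m +_) (slack≡ q r)) (cap≡eval q r) h)
  where
  open ≤-Reasoning
  X = 3 ^ q
  bigX : ∀ {k} → k ≤ q → 3 ^ k ≤ X
  bigX = ^-monoʳ-≤ 3
  shift : ∀ r → suc (q * 3 + r) + 2 ≡ q * 3 + (3 + r)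
  shift r = lemma (q * 3) r
    where
    lemma : ∀ k r → suc (k + r) + 2 ≡ k + (3 + r)
    lemma = solve-∀
  go : ∀ r → r < 3 → base r ≤ q → 60 * m + slack r ≤ eval (capForm r) q → Below m (suc (q * 3 + r))
  -- Here the cap is exactly sixty times `t(n)`, and strictness comes from the slack.
  go 0 _ b h = subst (λ e → (3 * m ∸ (q * 3 + 0)) ^ 3 < e) (trans (^-*-assoc 3 (suc q) 3) (cong (3 ^_) (lemma₂ (q * 3))))
    (^-monoˡ-< 3 (m<n+o⇒m∸n<o (3 * m) (q * 3 + 0) {{m^n≢0 3 (suc q)}} (begin-strict
      3 * m                  <⟨ m<m+n (3 * m) {3} (s≤s z≤n) ⟩
      3 * m + 3              ≤⟨ *-cancelˡ-≤ 20 (≤-trans (≤-reflexive (lemma₃ m)) (≤-trans h (≤-reflexive (lemma₄ X q)))) ⟩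
      q * 3 + 0 + 3 * X      ∎)))
    where
    lemma₂ : ∀ k → 3 + k ≡ suc (k + 0) + 2
    lemma₂ = solve-∀
    lemma₃ : ∀ m → 20 * (3 * m + 3) ≡ 60 * m + 60
    lemma₃ = solve-∀
    lemma₄ : ∀ x q → 60 * x + 60 * q + 0 ≡ 20 * (q * 3 + 0 + 3 * x)
    lemma₄ = solve-∀
  -- `108/25 = 4.32` is just below `3^(4/3)`. The cap contributes `3 * 85/60 = 4.25`, and the
  -- difference pays for the excess constant as soon as `q ≥ 3`.
  go 1 _ b h = subst (λ e → (3 * m ∸ (q * 3 + 1)) ^ 3 < 3 ^ e) (sym (shift 1))
    (cube-< 25 108 4 q (3 * m ∸ (q * 3 + 1)) (<ᵇ⇒< (108 ^ 3) _ _) (scaled-∸ 25 (3 * m) (q * 3 + 1) (108 * X) (*-cancelˡ-≤ 4 (begin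
      4 * (25 * (3 * m))                   ≡⟨ lemma₁ m ⟩
      5 * (60 * m + 0)                     ≤⟨ *-monoʳ-≤ 5 h ⟩
      5 * (85 * X + 60 * q + 45)           ≡⟨ lemma₂ X q ⟩
      425 * X + 300 * q + 100 + 125        ≤⟨ +-monoʳ-≤ (425 * X + 300 * q + 100) (≤-trans (≤ᵇ⇒≤ 125 (7 * 27) _) (*-monoʳ-≤ 7 (bigX b))) ⟩
      425 * X + 300 * q + 100 + 7 * X      ≡⟨ lemma₃ X q ⟩
      4 * (25 * (q * 3 + 1) + 108 * X)     ∎))))
    where
    lemma₁ : ∀ m → 4 * (25 * (3 * m)) ≡ 5 * (60 * m + 0)
    lemma₁ = solve-∀
    lemma₂ : ∀ x q → 5 * (85 * x + 60 * q + 45) ≡ 425 * x + 300 * q + 100 + 125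
    lemma₂ = solve-∀
    lemma₃ : ∀ x q → 425 * x + 300 * q + 100 + 7 * x ≡ 4 * (25 * (q * 3 + 1) + 108 * x)
    lemma₃ = solve-∀
  -- Likewise `31/5 = 6.2` is just below `3^(5/3)`, and `3 * 123/60` is `6.15`.
  go 2 _ b h = subst (λ e → (3 * m ∸ (q * 3 + 2)) ^ 3 < 3 ^ e) (sym (shift 2))
    (cube-< 5 31 5 q (3 * m ∸ (q * 3 + 2)) (<ᵇ⇒< (31 ^ 3) _ _) (scaled-∸ 5 (3 * m) (q * 3 + 2) (31 * X) (*-cancelˡ-≤ 4 (begin
      4 * (5 * (3 * m))                    ≡⟨ lemma₁ m ⟩
      60 * m + 0                           ≤⟨ h ⟩
      123 * X + 60 * q + 42                ≡⟨ lemma₂ X q ⟩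
      123 * X + 60 * q + 40 + 2            ≤⟨ +-monoʳ-≤ (123 * X + 60 * q + 40) (≤-trans (≤ᵇ⇒≤ 2 27 _) (bigX b)) ⟩
      123 * X + 60 * q + 40 + X            ≡⟨ lemma₃ X q ⟩
      4 * (5 * (q * 3 + 2) + 31 * X)       ∎))))
    where
    lemma₁ : ∀ m → 4 * (5 * (3 * m)) ≡ 60 * m + 0
    lemma₁ = solve-∀
    lemma₂ : ∀ x q → 123 * x + 60 * q + 42 ≡ 123 * x + 60 * q + 40 + 2
    lemma₂ = solve-∀
    lemma₃ : ∀ x q → 123 * x + 60 * q + 40 + x ≡ 4 * (5 * (q * 3 + 2) + 31 * x)
    lemma₃ = solve-∀
  go (suc (suc (suc _))) (s≤s (s≤s (s≤s ()))) b h

below-mono : ∀ {m k} n → m ≤ k → Below k n → Below m n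
below-mono n h b = ≤-<-trans (^-monoˡ-≤ 3 (∸-monoˡ-≤ (n ∸ 1) (*-monoʳ-≤ 3 h))) b

IsSpider : RT → Set
IsSpider t = ∃ λ k → size t ≡ k * 3 + 1 × t ≈ spider k

small-below : ∀ t n → size t ≡ n → 4 ≤ n → n ≤ 10 → Below (φ t) n ⊎ IsSpider t
small-below t n eq 4≤n n≤10 = go n eq 4≤n n≤10
  where
  fits : size t ≤ 10
  fits = ≤-trans (≤-reflexive eq) n≤10
  bounded : ∀ n → size t ≡ n → φ t ≤ best n
  bounded n eq = subst (λ k → φ t ≤ best k) eq (proj₁ (small-facts t fits))
  check : ∀ n → size t ≡ n → T ((3 * best n ∸ (n ∸ 1)) ^ 3 <ᵇ 3 ^ (n + 2)) → Below (φ t) n ⊎ IsSpider t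
  check n eq h = inj₁ (below-mono n (bounded n eq) (<ᵇ⇒< ((3 * best n ∸ (n ∸ 1)) ^ 3) (3 ^ (n + 2)) h))
  extremal : ∀ k n → size t ≡ n → n ≡ k * 3 + 1 → champion n ≡ just (spider k) →
    T ((3 * pred (best n) ∸ (n ∸ 1)) ^ 3 <ᵇ 3 ^ (n + 2)) → Below (φ t) n ⊎ IsSpider t
  extremal k n eq n≡ ch h = case (small-champion t (spider k) fits (trans (cong champion eq) ch))
    where
    case : φ t < best (size t) ⊎ t ≈ spider k → _
    case (inj₂ i)  = inj₂ (k , trans eq n≡ , i)
    case (inj₁ lt) = inj₁ (below-mono n (<⇒≤pred (subst (λ m → φ t < best m) eq lt)) (<ᵇ⇒< ((3 * pred (best n) ∸ (n ∸ 1)) ^ 3) (3 ^ (n + 2)) h))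
  go : ∀ n → size t ≡ n → 4 ≤ n → n ≤ 10 → Below (φ t) n ⊎ IsSpider t
  go 4 eq _ _ = extremal 1 4 eq refl refl _
  go 5 eq _ _ = check 5 eq _
  go 6 eq _ _ = check 6 eq _
  go 7 eq _ _ = extremal 2 7 eq refl refl _
  go 8 eq _ _ = check 8 eq _
  go 9 eq _ _ = check 9 eq _
  go 10 eq _ _ = extremal 3 10 eq refl refl _
  go 0 eq () _
  go 1 eq (s≤s ()) _
  go 2 eq (s≤s (s≤s ())) _
  go 3 eq (s≤s (s≤s (s≤s ()))) _
  go (suc (suc (suc (suc (suc (suc (suc (suc (suc (suc (suc n))))))))))) eq _ h = ⊥-elim (<⇒≱ (s≤s (s≤s (s≤s (s≤s (s≤s (s≤s (s≤s (s≤s (s≤s (s≤s (s≤s z≤n))))))))))) h)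

residue<3 : ∀ {r} → r ∈ (0 ∷ 1 ∷ 2 ∷ []) → r < 3
residue<3 (here refl) = s≤s z≤n
residue<3 (there (here refl)) = s≤s (s≤s z≤n)
residue<3 (there (there (here refl))) = s≤s (s≤s (s≤s z≤n))

tree-bound : ∀ t → 4 ≤ size t → Below (φ t) (size t) ⊎ IsSpider t
tree-bound t 4≤ with size t ≤? 10
... | yes small = small-below t (size t) refl 4≤ small
... | no ¬small = go (large-good t (≰⇒> ¬small))
  where
  L = large-order (size t) (≰⇒> ¬small)
  go : Good t → Below (φ t) (size t) ⊎ IsSpider t
  go (inj₂ sp) = inj₂ sp
  go (inj₁ (capped h)) = inj₁ (subst (Below (φ t)) (sym (m≡ L))
    (large-below (q L) (r L) (φ t) (residue<3 (r∈ L)) (b≤q L) (subst (λ n → 60 * φ t + slack (n ∸ 1) ≤ cap n) (m≡ L) h)))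

-- The graphs of the statement

same-adj? : ∀ {n} (G H : Graph n) (f : Fin n → Fin n) → Dec (∀ u v → adj G u v ≡ adj H (f u) (f v))
same-adj? G H f = all? λ u → all? λ v → adj G u v B.≟ adj H (f u) (f v)

P₃≃ : ⟦ P₃ ⟧ ≃ gr cherry
P₃≃ = ≃-trans (iso ↔-refl (from-yes (same-adj? P₃ (toGraph path₃) id))) (≃-trans (toGraph≃ path₃) (flip-≈ leaf path₂))

K₁₃≃ : ⟦ K₁ 3 ⟧ ≃ gr (spider 1)
K₁₃≃ = ≃-trans (iso ↔-refl (from-yes (same-adj? (K₁ 3) (toGraph (cherry ▷ leaf)) id)))
               (≃-trans (toGraph≃ (cherry ▷ leaf)) (flip-≈ cherry leaf))

K₁₄≃ : ⟦ K₁ 4 ⟧ ≃ gr quad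
K₁₄≃ = ≃-trans (iso ↔-refl (from-yes (same-adj? (K₁ 4) (toGraph quad) id))) (toGraph≃ quad)

T*₈≃ : ⟦ T*₈ ⟧ ≃ gr dumbbell
T*₈≃ = ≃-trans (iso (mk↔ₛ′ to from to-from from-to) (from-yes (same-adj? T*₈ (toGraph (cherry ▷ broom)) to)))
  (≃-trans (toGraph≃ (cherry ▷ broom)) (≃-trans (flip-≈ cherry broom) (plain (link-swap point (gr claw) (gr cherry)))))
  where
  -- In `cherry ▷ broom` the vertices 0, 3, 4, 5 are the path between the two centres, so leaf 7 of
  -- `T*₈` becomes 4 and the second centre becomes 5.
  to from : Fin 8 → Fin 8
  to 4F = 5F
  to 5F = 6F
  to 6F = 7F
  to 7F = 4F
  to i  = i
  from 4F = 7F
  from 5F = 4F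
  from 6F = 5F
  from 7F = 6F
  from i  = i
  to-from : ∀ i → to (from i) ≡ i
  to-from 0F = refl
  to-from 1F = refl
  to-from 2F = refl
  to-from 3F = refl
  to-from 4F = refl
  to-from 5F = refl
  to-from 6F = refl
  to-from 7F = refl
  from-to : ∀ i → from (to i) ≡ i
  from-to 0F = refl
  from-to 1F = refl
  from-to 2F = refl
  from-to 3F = refl
  from-to 4F = refl
  from-to 5F = refl
  from-to 6F = refl
  from-to 7F = refl

⊕≃ : ∀ {m n} (G : Graph m) (H : Graph n) → ⟦ G ⊕ H ⟧ ≃ ⟦ G ⟧ ⊎ᵍ ⟦ H ⟧
⊕≃ {m} G H = iso +↔⊎ e
  where
  e : ∀ u v → adj (G ⊕ H) u v ≡ edge (⟦ G ⟧ ⊎ᵍ ⟦ H ⟧) (splitAt m u) (splitAt m v)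
  e u v with splitAt m u | splitAt m v
  ... | inj₁ _ | inj₁ _ = refl
  ... | inj₂ _ | inj₂ _ = refl
  ... | inj₁ _ | inj₂ _ = refl
  ... | inj₂ _ | inj₁ _ = refl

copies≃ : ∀ {n} {G : Graph n} {t} k → ⟦ G ⟧ ≃ gr t → ⟦ copies k G ⟧ ≃ forest (replicate k t)
copies≃ zero    i = iso (mk↔ₛ′ (λ ()) (λ ()) (λ ()) (λ ())) λ ()
copies≃ {G = G} (suc k) i = ≃-trans (⊕≃ G (copies k G)) (⊎ᵍ-cong i (copies≃ k i))

marked : ∀ {n} → Graph n → (Fin n → Bool) → MGraph
marked G c = mgraph (Fin _) (adj G) c

isZero : ∀ {n} → Fin (suc n) → Bool
isZero zero    = true
isZero (suc _) = false

apex : ∀ {n} → Graph n → (Fin n → Bool) → MGraph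
apex G c = marked (addApex G c) isZero

centred : marked P₃ P₃centre ≃ᵐ gr cherry
centred = isoᵐ (iso (mk↔ₛ′ to from
    (λ { (inj₁ (inj₁ _)) → refl ; (inj₁ (inj₂ _)) → refl ; (inj₂ _) → refl })
    (λ { 0F → refl ; 1F → refl ; 2F → refl }))
    (λ { 0F 0F → refl ; 0F 1F → refl ; 0F 2F → refl ; 1F 0F → refl ; 1F 1F → refl ; 1F 2F → refl ; 2F 0F → refl ; 2F 1F → refl ; 2F 2F → refl }))
  λ { 0F → refl ; 1F → refl ; 2F → refl }
  where
  to : Fin 3 → V (gr cherry)
  to 0F = inj₁ (inj₂ tt)
  to 1F = inj₁ (inj₁ tt)
  to 2F = inj₂ tt
  from : V (gr cherry) → Fin 3
  from (inj₁ (inj₁ _)) = 1F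
  from (inj₁ (inj₂ _)) = 0F
  from (inj₂ _)        = 2F

-- Takes the first copy of `P₃` out of the disjoint union and hangs it below the apex; as `P₃centre`
-- marks its middle vertex, the edge supplied by `link` is the one that `addApex` prescribes.
apex-copies : ∀ k → apex (P₃ ⊕ copies k P₃) (copiesMark (suc k) P₃centre)
                  ≃ᵐ link (apex (copies k P₃) (copiesMark k P₃centre)) (marked P₃ P₃centre)
apex-copies k = isoᵐ (iso (mk↔ₛ′ to from to-from from-to) e) m
  where
  A = apex (P₃ ⊕ copies k P₃) (copiesMark (suc k) P₃centre)
  B' = link (apex (copies k P₃) (copiesMark k P₃centre)) (marked P₃ P₃centre)
  place : Fin 3 ⊎ Fin (k * 3) → Fin (suc (k * 3)) ⊎ Fin 3
  place (inj₁ i) = inj₂ i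
  place (inj₂ j) = inj₁ (suc j)
  to : Fin (suc (3 + k * 3)) → Fin (suc (k * 3)) ⊎ Fin 3
  to zero    = inj₁ zero
  to (suc v) = place (splitAt 3 v)
  from : Fin (suc (k * 3)) ⊎ Fin 3 → Fin (suc (3 + k * 3))
  from (inj₁ zero)    = zero
  from (inj₁ (suc j)) = suc (join 3 (k * 3) (inj₂ j))
  from (inj₂ i)       = suc (join 3 (k * 3) (inj₁ i))
  to-from : ∀ z → to (from z) ≡ z
  to-from (inj₁ zero)    = refl
  to-from (inj₁ (suc j)) = cong place (splitAt-join 3 (k * 3) (inj₂ j))
  to-from (inj₂ i)       = cong place (splitAt-join 3 (k * 3) (inj₁ i))
  from-place : ∀ z → from (place z) ≡ suc (join 3 (k * 3) z)
  from-place (inj₁ i) = refl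
  from-place (inj₂ j) = refl
  from-to : ∀ v → from (to v) ≡ v
  from-to zero    = refl
  from-to (suc v) = trans (from-place (splitAt 3 v)) (cong suc (join-splitAt 3 (k * 3) v))
  m : ∀ v → mark A v ≡ mark B' (to v)
  m zero = refl
  m (suc v) with splitAt 3 v
  ... | inj₁ _ = refl
  ... | inj₂ _ = refl
  e : ∀ u v → edge A u v ≡ edge B' (to u) (to v)
  e zero zero = refl
  e zero (suc v) with splitAt 3 v
  ... | inj₁ _ = refl
  ... | inj₂ _ = refl
  e (suc u) zero with splitAt 3 u
  ... | inj₁ i with P₃centre i
  ...   | true  = refl
  ...   | false = refl
  e (suc u) zero | inj₂ _ = refl
  e (suc u) (suc v) with splitAt 3 u | splitAt 3 v
  ... | inj₁ _ | inj₁ _ = refl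
  ... | inj₂ _ | inj₂ _ = refl
  ... | inj₁ i | inj₂ _ with P₃centre i
  ...   | true  = refl
  ...   | false = refl
  e (suc u) (suc v) | inj₂ _ | inj₁ _ = refl

replicate-∷ʳ : ∀ {A : Set} k (a : A) → replicate (suc k) a ≡ replicate k a ∷ʳ a
replicate-∷ʳ zero    a = refl
replicate-∷ʳ (suc k) a = cong (a ∷_) (replicate-∷ʳ k a)

spider≃ᵐ : ∀ k → apex (copies k P₃) (copiesMark k P₃centre) ≃ᵐ gr (spider k)
spider≃ᵐ zero = isoᵐ (iso (mk↔ₛ′ (λ _ → tt) (λ _ → zero) (λ _ → refl) (λ { zero → refl })) (λ { zero zero → refl })) λ { zero → refl }
spider≃ᵐ (suc k) = ≃ᵐ-trans (apex-copies k) (subst (λ t → link (apex (copies k P₃) (copiesMark k P₃centre)) (marked P₃ P₃centre) ≃ᵐ gr t)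
  (trans (sym (attach-∷ʳ leaf (replicate k cherry) cherry)) (cong (attach leaf) (sym (replicate-∷ʳ k cherry))))
  (link-cong (spider≃ᵐ k) centred))

unmark : ∀ {n} {G : Graph n} {c H} → marked G c ≃ H → ⟦ G ⟧ ≃ H
unmark (iso f e) = iso f e

T*≃ : ∀ k → ⟦ T* k ⟧ ≃ gr (spider k)
T*≃ k = unmark {G = T* k} {c = isZero} (plain (spider≃ᵐ k))

-- Forests


-- Sequences that triple when the order grows by 3, like `Φ` when a component `P₃` is added; the
-- arguments are the first three values.
geo : ℕ → ℕ → ℕ → ℕ → ℕ
geo x y z 0 = x
geo x y z 1 = y
geo x y z 2 = z
geo x y z (suc (suc (suc n))) = 3 * geo x y z n

geo-shift : ∀ x y z i r → geo x y z (i * 3 + r) ≡ 3 ^ i * geo x y z r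
geo-shift x y z zero    r = sym (+-identityʳ _)
geo-shift x y z (suc i) r = trans (cong (3 *_) (geo-shift x y z i r)) (sym (*-assoc 3 (3 ^ i) _))

-- Nine times the maximum of Φ over the forests of order n, except for n = 1, 2, 5, where it is larger.
ε : ℕ → ℕ
ε = geo 9 12 16

-- 27 φ < ω n makes a tree of order n too poor to be a component of an extremal forest, since
-- ω m ε n ≤ η (m + n) ≤ 243 f₂ (m + n).
ω : ℕ → ℕ
ω = geo 20 33 45

η : ℕ → ℕ
η = geo 180 297 405

-- Both sides triple when either order grows by 3, so the nine pairs of residues suffice; a factor 3
-- in a hypothesis is the carry when the residues add up to 3 or more.
geo-* : ∀ {x y z x' y' z' u v w} →
  x * x' ≤ u → x * y' ≤ v → x * z' ≤ w → y * x' ≤ v → y * y' ≤ w → y * z' ≤ 3 * u → z * x' ≤ w → z * y' ≤ 3 * u → z * z' ≤ 3 * v →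
  ∀ m n → geo x y z m * geo x' y' z' n ≤ geo u v w (m + n)
geo-* {x} {y} {z} {x'} {y'} {z'} {u} {v} {w} h₀₀ h₀₁ h₀₂ h₁₀ h₁₁ h₁₂ h₂₀ h₂₁ h₂₂ = go
  where
  g = geo x y z
  g' = geo x' y' z'
  k = geo u v w
  swap : ∀ a b → a * (3 * b) ≡ 3 * (a * b)
  swap = solve-∀
  triple : ∀ {a b c} → a * b ≤ c → a * (3 * b) ≤ 3 * c
  triple {a} {b} h = ≤-trans (≤-reflexive (swap a b)) (*-monoʳ-≤ 3 h)
  go : ∀ m n → g m * g' n ≤ k (m + n)
  go 0 0 = h₀₀
  go 0 1 = h₀₁
  go 0 2 = h₀₂
  go 0 (suc (suc (suc n))) = triple {x} (go 0 n)
  go 1 0 = h₁₀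
  go 1 1 = h₁₁
  go 1 2 = h₁₂
  go 1 (suc (suc (suc n))) = triple {y} (go 1 n)
  go 2 0 = h₂₀
  go 2 1 = h₂₁
  go 2 2 = h₂₂
  go 2 (suc (suc (suc n))) = triple {z} (go 2 n)
  go (suc (suc (suc m))) n = ≤-trans (≤-reflexive (*-assoc 3 (g m) (g' n))) (*-monoʳ-≤ 3 (go m n))

geo-≤ : ∀ {x y z u v w} → x ≤ u → y ≤ v → z ≤ w → ∀ n → geo x y z n ≤ geo u v w n
geo-≤ a b c 0 = a
geo-≤ a b c 1 = b
geo-≤ a b c 2 = c
geo-≤ a b c (suc (suc (suc n))) = *-monoʳ-≤ 3 (geo-≤ a b c n)

geo-scale : ∀ c x y z n → geo (c * x) (c * y) (c * z) n ≡ c * geo x y z n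
geo-scale c x y z 0 = refl
geo-scale c x y z 1 = refl
geo-scale c x y z 2 = refl
geo-scale c x y z (suc (suc (suc n))) = trans (cong (3 *_) (geo-scale c x y z n)) (lemma c (geo x y z n))
  where
  lemma : ∀ c g → 3 * (c * g) ≡ c * (3 * g)
  lemma = solve-∀

decide : ∀ {m n} → T (m ≤ᵇ n) → m ≤ n
decide {m} {n} = ≤ᵇ⇒≤ m n

ε-* : ∀ m n → ε m * ε n ≤ 9 * ε (m + n)
ε-* m n = ≤-trans (geo-* {u = 81} {108} {144} (decide {81} {81} _) (decide {108} {108} _) (decide {144} {144} _) (decide {108} {108} _) (decide {144} {144} _) (decide {192} {243} _)
  (decide {144} {144} _) (decide {192} {243} _) (decide {256} {324} _) m n) (≤-reflexive (geo-scale 9 9 12 16 (m + n)))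

ωε≤η : ∀ m n → ω m * ε n ≤ η (m + n)
ωε≤η = geo-* (decide {180} {180} _) (decide {240} {297} _) (decide {320} {405} _) (decide {297} {297} _) (decide {396} {405} _) (decide {528} {540} _)
  (decide {405} {405} _) (decide {540} {540} _) (decide {720} {891} _)

ω≤3ε : ∀ n → ω n ≤ 3 * ε n
ω≤3ε n = ≤-trans (geo-≤ {20} {33} {45} {27} {36} {48} (decide {20} {27} _) (decide {33} {36} _) (decide {45} {48} _) n) (≤-reflexive (geo-scale 3 9 12 16 n))

ε>0 : ∀ n → 1 ≤ ε n
ε>0 0 = s≤s z≤n
ε>0 1 = s≤s z≤n
ε>0 2 = s≤s z≤n
ε>0 (suc (suc (suc n))) = ≤-trans (ε>0 n) (m≤m+n _ _)

data Kind (t : RT) : Set where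
  isP₃       : t ≈ cherry → Kind t
  isK₁₃      : t ≈ spider 1 → Kind t
  isK₁₄      : t ≈ quad → Kind t
  isT₇       : t ≈ spider 2 → Kind t
  isT₈       : t ≈ dumbbell → Kind t
  light      : 27 * φ t < ω (size t) → Kind t

kind : ∀ t → Kind t
kind t with size t ≤? 10
... | no ¬small = light (subst (λ n → 27 * φ t < ω n) (sym (m≡ L)) (*-cancelˡ-< 60 _ _ (begin-strict
    60 * (27 * φ t)                        ≡⟨ lemma (φ t) ⟩
    27 * (60 * φ t)                        ≤⟨ *-monoʳ-≤ 27 (≤-trans (good⇒capped t (large-good t big)) (≤-reflexive (trans (cong cap (m≡ L)) (cap≡eval (q L) (r L))))) ⟩
    27 * eval (capForm (r L)) (q L)        ≡⟨ sym (eval-* 27 (capForm (r L)) (q L)) ⟩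
    -- The added 60 provides the strict inequality and still fits below the form for `ω`.
    eval (27 *ᶠ capForm (r L)) (q L)       <⟨ m<m+n _ (s≤s z≤n) ⟩
    eval (27 *ᶠ capForm (r L)) (q L) + 60  ≡⟨ sym (eval-+ (27 *ᶠ capForm (r L)) (form 0 0 60) (q L)) ⟩
    eval ((27 *ᶠ capForm (r L)) +ᶠ form 0 0 60) (q L)
      ≤⟨ dominates⇒≤ {base (r L)} {(27 *ᶠ capForm (r L)) +ᶠ form 0 0 60} {form (60 * ω (suc (r L))) 0 0} (All.lookup (all⁺ poor (0 ∷ 1 ∷ 2 ∷ []) _) (r∈ L)) (b≤q L) ⟩
    eval (form (60 * ω (suc (r L))) 0 0) (q L) ≡⟨ lemma' (ω (suc (r L))) (3 ^ q L) (q L) ⟩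
    60 * (3 ^ q L * ω (suc (r L)))         ≡⟨ cong (60 *_) (sym (trans (cong ω (sym (+-suc (q L * 3) (r L)))) (geo-shift 20 33 45 (q L) (suc (r L))))) ⟩
    60 * ω (suc (q L * 3 + r L))           ∎)))
  where
  open ≤-Reasoning
  big = ≰⇒> ¬small
  L = large-order (size t) big
  poor : ℕ → Bool
  poor r = dominates (base r) ((27 *ᶠ capForm r) +ᶠ form 0 0 60) (form (60 * ω (suc r)) 0 0)
  lemma : ∀ f → 60 * (27 * f) ≡ 27 * (60 * f)
  lemma = solve-∀
  lemma' : ∀ o x q → 60 * o * x + 0 * q + 0 ≡ 60 * (x * o)
  lemma' = solve-∀
... | yes small = go (size t) refl
  where
  poor : ∀ {b} n → size t ≡ n → φ t ≤ b → 27 * b < ω n → Kind t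
  poor n eq h lt = light (subst (λ n → 27 * φ t < ω n) (sym eq) (≤-<-trans (*-monoʳ-≤ 27 h) lt))
  max : ∀ n → size t ≡ n → T (27 * best n <ᵇ ω n) → Kind t
  max n eq lt = poor n eq (subst (λ n → φ t ≤ best n) eq (proj₁ (small-facts t small))) (<ᵇ⇒< _ _ lt)
  champ : ∀ n τ → size t ≡ n → champion n ≡ just τ → (t ≈ τ → Kind t) → T (27 * pred (best n) <ᵇ ω n) → Kind t
  champ n τ eq c f lt = pick (small-champion t τ small (trans (cong champion eq) c))
    where
    pick : φ t < best (size t) ⊎ t ≈ τ → Kind t
    pick (inj₂ i) = f i
    pick (inj₁ h) = poor n eq (<⇒≤pred (subst (λ n → φ t < best n) eq h)) (<ᵇ⇒< _ _ lt)
  go : ∀ n → size t ≡ n → Kind t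
  go 0 eq = ⊥-elim (<⇒≱ (size>0 t) (≤-reflexive eq))
  go 1 eq = max 1 eq _
  go 2 eq = max 2 eq _
  go 3 eq = champ 3 cherry eq refl isP₃ _
  go 4 eq = champ 4 (spider 1) eq refl isK₁₃ _
  go 5 eq = champ 5 quad eq refl isK₁₄ _
  go 6 eq = max 6 eq _
  go 7 eq = champ 7 (spider 2) eq refl isT₇ _
  go 8 eq = champ 8 dumbbell eq refl isT₈ _
  go 9 eq = max 9 eq _
  go 10 eq = max 10 eq _
  go (suc (suc (suc (suc (suc (suc (suc (suc (suc (suc (suc n))))))))))) eq =
    ⊥-elim (<⇒≱ (s≤s (s≤s (s≤s (s≤s (s≤s (s≤s (s≤s (s≤s (s≤s (s≤s (s≤s z≤n))))))))))) (≤-trans (≤-reflexive (sym eq)) small))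

invariants : ∀ {t τ} → t ≈ τ → φ t ≡ φ τ × size t ≡ size τ
invariants {t} {τ} i = φ-≃ {t} {τ} i , size-≃ {t} {τ} i

tree≤ε : ∀ t → 9 * φ t ≤ ε (size t)
tree≤ε t = go (kind t)
  where
  at : ∀ {τ} → t ≈ τ → T (9 * φ τ ≤ᵇ ε (size τ)) → 9 * φ t ≤ ε (size t)
  at {τ} i h = subst₂ (λ f n → 9 * f ≤ ε n) (sym (proj₁ (invariants {t} {τ} i))) (sym (proj₂ (invariants {t} {τ} i))) (≤ᵇ⇒≤ _ _ h)
  go : Kind t → 9 * φ t ≤ ε (size t)
  go (isP₃ i)  = at {cherry} i _
  go (isK₁₃ i) = at {spider 1} i _
  go (isK₁₄ i) = at {quad} i _
  go (isT₇ i)  = at {spider 2} i _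
  go (isT₈ i)  = at {dumbbell} i _
  go (light h) = *-cancelˡ-≤ 3 (≤-trans (≤-reflexive (lemma (φ t))) (≤-trans (<⇒≤ h) (ω≤3ε (size t))))
    where
    lemma : ∀ f → 3 * (9 * f) ≡ 27 * f
    lemma = solve-∀

forest≤ε : ∀ ts → 9 * ∏φ ts ≤ ε (sizes ts)
forest≤ε []       = ≤-refl
forest≤ε (t ∷ ts) = *-cancelˡ-≤ 9 (begin
  9 * (9 * (φ t * ∏φ ts))      ≡⟨ lemma (φ t) (∏φ ts) ⟩
  (9 * φ t) * (9 * ∏φ ts)      ≤⟨ *-mono-≤ (tree≤ε t) (forest≤ε ts) ⟩
  ε (size t) * ε (sizes ts)    ≤⟨ ε-* (size t) (sizes ts) ⟩
  9 * ε (size t + sizes ts)    ∎)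
  where
  open ≤-Reasoning
  lemma : ∀ f g → 9 * (9 * (f * g)) ≡ (9 * f) * (9 * g)
  lemma = solve-∀

light-forest : ∀ t ts → 27 * φ t < ω (size t) → 243 * ∏φ (t ∷ ts) < η (sizes (t ∷ ts))
light-forest t ts h = begin-strict
  243 * (φ t * ∏φ ts)           ≡⟨ lemma (φ t) (∏φ ts) ⟩
  27 * φ t * (9 * ∏φ ts)        ≤⟨ *-monoʳ-≤ (27 * φ t) (forest≤ε ts) ⟩
  27 * φ t * ε (sizes ts)       <⟨ *-monoˡ-< (ε (sizes ts)) {{>-nonZero (ε>0 (sizes ts))}} h ⟩
  ω (size t) * ε (sizes ts)     ≤⟨ ωε≤η (size t) (sizes ts) ⟩
  η (size t + sizes ts)         ∎
  where
  open ≤-Reasoning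
  lemma : ∀ f g → 243 * (f * g) ≡ 27 * f * (9 * g)
  lemma = solve-∀

∏φ-↭ : ∀ {ts ts'} → ts ↭ ts' → ∏φ ts ≡ ∏φ ts'
∏φ-↭ ↭.refl = refl
∏φ-↭ (↭.prep t p) = cong (φ t *_) (∏φ-↭ p)
∏φ-↭ {_ ∷ _ ∷ ts} {_ ∷ _ ∷ ts'} (↭.swap t t' p) = trans (cong (λ k → φ t * (φ t' * k)) (∏φ-↭ p)) (lemma (φ t) (φ t') (∏φ ts'))
  where
  lemma : ∀ a b c → a * (b * c) ≡ b * (a * c)
  lemma = solve-∀
∏φ-↭ (↭.trans p p') = trans (∏φ-↭ p) (∏φ-↭ p')

sizes-↭ : ∀ {ts ts'} → ts ↭ ts' → sizes ts ≡ sizes ts'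
sizes-↭ ↭.refl = refl
sizes-↭ (↭.prep t p) = cong (size t +_) (sizes-↭ p)
sizes-↭ {_ ∷ _ ∷ ts} {_ ∷ _ ∷ ts'} (↭.swap t t' p) = trans (cong (λ k → size t + (size t' + k)) (sizes-↭ p)) (lemma (size t) (size t') (sizes ts'))
  where
  lemma : ∀ a b c → a + (b + c) ≡ b + (a + c)
  lemma = solve-∀
sizes-↭ (↭.trans p p') = trans (sizes-↭ p) (sizes-↭ p')

mod-3 : ∀ a k → (a + k * 3) % 3 ≡ a % 3
mod-3 a k = [m+kn]%n≡m%n a k 3

f₁-7 : ∀ k → f₁ (k * 3 + 7) ≡ 12 * 3 ^ k
f₁-7 k = trans (cong f₁ (+-comm (k * 3) 7)) (go k)
  where
  go : ∀ k → f₁ (7 + k * 3) ≡ 12 * 3 ^ k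
  go k rewrite mod-3 7 k = trans (cong (λ e → 4 * 3 ^ e) (m*n/n≡m (suc k) 3)) (lemma (3 ^ k))
    where
    lemma : ∀ x → 4 * (3 * x) ≡ 12 * x
    lemma = solve-∀

f₁-8 : ∀ k → f₁ (k * 3 + 8) ≡ 16 * 3 ^ k
f₁-8 k = trans (cong f₁ (+-comm (k * 3) 8)) (go k)
  where
  go : ∀ k → f₁ (8 + k * 3) ≡ 16 * 3 ^ k
  go k rewrite mod-3 8 k = cong (λ e → 16 * 3 ^ e) (m*n/n≡m k 3)

f₁-9 : ∀ k → f₁ (k * 3 + 9) ≡ 27 * 3 ^ k
f₁-9 k = trans (cong f₁ (+-comm (k * 3) 9)) (go k)
  where
  go : ∀ k → f₁ (9 + k * 3) ≡ 27 * 3 ^ k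
  go k rewrite mod-3 9 k = trans (cong (3 ^_) (m*n/n≡m (3 + k) 3)) (lemma (3 ^ k))
    where
    lemma : ∀ x → 3 * (3 * (3 * x)) ≡ 27 * x
    lemma = solve-∀

f₂-7 : ∀ k → f₂ (k * 3 + 7) ≡ 11 * 3 ^ k
f₂-7 k = trans (cong f₂ (+-comm (k * 3) 7)) (go k)
  where
  go : ∀ k → f₂ (7 + k * 3) ≡ 11 * 3 ^ k
  go zero = refl
  go (suc k) rewrite mod-3 10 k = cong (λ e → 11 * 3 ^ e) (m*n/n≡m (suc k) 3)

f₂-8 : ∀ k → f₂ (k * 3 + 8) ≡ 15 * 3 ^ k
f₂-8 k = trans (cong f₂ (+-comm (k * 3) 8)) (go k)
  where
  go : ∀ k → f₂ (8 + k * 3) ≡ 15 * 3 ^ k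
  go zero = refl
  go (suc k) rewrite mod-3 11 k = cong (λ e → 15 * 3 ^ e) (m*n/n≡m (suc k) 3)

f₂-12 : ∀ k → f₂ (k * 3 + 12) ≡ 64 * 3 ^ k
f₂-12 k = trans (cong f₂ (+-comm (k * 3) 12)) (go k)
  where
  go : ∀ k → f₂ (12 + k * 3) ≡ 64 * 3 ^ k
  go k rewrite mod-3 12 k = cong (λ e → 64 * 3 ^ e) (m*n/n≡m k 3)

record Residue (n : ℕ) : Set where
  constructor res
  field
    quot rem : ℕ
    rem<3    : rem < 3
    division : n ≡ quot * 3 + rem

residue : ∀ n → Residue n
residue 0 = res 0 0 (s≤s z≤n) refl
residue 1 = res 0 1 (s≤s (s≤s z≤n)) refl
residue 2 = res 0 2 (s≤s (s≤s (s≤s z≤n))) refl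
residue (suc (suc (suc n))) with residue n
... | res j r r<3 eq = res (suc j) r r<3 (cong (3 +_) eq)

3≰2 : ∀ {r} → ¬ (3 + r < 3)
3≰2 (s≤s (s≤s (s≤s ())))

ε-at : ∀ j r → ε (j * 3 + r) ≡ 3 ^ j * ε r
ε-at = geo-shift 9 12 16

data Order≥7 : ℕ → Set where
  is7  : ∀ k → Order≥7 (k * 3 + 7)
  is8  : ∀ k → Order≥7 (k * 3 + 8)
  is9  : Order≥7 9
  is12 : ∀ k → Order≥7 (k * 3 + 12)

order≥7 : ∀ n → 7 ≤ n → Order≥7 n
order≥7 n h with m≤n⇒∃[o]m+o≡n h
... | o , refl with residue o
...   | res j 0 _ refl = subst Order≥7 (lemma (j * 3)) (is7 j)
  where
  lemma : ∀ k → k + 7 ≡ 7 + (k + 0)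
  lemma = solve-∀
...   | res j 1 _ refl = subst Order≥7 (lemma (j * 3)) (is8 j)
  where
  lemma : ∀ k → k + 8 ≡ 7 + (k + 1)
  lemma = solve-∀
...   | res zero 2 _ refl = is9
...   | res (suc j) 2 _ refl = subst Order≥7 (lemma (j * 3)) (is12 j)
  where
  lemma : ∀ k → k + 12 ≡ 7 + (3 + k + 2)
  lemma = solve-∀
...   | res j (suc (suc (suc _))) lt _ = ⊥-elim (3≰2 lt)

9f₁≡ε : ∀ n → 7 ≤ n → 9 * f₁ n ≡ ε n
9f₁≡ε n h with order≥7 n h
... | is7 k  = trans (cong (9 *_) (f₁-7 k)) (trans (lemma (3 ^ k)) (sym (ε-at k 7)))
  where
  lemma : ∀ x → 9 * (12 * x) ≡ x * 108
  lemma = solve-∀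
... | is8 k  = trans (cong (9 *_) (f₁-8 k)) (trans (lemma (3 ^ k)) (sym (ε-at k 8)))
  where
  lemma : ∀ x → 9 * (16 * x) ≡ x * 144
  lemma = solve-∀
... | is9    = refl
... | is12 k = trans (cong (λ m → 9 * f₁ m) (shift (k * 3))) (trans (cong (9 *_) (f₁-9 (suc k))) (trans (lemma (3 ^ k)) (sym (ε-at k 12))))
  where
  shift : ∀ k → k + 12 ≡ 3 + k + 9
  shift = solve-∀
  lemma : ∀ x → 9 * (27 * (3 * x)) ≡ x * 729
  lemma = solve-∀

η≤243f₂ : ∀ n → 7 ≤ n → η n ≤ 243 * f₂ n
η≤243f₂ n h with order≥7 n h
... | is7 k  = ≤-reflexive (trans (geo-shift 180 297 405 k 7) (trans (lemma (3 ^ k)) (cong (243 *_) (sym (f₂-7 k)))))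
  where
  lemma : ∀ x → x * 2673 ≡ 243 * (11 * x)
  lemma = solve-∀
... | is8 k  = ≤-reflexive (trans (geo-shift 180 297 405 k 8) (trans (lemma (3 ^ k)) (cong (243 *_) (sym (f₂-8 k)))))
  where
  lemma : ∀ x → x * 3645 ≡ 243 * (15 * x)
  lemma = solve-∀
... | is9    = ≤-refl
... | is12 k = ≤-trans (≤-reflexive (geo-shift 180 297 405 k 12)) (≤-trans (*-monoʳ-≤ (3 ^ k) (decide {14580} {15552} _))
    (≤-reflexive (trans (lemma (3 ^ k)) (cong (243 *_) (sym (f₂-12 k))))))
  where
  lemma : ∀ x → x * 15552 ≡ 243 * (64 * x)
  lemma = solve-∀

pick : ∀ {P Q : RT → Set} → ∀ {ts} → All (λ t → P t ⊎ Q t) ts → All P ts ⊎ ∃₂ λ t rest → ts ↭ t ∷ rest × Q t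
pick [] = inj₁ []
pick {ts = t ∷ ts} (inj₂ q ∷ _) = inj₂ (t , ts , ↭-refl , q)
pick {ts = t ∷ ts} (inj₁ p ∷ hs) with pick hs
... | inj₁ ps = inj₁ (p ∷ ps)
... | inj₂ (t' , rest , h , q) = inj₂ (t' , t ∷ rest , ↭-trans (prep t h) (↭.swap t t' ↭-refl) , q)

data NotP₃ (t : RT) : Set where
  k₁₃ : t ≈ spider 1 → NotP₃ t
  k₁₄ : t ≈ quad → NotP₃ t
  t₇  : t ≈ spider 2 → NotP₃ t
  t₈  : t ≈ dumbbell → NotP₃ t
  poor : 27 * φ t < ω (size t) → NotP₃ t

p₃-or-not : ∀ t → t ≈ cherry ⊎ NotP₃ t
p₃-or-not t with kind t
... | isP₃ i  = inj₁ i
... | isK₁₃ i = inj₂ (k₁₃ i)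
... | isK₁₄ i = inj₂ (k₁₄ i)
... | isT₇ i  = inj₂ (t₇ i)
... | isT₈ i  = inj₂ (t₈ i)
... | light h = inj₂ (poor h)

P₃s : ∀ {ts} → All (_≈ cherry) ts → ∏φ ts ≡ 3 ^ length ts × sizes ts ≡ length ts * 3 × forest ts ≃ forest (replicate (length ts) cherry)
P₃s [] = refl , refl , ≃-refl
P₃s {t ∷ ts} (i ∷ is) with P₃s is
... | a , b , c = cong₂ _*_ (proj₁ (invariants {t} {cherry} i)) a , cong₂ _+_ (proj₂ (invariants {t} {cherry} i)) b , ⊎ᵍ-cong i c

-- A component of order `a` with `p` sets, completed as well as `ε` permits, stays short of copies
-- of `P₃`. Only total orders divisible by 3 are compared.
pays : ℕ → ℕ → ℕ → Bool
pays a p r = not ((a + r) % 3 ≡ᵇ 0) ∨ (p * ε r <ᵇ ε (a + r))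

pays⇒ : ∀ a p → T (pays a p 0 ∧ pays a p 1 ∧ pays a p 2) → ∀ r → r < 3 → (a + r) % 3 ≡ 0 → p * ε r < ε (a + r)
pays⇒ a p h r r<3 e with ∧⁻ {pays a p 0} h
... | h₀ , h' with ∧⁻ {pays a p 1} h'
...   | h₁ , h₂ = go r r<3 e
  where
  use : ∀ r → T (pays a p r) → (a + r) % 3 ≡ 0 → p * ε r < ε (a + r)
  use r h e rewrite e = <ᵇ⇒< _ _ h
  go : ∀ r → r < 3 → (a + r) % 3 ≡ 0 → p * ε r < ε (a + r)
  go 0 _ = use 0 h₀
  go 1 _ = use 1 h₁
  go 2 _ = use 2 h₂
  go (suc (suc (suc r))) lt = ⊥-elim (3≰2 lt)

falls-short : ∀ {a p} → T (pays a p 0 ∧ pays a p 1 ∧ pays a p 2) →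
  ∀ rest i → a + sizes rest ≡ i * 3 → p * ∏φ rest < 3 ^ i
falls-short {a} {p} h rest i order with residue (sizes rest)
... | res j r r<3 r≡ = *-cancelˡ-< 9 _ _ (begin-strict
  9 * (p * ∏φ rest)           ≡⟨ lemma p (∏φ rest) ⟩
  p * (9 * ∏φ rest)           ≤⟨ *-monoʳ-≤ p (forest≤ε rest) ⟩
  p * ε (sizes rest)          ≡⟨ cong (p *_) (trans (cong ε r≡) (ε-at j r)) ⟩
  p * (3 ^ j * ε r)           ≡⟨ lemma' p (3 ^ j) (ε r) ⟩
  3 ^ j * (p * ε r)           <⟨ *-monoʳ-< (3 ^ j) {{m^n≢0 3 j}} (pays⇒ a p h r r<3 rmod) ⟩
  3 ^ j * ε (a + r)           ≡⟨ sym (ε-at j (a + r)) ⟩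
  ε (j * 3 + (a + r))         ≡⟨ cong ε (trans shift (sym (+-identityʳ _))) ⟩
  ε (i * 3 + 0)               ≡⟨ trans (ε-at i 0) (*-comm (3 ^ i) 9) ⟩
  9 * 3 ^ i                   ∎)
  where
  open ≤-Reasoning
  lemma : ∀ a b → 9 * (a * b) ≡ a * (9 * b)
  lemma = solve-∀
  lemma' : ∀ a b c → a * (b * c) ≡ b * (a * c)
  lemma' = solve-∀
  perm : ∀ j a r → j + (a + r) ≡ a + (j + r)
  perm = solve-∀
  shift : j * 3 + (a + r) ≡ i * 3
  shift = trans (perm (j * 3) a r) (trans (cong (a +_) (sym r≡)) order)
  rmod : (a + r) % 3 ≡ 0
  rmod = trans (sym ([m+kn]%n≡m%n (a + r) j 3)) (trans (%-congˡ (trans (+-comm (a + r) (j * 3)) shift)) (m*n%n≡0 i 3))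

-- Identifies the remaining components when equality holds: any component other than `P₃` loses
-- strictly, even against the estimate `ε` for the others.
all-P₃-max : ∀ ts i → sizes ts ≡ i * 3 → ∏φ ts < 3 ^ i ⊎ forest ts ≃ forest (replicate i cherry)
all-P₃-max ts i eq with pick (All.universal p₃-or-not ts)
... | inj₁ ps with P₃s ps
...   | _ , b , c = inj₂ (subst (λ j → forest ts ≃ forest (replicate j cherry)) (*-cancelʳ-≡ _ _ 3 (trans (sym b) eq)) c)
all-P₃-max ts i eq | inj₂ (t , rest , h , q) = inj₁ (subst (_< 3 ^ i) (sym (∏φ-↭ h)) (go q))
  where
  open ≤-Reasoning
  order : size t + sizes rest ≡ i * 3
  order = trans (sym (sizes-↭ h)) eq
  special : ∀ τ → t ≈ τ → T (pays (size τ) (φ τ) 0 ∧ pays (size τ) (φ τ) 1 ∧ pays (size τ) (φ τ) 2) → φ t * ∏φ rest < 3 ^ i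
  special τ e p = subst (λ f → f * ∏φ rest < 3 ^ i) (sym (proj₁ (invariants {t} {τ} e)))
    (falls-short {size τ} {φ τ} p rest i (trans (cong (_+ sizes rest) (sym (proj₂ (invariants {t} {τ} e)))) order))
  go : NotP₃ t → φ t * ∏φ rest < 3 ^ i
  go (k₁₃ e) = special (spider 1) e _
  go (k₁₄ e) = special quad e _
  go (t₇ e)  = special (spider 2) e _
  go (t₈ e)  = special dumbbell e _
  go (poor l) = *-cancelˡ-< 243 _ _ (begin-strict
    243 * (φ t * ∏φ rest)       <⟨ light-forest t rest l ⟩
    η (size t + sizes rest)     ≡⟨ trans (cong η (trans order (sym (+-identityʳ _)))) (geo-shift 180 297 405 i 0) ⟩
    3 ^ i * 180                 ≤⟨ *-monoʳ-≤ (3 ^ i) (decide {180} {243} _) ⟩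
    3 ^ i * 243                 ≡⟨ *-comm (3 ^ i) 243 ⟩
    243 * 3 ^ i                 ∎)

sizes≡0 : ∀ ts → sizes ts ≡ 0 → ts ≡ []
sizes≡0 []       _ = refl
sizes≡0 (t ∷ ts) e = ⊥-elim (<⇒≱ (size>0 t) (≤-trans (m≤m+n (size t) (sizes ts)) (≤-reflexive e)))

-- Serves the sporadic order 9, where `K₁,₄` is completed by an optimal forest of order 4.
order-4-max : ∀ ts → sizes ts ≡ 4 → ∏φ ts < 4 ⊎ forest ts ≃ forest (spider 1 ∷ [])
order-4-max ts eq with pick (All.universal p₃-or-not ts)
... | inj₁ ps = ⊥-elim (absurd (length ts) (trans (sym (proj₁ (proj₂ (P₃s ps)))) eq))
  where
  absurd : ∀ l → l * 3 ≢ 4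
  absurd 0 ()
  absurd 1 ()
  absurd (suc (suc l)) ()
... | inj₂ (t , rest , h , q) = go q
  where
  order : size t + sizes rest ≡ 4
  order = trans (sym (sizes-↭ h)) eq
  tooBig : ∀ τ → t ≈ τ → 5 ≤ size τ → ⊥
  tooBig τ e b = <⇒≱ (≤-trans b (≤-trans (≤-reflexive (sym (proj₂ (invariants {t} {τ} e)))) (m≤m+n _ _))) (≤-reflexive order)
  go : NotP₃ t → ∏φ ts < 4 ⊎ forest ts ≃ forest (spider 1 ∷ [])
  go (k₁₃ e) with refl ← sizes≡0 rest (+-cancelˡ-≡ 4 _ _ (trans (cong (_+ sizes rest) (sym (proj₂ (invariants {t} {spider 1} e)))) order)) =
    inj₂ (≃-trans (forest-↭ h) (⊎ᵍ-cong e ≃-refl))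
  go (k₁₄ e) = ⊥-elim (tooBig quad e (decide {5} {5} _))
  go (t₇ e)  = ⊥-elim (tooBig (spider 2) e (decide {5} {7} _))
  go (t₈ e)  = ⊥-elim (tooBig dumbbell e (decide {5} {8} _))
  go (poor l) = inj₁ (subst (_< 4) (sym (∏φ-↭ h)) (*-cancelˡ-< 243 _ _
    (<-≤-trans (light-forest t rest l) (≤-trans (≤-reflexive (cong η order)) (decide {891} {972} _)))))

Extremalᶠ : ℕ → MGraph → Set
Extremalᶠ n G =
    (∃ λ k → n ≡ k * 3 + 7 × G ≃ forest (spider 2 ∷ replicate k cherry))
  ⊎ (∃ λ k → n ≡ k * 3 + 8 × (G ≃ forest (dumbbell ∷ replicate k cherry) ⊎ G ≃ forest (quad ∷ replicate (suc k) cherry)))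
  ⊎ (n ≡ 9 × G ≃ forest (quad ∷ spider 1 ∷ []))
  ⊎ (∃ λ k → n ≡ k * 3 + 12 × G ≃ forest (spider 1 ∷ spider 1 ∷ spider 1 ∷ replicate k cherry))

Verdict : ℕ → MGraph → ℕ → Set
Verdict n G m = m < f₂ n ⊎ (m ≡ f₂ n × Extremalᶠ n G)

-- With `f₂ n` written as `c * 3^k` and the rest estimated by `ε`, the factor `3^k` cancels and one
-- numerical comparison remains for all `k`.
strict : ∀ {n c} d k p r rest → sizes rest ≡ (d + k) * 3 + r → f₂ n ≡ c * 3 ^ k → T (p * (3 ^ d * ε r) <ᵇ 9 * c) → p * ∏φ rest < f₂ n
strict {n} {c} d k p r rest B≡ f≡ h = *-cancelˡ-< 9 _ _ (begin-strict
  9 * (p * ∏φ rest)                    ≡⟨ lemma₁ p (∏φ rest) ⟩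
  p * (9 * ∏φ rest)                    ≤⟨ *-monoʳ-≤ p (forest≤ε rest) ⟩
  p * ε (sizes rest)                   ≡⟨ cong (p *_) (trans (cong ε B≡) (ε-at (d + k) r)) ⟩
  p * (3 ^ (d + k) * ε r)              ≡⟨ cong (λ x → p * (x * ε r)) (^-distribˡ-+-* 3 d k) ⟩
  p * (3 ^ d * 3 ^ k * ε r)            ≡⟨ lemma₂ p (3 ^ d) (3 ^ k) (ε r) ⟩
  p * (3 ^ d * ε r) * 3 ^ k            <⟨ *-monoˡ-< (3 ^ k) {{m^n≢0 3 k}} (<ᵇ⇒< _ (9 * c) h) ⟩
  9 * c * 3 ^ k                        ≡⟨ trans (*-assoc 9 c (3 ^ k)) (cong (9 *_) (sym f≡)) ⟩
  9 * f₂ n                             ∎)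
  where
  open ≤-Reasoning
  lemma₁ : ∀ a b → 9 * (a * b) ≡ a * (9 * b)
  lemma₁ = solve-∀
  lemma₂ : ∀ p u x e → p * (u * x * e) ≡ p * (u * e) * x
  lemma₂ = solve-∀

-- The completion by copies of `P₃` meets `f₂ n` exactly, so the equality case is that of
-- `all-P₃-max`.
tight : ∀ {n} p {{_ : NonZero p}} k rest {G} → sizes rest ≡ k * 3 + 0 → f₂ n ≡ p * 3 ^ k →
  (forest rest ≃ forest (replicate k cherry) → Extremalᶠ n G) → Verdict n G (p * ∏φ rest)
tight {n} p k rest B≡ f≡ ext with all-P₃-max rest k (trans B≡ (+-identityʳ _)) | m≤n⇒m<n∨m≡n (p₃-bound)
  where
  p₃-bound : ∏φ rest ≤ 3 ^ k
  p₃-bound = *-cancelˡ-≤ 9 (≤-trans (forest≤ε rest) (≤-reflexive (trans (cong ε B≡) (trans (ε-at k 0) (*-comm (3 ^ k) 9)))))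
... | inj₁ lt | _       = inj₁ (subst (p * ∏φ rest <_) (sym f≡) (*-monoʳ-< p lt))
... | inj₂ _  | inj₁ lt = inj₁ (subst (p * ∏φ rest <_) (sym f≡) (*-monoʳ-< p lt))
... | inj₂ i  | inj₂ e  = inj₂ (trans (cong (p *_) e) (sym f≡) , ext i)

block : ∀ a p n rest G → n ≡ a + sizes rest → 7 ≤ n →
  (∀ j r → r < 3 → sizes rest ≡ j * 3 + r → 7 ≤ a + (j * 3 + r) → Verdict (a + (j * 3 + r)) G (p * ∏φ rest)) → Verdict n G (p * ∏φ rest)
block a p n rest G n≡ 7≤n f with residue (sizes rest)
... | res j r r<3 eq = subst (λ m → Verdict m G (p * ∏φ rest)) (sym n≡') (f j r r<3 eq (subst (7 ≤_) n≡' 7≤n))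
  where
  n≡' : n ≡ a + (j * 3 + r)
  n≡' = trans n≡ (cong (a +_) eq)

f₂-7′ : ∀ {n} k → n ≡ k * 3 + 7 → f₂ n ≡ 11 * 3 ^ k
f₂-7′ k refl = f₂-7 k

f₂-8′ : ∀ {n} k → n ≡ k * 3 + 8 → f₂ n ≡ 15 * 3 ^ k
f₂-8′ k refl = f₂-8 k

f₂-12′ : ∀ {n} k → n ≡ k * 3 + 12 → f₂ n ≡ 64 * 3 ^ k
f₂-12′ k refl = f₂-12 k

regroup : ∀ {a b} j r → a + r ≡ b → a + (j * 3 + r) ≡ j * 3 + b
regroup {a} j r refl = lemma (j * 3) a r
  where
  lemma : ∀ j a r → a + (j + r) ≡ j + (a + r)
  lemma = solve-∀

quad-block : ∀ n rest → n ≡ 5 + sizes rest → 7 ≤ n → Verdict n (forest (quad ∷ rest)) (5 * ∏φ rest)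
quad-block n rest n≡ 7≤n = block 5 5 n rest _ n≡ 7≤n go
  where
  go : ∀ j r → r < 3 → sizes rest ≡ j * 3 + r → 7 ≤ 5 + (j * 3 + r) → Verdict (5 + (j * 3 + r)) (forest (quad ∷ rest)) (5 * ∏φ rest)
  go zero 0 _ B≡ h = ⊥-elim (<⇒≱ {5} {7} (decide {6} {7} _) h)
  go (suc k) 0 _ B≡ h = tight 5 (suc k) rest B≡ (trans (f₂-8′ k (regroup {8} k 0 refl)) (lemma (3 ^ k)))
      (λ i → inj₂ (inj₁ (k , regroup {8} k 0 refl , inj₂ (⊎ᵍ-cong ≃-refl i))))
    where
    lemma : ∀ x → 15 * x ≡ 5 * (3 * x)
    lemma = solve-∀
  go zero 1 _ B≡ h = ⊥-elim (<⇒≱ {6} {7} ≤-refl h)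
  -- Order 9 is too small for three claws; `5 * 4 = 20` is the value of `f₂` there.
  go (suc zero) 1 _ B≡ h with order-4-max rest B≡ | m≤n⇒m<n∨m≡n 4-bound
    where
    4-bound : ∏φ rest ≤ 4
    4-bound = *-cancelˡ-≤ 9 (≤-trans (forest≤ε rest) (≤-reflexive (cong ε B≡)))
  ... | inj₁ lt | _       = inj₁ (*-monoʳ-< 5 lt)
  ... | inj₂ _  | inj₁ lt = inj₁ (*-monoʳ-< 5 lt)
  ... | inj₂ i  | inj₂ e  = inj₂ (cong (5 *_) e , inj₂ (inj₂ (inj₁ (refl , ⊎ᵍ-cong ≃-refl i))))
  go (suc (suc k)) 1 _ B≡ h = inj₁ (strict {5 + ((suc (suc k)) * 3 + 1)} {64} 2 k 5 1 rest B≡ (f₂-12′ k (regroup {11} k 1 refl)) _)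
  go j 2 _ B≡ h = inj₁ (strict {5 + (j * 3 + 2)} {11} 0 j 5 2 rest B≡ (f₂-7′ j (regroup {5} j 2 refl)) _)
  go j (suc (suc (suc r))) lt _ _ = ⊥-elim (3≰2 lt)

T₇-block : ∀ n rest → n ≡ 7 + sizes rest → 7 ≤ n → Verdict n (forest (spider 2 ∷ rest)) (11 * ∏φ rest)
T₇-block n rest n≡ 7≤n = block 7 11 n rest _ n≡ 7≤n go
  where
  go : ∀ j r → r < 3 → sizes rest ≡ j * 3 + r → 7 ≤ 7 + (j * 3 + r) → Verdict (7 + (j * 3 + r)) (forest (spider 2 ∷ rest)) (11 * ∏φ rest)
  go j 0 _ B≡ h = tight 11 j rest B≡ (f₂-7′ j (regroup {7} j 0 refl)) (λ i → inj₁ (j , regroup {7} j 0 refl , ⊎ᵍ-cong ≃-refl i))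
  go j 1 _ B≡ h = inj₁ (strict {7 + (j * 3 + 1)} {15} 0 j 11 1 rest B≡ (f₂-8′ j (regroup {7} j 1 refl)) _)
  go zero 2 _ B≡ h = inj₁ (strict {7 + (zero * 3 + 2)} {20} 0 0 11 2 rest B≡ refl _)
  go (suc k) 2 _ B≡ h = inj₁ (strict {7 + ((suc k) * 3 + 2)} {64} 1 k 11 2 rest B≡ (f₂-12′ k (regroup {10} k 2 refl)) _)
  go j (suc (suc (suc r))) lt _ _ = ⊥-elim (3≰2 lt)

T₈-block : ∀ n rest → n ≡ 8 + sizes rest → 7 ≤ n → Verdict n (forest (dumbbell ∷ rest)) (15 * ∏φ rest)
T₈-block n rest n≡ 7≤n = block 8 15 n rest _ n≡ 7≤n go
  where
  go : ∀ j r → r < 3 → sizes rest ≡ j * 3 + r → 7 ≤ 8 + (j * 3 + r) → Verdict (8 + (j * 3 + r)) (forest (dumbbell ∷ rest)) (15 * ∏φ rest)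
  go j 0 _ B≡ h = tight 15 j rest B≡ (f₂-8′ j (regroup {8} j 0 refl)) (λ i → inj₂ (inj₁ (j , regroup {8} j 0 refl , inj₁ (⊎ᵍ-cong ≃-refl i))))
  -- The estimate by `ε 1 = 12` would give `15 * 12 = 9 * 20` without strictness; integrality
  -- sharpens `9 * ∏φ rest ≤ 12` to `∏φ rest ≤ 1`.
  go zero 1 _ B≡ h = inj₁ (≤-<-trans (*-monoʳ-≤ 15 bound) (decide {16} {20} _))
    where
    bound : ∏φ rest ≤ 1
    bound = s≤s⁻¹ (*-cancelˡ-< 9 (∏φ rest) 2 (≤-<-trans (forest≤ε rest) (≤-<-trans (≤-reflexive (cong ε B≡)) (decide {13} {18} _))))
  go (suc k) 1 _ B≡ h = inj₁ (strict {8 + ((suc k) * 3 + 1)} {64} 1 k 15 1 rest B≡ (f₂-12′ k (regroup {11} k 1 refl)) _)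
  go j 2 _ B≡ h = inj₁ (strict {8 + (j * 3 + 2)} {33} 0 j 15 2 rest B≡ (trans (f₂-7′ (suc j) (trans (regroup {8} j 2 refl) (lemma₀ (j * 3)))) (lemma (3 ^ j))) _)
    where
    lemma₀ : ∀ j → j + 10 ≡ 3 + j + 7
    lemma₀ = solve-∀
    lemma : ∀ x → 11 * (3 * x) ≡ 33 * x
    lemma = solve-∀
  go j (suc (suc (suc r))) lt _ _ = ⊥-elim (3≰2 lt)

claws-block : ∀ n rest → n ≡ 12 + sizes rest → 7 ≤ n →
  Verdict n (forest (spider 1 ∷ spider 1 ∷ spider 1 ∷ rest)) (64 * ∏φ rest)
claws-block n rest n≡ 7≤n = block 12 64 n rest _ n≡ 7≤n go
  where
  G = forest (spider 1 ∷ spider 1 ∷ spider 1 ∷ rest)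
  go : ∀ j r → r < 3 → sizes rest ≡ j * 3 + r → 7 ≤ 12 + (j * 3 + r) → Verdict (12 + (j * 3 + r)) G (64 * ∏φ rest)
  go j 0 _ B≡ h = tight 64 j rest B≡ (f₂-12′ j (regroup {12} j 0 refl))
    (λ i → inj₂ (inj₂ (inj₂ (j , regroup {12} j 0 refl , ⊎ᵍ-cong ≃-refl (⊎ᵍ-cong ≃-refl (⊎ᵍ-cong ≃-refl i))))))
  go j 1 _ B≡ h = inj₁ (strict {12 + (j * 3 + 1)} {99} 0 j 64 1 rest B≡ (trans (f₂-7′ (2 + j) (trans (regroup {12} j 1 refl) (lemma₀ (j * 3)))) (lemma (3 ^ j))) _)
    where
    lemma₀ : ∀ j → j + 13 ≡ 6 + j + 7
    lemma₀ = solve-∀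
    lemma : ∀ x → 11 * (3 * (3 * x)) ≡ 99 * x
    lemma = solve-∀
  go j 2 _ B≡ h = inj₁ (strict {12 + (j * 3 + 2)} {135} 0 j 64 2 rest B≡ (trans (f₂-8′ (2 + j) (trans (regroup {12} j 2 refl) (lemma₀ (j * 3)))) (lemma (3 ^ j))) _)
    where
    lemma₀ : ∀ j → j + 14 ≡ 6 + j + 8
    lemma₀ = solve-∀
    lemma : ∀ x → 15 * (3 * (3 * x)) ≡ 135 * x
    lemma = solve-∀
  go j (suc (suc (suc r))) lt _ _ = ⊥-elim (3≰2 lt)

extremal-≃ : ∀ {n G H} → G ≃ H → Extremalᶠ n H → Extremalᶠ n G
extremal-≃ g (inj₁ (k , e , i))                      = inj₁ (k , e , ≃-trans g i)
extremal-≃ g (inj₂ (inj₁ (k , e , inj₁ i)))          = inj₂ (inj₁ (k , e , inj₁ (≃-trans g i)))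
extremal-≃ g (inj₂ (inj₁ (k , e , inj₂ i)))          = inj₂ (inj₁ (k , e , inj₂ (≃-trans g i)))
extremal-≃ g (inj₂ (inj₂ (inj₁ (e , i))))            = inj₂ (inj₂ (inj₁ (e , ≃-trans g i)))
extremal-≃ g (inj₂ (inj₂ (inj₂ (k , e , i))))        = inj₂ (inj₂ (inj₂ (k , e , ≃-trans g i)))

verdict-≃ : ∀ {n G H m m'} → G ≃ H → m ≡ m' → Verdict n H m' → Verdict n G m
verdict-≃ g refl (inj₁ lt)      = inj₁ lt
verdict-≃ g refl (inj₂ (e , x)) = inj₂ (e , extremal-≃ g x)

-- The components whose presence alone settles the verdict. `K₁,₃` is set apart: forests attaining
-- `f₁` contain up to two of them, and only a third one costs.
data Rich (t : RT) : Set where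
  k₁₄ : t ≈ quad → Rich t
  t₇  : t ≈ spider 2 → Rich t
  t₈  : t ≈ dumbbell → Rich t
  poor : 27 * φ t < ω (size t) → Rich t

Plain : RT → Set
Plain t = t ≈ cherry ⊎ t ≈ spider 1

plain-or-rich : ∀ t → Plain t ⊎ Rich t
plain-or-rich t with kind t
... | isP₃ i  = inj₁ (inj₁ i)
... | isK₁₃ i = inj₁ (inj₂ i)
... | isK₁₄ i = inj₂ (k₁₄ i)
... | isT₇ i  = inj₂ (t₇ i)
... | isT₈ i  = inj₂ (t₈ i)
... | light h = inj₂ (poor h)

rich-verdict : ∀ ts t rest → ts ↭ t ∷ rest → Rich t → 7 ≤ sizes ts → Verdict (sizes ts) (forest ts) (∏φ ts)
rich-verdict ts t rest h q 7≤ = go q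
  where
  n = sizes ts
  order : n ≡ size t + sizes rest
  order = sizes-↭ h
  at : ∀ τ → t ≈ τ → (n ≡ size τ + sizes rest → 7 ≤ n → Verdict n (forest (τ ∷ rest)) (φ τ * ∏φ rest)) → Verdict n (forest ts) (∏φ ts)
  at τ e v = verdict-≃ (≃-trans (forest-↭ h) (⊎ᵍ-cong e ≃-refl)) (trans (∏φ-↭ h) (cong (_* ∏φ rest) (proj₁ (invariants {t} {τ} e))))
    (v (trans order (cong (_+ sizes rest) (proj₂ (invariants {t} {τ} e)))) 7≤)
  go : Rich t → Verdict n (forest ts) (∏φ ts)
  go (k₁₄ e)  = at quad e (quad-block n rest)
  go (t₇ e)   = at (spider 2) e (T₇-block n rest)
  go (t₈ e)   = at dumbbell e (T₈-block n rest)
  go (poor l) = inj₁ (*-cancelˡ-< 243 _ _ (≤-<-trans (≤-reflexive (cong (243 *_) (∏φ-↭ h)))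
    (<-≤-trans (light-forest t rest l) (≤-trans (≤-reflexive (cong η (sym order))) (η≤243f₂ n 7≤)))))

-- Excludes copies of `P₃` with none, one or two `K₁,₃`, where `(p, a)` is `(1, 0)`, `(4, 4)` or
-- `(16, 8)`: such a forest attains `f₁`.
maximal : ∀ {ts} → 7 ≤ sizes ts → ∏φ ts < f₁ (sizes ts) → ∀ p a l → 9 * p ≡ ε a → ∏φ ts ≡ p * 3 ^ l → sizes ts ≡ a + l * 3 → ⊥
maximal {ts} 7≤ lt p a l p≡ ∏≡ s≡ = <⇒≢ (*-monoʳ-< 9 lt) (begin
  9 * ∏φ ts         ≡⟨ trans (cong (9 *_) ∏≡) (sym (*-assoc 9 p (3 ^ l))) ⟩
  9 * p * 3 ^ l     ≡⟨ trans (cong (_* 3 ^ l) p≡) (*-comm (ε a) (3 ^ l)) ⟩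
  3 ^ l * ε a       ≡⟨ sym (ε-at l a) ⟩
  ε (l * 3 + a)     ≡⟨ cong ε (trans (+-comm (l * 3) a) (sym s≡)) ⟩
  ε (sizes ts)      ≡⟨ sym (9f₁≡ε (sizes ts) 7≤) ⟩
  9 * f₁ (sizes ts) ∎)
  where open ≡-Reasoning

forest-verdict : ∀ ts → 7 ≤ sizes ts → ∏φ ts < f₁ (sizes ts) → Verdict (sizes ts) (forest ts) (∏φ ts)
forest-verdict ts 7≤ lt with pick (All.universal plain-or-rich ts)
... | inj₂ (t , rest , h , q) = rich-verdict ts t rest h q 7≤
... | inj₁ ps with pick ps
...   | inj₁ cs = ⊥-elim (maximal {ts} 7≤ lt 1 0 (length ts) refl (trans (proj₁ (P₃s cs)) (sym (*-identityˡ _))) (proj₁ (proj₂ (P₃s cs))))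
...   | inj₂ (c₁ , r₁ , h₁ , e₁) with pick (All.tail (All-resp-↭ h₁ ps))
...     | inj₁ cs = ⊥-elim (maximal {ts} 7≤ lt 4 4 (length r₁) refl
            (trans (∏φ-↭ h₁) (cong₂ _*_ (proj₁ (invariants {c₁} {spider 1} e₁)) (proj₁ (P₃s cs))))
            (trans (sizes-↭ h₁) (cong₂ _+_ (proj₂ (invariants {c₁} {spider 1} e₁)) (proj₁ (proj₂ (P₃s cs))))))
...     | inj₂ (c₂ , r₂ , h₂ , e₂) with pick (All.tail (All-resp-↭ h₂ (All.tail (All-resp-↭ h₁ ps))))
...       | inj₁ cs = ⊥-elim (maximal {ts} 7≤ lt 16 8 (length r₂) refl
            (trans (∏φ-↭ h₁) (trans (cong₂ _*_ (proj₁ (invariants {c₁} {spider 1} e₁)) (trans (∏φ-↭ h₂)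
              (cong₂ _*_ (proj₁ (invariants {c₂} {spider 1} e₂)) (proj₁ (P₃s cs))))) (sym (*-assoc 4 4 (3 ^ length r₂)))))
            (trans (sizes-↭ h₁) (cong₂ _+_ (proj₂ (invariants {c₁} {spider 1} e₁)) (trans (sizes-↭ h₂)
              (cong₂ _+_ (proj₂ (invariants {c₂} {spider 1} e₂)) (proj₁ (proj₂ (P₃s cs))))))))
...       | inj₂ (c₃ , r₃ , h₃ , e₃) = verdict-≃
    (≃-trans (forest-↭ h₁) (⊎ᵍ-cong e₁ (≃-trans (forest-↭ h₂) (⊎ᵍ-cong e₂ (≃-trans (forest-↭ h₃) (⊎ᵍ-cong e₃ ≃-refl))))))
    (trans (∏φ-↭ h₁) (trans (cong₂ _*_ (proj₁ (invariants {c₁} {spider 1} e₁)) (trans (∏φ-↭ h₂) (cong₂ _*_ (proj₁ (invariants {c₂} {spider 1} e₂))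
      (trans (∏φ-↭ h₃) (cong (_* ∏φ r₃) (proj₁ (invariants {c₃} {spider 1} e₃))))))) (lemma (∏φ r₃))))
    (claws-block (sizes ts) r₃ (trans (sizes-↭ h₁) (cong₂ _+_ (proj₂ (invariants {c₁} {spider 1} e₁)) (trans (sizes-↭ h₂)
      (cong₂ _+_ (proj₂ (invariants {c₂} {spider 1} e₂)) (trans (sizes-↭ h₃) (cong (_+ sizes r₃) (proj₂ (invariants {c₃} {spider 1} e₃)))))))) 7≤)
  where
  lemma : ∀ x → 4 * (4 * (4 * x)) ≡ 64 * x
  lemma = solve-∀

-- Among the orders 4 to 6 this is the one with a gap: `f₂` is `f₁ - 1` at orders 4 and 5, but falls
-- from 9 to 6 here.
forest-of-order-6 : ∀ ts → sizes ts ≡ 6 → ∏φ ts < 9 → ∏φ ts ≤ 6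
forest-of-order-6 ts eq lt with pick (All.universal p₃-or-not ts)
... | inj₁ ps = ⊥-elim (<⇒≢ lt (trans (proj₁ (P₃s ps)) (cong (3 ^_) (*-cancelʳ-≡ (length ts) 2 3 (trans (sym (proj₁ (proj₂ (P₃s ps)))) eq)))))
... | inj₂ (t , rest , h , q) = subst (_≤ 6) (sym (∏φ-↭ h)) (go q)
  where
  order : size t + sizes rest ≡ 6
  order = trans (sym (sizes-↭ h)) eq
  tooBig : ∀ τ → t ≈ τ → 7 ≤ size τ → ⊥
  tooBig τ e b = <⇒≱ (≤-trans b (≤-trans (≤-reflexive (sym (proj₂ (invariants {t} {τ} e)))) (m≤m+n _ _))) (≤-reflexive order)
  at : ∀ τ → t ≈ τ → ∀ B b → size τ + B ≡ 6 → T (ε B <ᵇ 9 * suc b) → T (φ τ * b ≤ᵇ 6) → φ t * ∏φ rest ≤ 6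
  at τ e B b s≡ h₁ h₂ = ≤-trans (≤-reflexive (cong (_* ∏φ rest) (proj₁ (invariants {t} {τ} e)))) (≤-trans (*-monoʳ-≤ (φ τ) bound) (≤ᵇ⇒≤ (φ τ * b) 6 h₂))
    where
    B≡ : sizes rest ≡ B
    B≡ = +-cancelˡ-≡ (size τ) _ _ (trans (cong (_+ sizes rest) (sym (proj₂ (invariants {t} {τ} e)))) (trans order (sym s≡)))
    bound : ∏φ rest ≤ b
    bound = s≤s⁻¹ (*-cancelˡ-< 9 (∏φ rest) (suc b) (≤-<-trans (forest≤ε rest) (≤-<-trans (≤-reflexive (cong ε B≡)) (<ᵇ⇒< (ε B) (9 * suc b) h₁))))
  go : NotP₃ t → φ t * ∏φ rest ≤ 6
  go (k₁₃ e)  = at (spider 1) e 2 1 refl _ _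
  go (k₁₄ e)  = at quad e 1 1 refl _ _
  go (t₇ e)   = ⊥-elim (tooBig (spider 2) e ≤-refl)
  go (t₈ e)   = ⊥-elim (tooBig dumbbell e (decide {7} {8} _))
  go (poor l) = s≤s⁻¹ (*-cancelˡ-< 243 (φ t * ∏φ rest) 7 (<-≤-trans (light-forest t rest l) (≤-trans (≤-reflexive (cong η order)) (decide {1620} {1701} _))))

-- The extremal forests as graphs, and the theorem

forest-++ : ∀ ts us → forest ts ⊎ᵍ forest us ≃ forest (ts ++ us)
forest-++ []       us = ≃-trans (⊎ᵍ-comm empty (forest us)) (⊎ᵍ-empty (forest us))
forest-++ (t ∷ ts) us = ≃-trans (⊎ᵍ-assoc (gr t) (forest ts) (forest us)) (⊎ᵍ-cong ≃-refl (forest-++ ts us))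

P₃s-⊕ : ∀ k {m} {H : Graph m} τ → ⟦ H ⟧ ≃ gr τ → ⟦ copies k P₃ ⊕ H ⟧ ≃ forest (τ ∷ replicate k cherry)
P₃s-⊕ k {H = H} τ i = ≃-trans (⊕≃ (copies k P₃) H) (≃-trans (⊎ᵍ-comm ⟦ copies k P₃ ⟧ ⟦ H ⟧) (⊎ᵍ-cong i (copies≃ {G = P₃} {cherry} k P₃≃)))

T₇-forest : ∀ k → ⟦ copies k P₃ ⊕ T* 2 ⟧ ≃ forest (spider 2 ∷ replicate k cherry)
T₇-forest k = P₃s-⊕ k {H = T* 2} (spider 2) (T*≃ 2)

T₈-forest : ∀ k → ⟦ copies k P₃ ⊕ T*₈ ⟧ ≃ forest (dumbbell ∷ replicate k cherry)
T₈-forest k = P₃s-⊕ k {H = T*₈} dumbbell T*₈≃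

K₁₄-forest : ∀ k → ⟦ copies k P₃ ⊕ K₁ 4 ⟧ ≃ forest (quad ∷ replicate k cherry)
K₁₄-forest k = P₃s-⊕ k {H = K₁ 4} quad K₁₄≃

K₁₃-K₁₄-forest : ⟦ K₁ 3 ⊕ K₁ 4 ⟧ ≃ forest (quad ∷ spider 1 ∷ [])
K₁₃-K₁₄-forest = ≃-trans (⊕≃ (K₁ 3) (K₁ 4)) (≃-trans (⊎ᵍ-comm ⟦ K₁ 3 ⟧ ⟦ K₁ 4 ⟧) (⊎ᵍ-cong K₁₄≃ (≃-trans K₁₃≃ (≃-sym (single (spider 1))))))

3K₁₃-forest : ∀ k → ⟦ copies k P₃ ⊕ copies 3 (K₁ 3) ⟧ ≃ forest (spider 1 ∷ spider 1 ∷ spider 1 ∷ replicate k cherry)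
3K₁₃-forest k = ≃-trans (⊕≃ (copies k P₃) (copies 3 (K₁ 3))) (≃-trans (⊎ᵍ-comm ⟦ copies k P₃ ⟧ ⟦ copies 3 (K₁ 3) ⟧)
  (≃-trans (⊎ᵍ-cong (copies≃ {G = K₁ 3} {spider 1} 3 K₁₃≃) (copies≃ {G = P₃} {cherry} k P₃≃))
           (forest-++ (replicate 3 (spider 1)) (replicate k cherry))))

module _ {n} (F : Graph n) where
  private
    iso⇒≅ : ∀ {m} (H : Graph m) {G} → ⟦ F ⟧ ≃ G → ⟦ H ⟧ ≃ G → F ≅ H
    iso⇒≅ H i j = ≃⇒≅ {G = F} {H} (≃-trans i (≃-sym j))

  extremalᶠ⇒ : Extremalᶠ n ⟦ F ⟧ → Extremal F
  extremalᶠ⇒ (inj₁ (k , e , i))               = inj₁ (k , e , iso⇒≅ (copies k P₃ ⊕ T* 2) i (T₇-forest k))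
  extremalᶠ⇒ (inj₂ (inj₁ (k , e , inj₁ i)))   = inj₂ (inj₁ (k , e , inj₁ (iso⇒≅ (copies k P₃ ⊕ T*₈) i (T₈-forest k))))
  extremalᶠ⇒ (inj₂ (inj₁ (k , e , inj₂ i)))   = inj₂ (inj₁ (k , e , inj₂ (iso⇒≅ (copies (suc k) P₃ ⊕ K₁ 4) i (K₁₄-forest (suc k)))))
  extremalᶠ⇒ (inj₂ (inj₂ (inj₁ (e , i))))     = inj₂ (inj₂ (inj₁ (e , iso⇒≅ (K₁ 3 ⊕ K₁ 4) i K₁₃-K₁₄-forest)))
  extremalᶠ⇒ (inj₂ (inj₂ (inj₂ (k , e , i)))) = inj₂ (inj₂ (inj₂ (k , e , iso⇒≅ (copies k P₃ ⊕ copies 3 (K₁ 3)) i (3K₁₃-forest k))))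

∏φ-P₃s : ∀ k → ∏φ (replicate k cherry) ≡ 3 ^ k
∏φ-P₃s zero    = refl
∏φ-P₃s (suc k) = cong (3 *_) (∏φ-P₃s k)

extremal⇒Φ≡f₂ : ∀ {n} (F : Graph n) → Extremal F → Φ F ≡ f₂ n
extremal⇒Φ≡f₂ {n} F = go
  where
  via : ∀ {m} (H : Graph m) ts → F ≅ H → ⟦ H ⟧ ≃ forest ts → Φ F ≡ ∏φ ts
  via H ts i j = Φ≡∏φ F ts (≃-trans (≅⇒≃ {G = F} {H} i) j)
  lemma : ∀ x → 5 * (3 * x) ≡ 15 * x
  lemma = solve-∀
  lemma' : ∀ x → 4 * (4 * (4 * x)) ≡ 64 * x
  lemma' = solve-∀
  go : Extremal F → Φ F ≡ f₂ n
  go (inj₁ (k , e , i)) =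
    trans (via (copies k P₃ ⊕ T* 2) (spider 2 ∷ replicate k cherry) i (T₇-forest k)) (trans (cong (11 *_) (∏φ-P₃s k)) (sym (f₂-7′ k e)))
  go (inj₂ (inj₁ (k , e , inj₁ i))) =
    trans (via (copies k P₃ ⊕ T*₈) (dumbbell ∷ replicate k cherry) i (T₈-forest k)) (trans (cong (15 *_) (∏φ-P₃s k)) (sym (f₂-8′ k e)))
  go (inj₂ (inj₁ (k , e , inj₂ i))) =
    trans (via (copies (suc k) P₃ ⊕ K₁ 4) (quad ∷ replicate (suc k) cherry) i (K₁₄-forest (suc k)))
          (trans (cong (5 *_) (∏φ-P₃s (suc k))) (trans (lemma (3 ^ k)) (sym (f₂-8′ k e))))
  go (inj₂ (inj₂ (inj₁ (e , i)))) = trans (via (K₁ 3 ⊕ K₁ 4) (quad ∷ spider 1 ∷ []) i K₁₃-K₁₄-forest) (sym (cong f₂ e))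
  go (inj₂ (inj₂ (inj₂ (k , e , i)))) =
    trans (via (copies k P₃ ⊕ copies 3 (K₁ 3)) (spider 1 ∷ spider 1 ∷ spider 1 ∷ replicate k cherry) i (3K₁₃-forest k))
          (trans (trans (cong (λ x → 4 * (4 * (4 * x))) (∏φ-P₃s k)) (lemma' (3 ^ k))) (sym (f₂-12′ k e)))

tree≃ : ∀ {n} (T : Graph n) → 1 ≤ n → Tree T → ∃ λ t → ⟦ T ⟧ ≃ gr t
tree≃ T 1≤n (conn , acyclic) with decompose _ T acyclic
... | []         , i = ⊥-elim (<⇒≢ 1≤n (sym (order≡sizes T [] i)))
... | t ∷ []     , i = t , ≃-trans i (single t)
... | _ ∷ _ ∷ _  , i = ⊥-elim (connected⇒single T conn i)

≡t-spider : ∀ {m n} k → m ≡ 3 ^ k + k → n ≡ k * 3 + 1 → m ≡t n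
≡t-spider k refl refl = begin
  (3 * (3 ^ k + k) ∸ (k * 3 + 1 ∸ 1)) ^ 3   ≡⟨ cong (_^ 3) (cong₂ _∸_ (lemma (3 ^ k) k) (m+n∸n≡m (k * 3) 1)) ⟩
  (3 * 3 ^ k + k * 3 ∸ k * 3) ^ 3           ≡⟨ cong (_^ 3) (m+n∸n≡m (3 * 3 ^ k) (k * 3)) ⟩
  (3 ^ suc k) ^ 3                           ≡⟨ ^-*-assoc 3 (suc k) 3 ⟩
  3 ^ (3 + k * 3)                           ≡⟨ cong (3 ^_) (lemma' (k * 3)) ⟩
  3 ^ (k * 3 + 1 + 2)                       ∎
  where
  open ≡-Reasoning
  lemma : ∀ x k → 3 * (x + k) ≡ 3 * x + k * 3
  lemma = solve-∀
  lemma' : ∀ k → 3 + k ≡ k + 1 + 2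
  lemma' = solve-∀

rooted-tree-bound : ∀ n (T : Graph n) t → ⟦ T ⟧ ≃ gr t → 4 ≤ n → Φ T ≤t n × (Φ T ≡t n ⇔ (∃ λ k → n ≡ k * 3 + 1 × T ≅ T* k))
rooted-tree-bound n T t i 4≤n = upper bound , mk⇔ (extremal bound) attained
  where
  order : n ≡ size t
  order = order≡size T t i
  bound : Below (Φ T) n ⊎ IsSpider t
  bound = subst₂ (λ m k → Below m k ⊎ IsSpider t) (sym (Φ≡φ T t i)) (sym order) (tree-bound t (≤-trans 4≤n (≤-reflexive order)))
  attained : (∃ λ k → n ≡ k * 3 + 1 × T ≅ T* k) → Φ T ≡t n
  attained (k , e , j) = ≡t-spider k (trans (Φ≡φ T (spider k) (≃-trans (≅⇒≃ {G = T} {T* k} j) (T*≃ k))) (φ-spider k)) e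
  spider⇒ : IsSpider t → ∃ λ k → n ≡ k * 3 + 1 × T ≅ T* k
  spider⇒ (k , e , j) = k , trans order e , ≃⇒≅ {G = T} {T* k} (≃-trans i (≃-trans j (≃-sym (T*≃ k))))
  upper : Below (Φ T) n ⊎ IsSpider t → Φ T ≤t n
  upper (inj₁ lt) = <⇒≤ lt
  upper (inj₂ sp) = ≤-reflexive (attained (spider⇒ sp))
  extremal : Below (Φ T) n ⊎ IsSpider t → Φ T ≡t n → ∃ λ k → n ≡ k * 3 + 1 × T ≅ T* k
  extremal (inj₁ lt) e = ⊥-elim (<⇒≢ lt e)
  extremal (inj₂ sp) _ = spider⇒ sp

tree-theorem : ∀ n (T : Graph n) → 4 ≤ n → Tree T → Φ T ≤t n × (Φ T ≡t n ⇔ (∃ λ k → n ≡ k * 3 + 1 × T ≅ T* k))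
tree-theorem n T 4≤n tree = let t , i = tree≃ T (≤-trans (s≤s z≤n) 4≤n) tree in rooted-tree-bound n T t i 4≤n

small-forest-theorem : ∀ n (F : Graph n) → Forest F → 4 ≤ n → n ≤ 6 → Φ F < f₁ n → Φ F ≤ f₂ n
small-forest-theorem n F acyclic 4≤n n≤6 lt = by-order n (Φ F) 4≤n n≤6 order-6 lt
  where
  ts = proj₁ (decompose n F acyclic)
  i = proj₂ (decompose n F acyclic)
  order-6 : n ≡ 6 → Φ F < 9 → Φ F ≤ 6
  order-6 e h = subst (_≤ 6) (sym (Φ≡∏φ F ts i)) (forest-of-order-6 ts (trans (sym (order≡sizes F ts i)) e) (subst (_< 9) (Φ≡∏φ F ts i) h))
  by-order : ∀ n m → 4 ≤ n → n ≤ 6 → (n ≡ 6 → m < 9 → m ≤ 6) → m < f₁ n → m ≤ f₂ n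
  by-order 4 m _ _ _ lt = s≤s⁻¹ lt
  by-order 5 m _ _ _ lt = s≤s⁻¹ lt
  by-order 6 m _ _ h lt = h refl lt
  by-order 0 m ()
  by-order 1 m (s≤s ())
  by-order 2 m (s≤s (s≤s ()))
  by-order 3 m (s≤s (s≤s (s≤s ())))
  by-order (suc (suc (suc (suc (suc (suc (suc n))))))) m _ h =
    ⊥-elim (<⇒≱ (s≤s (s≤s (s≤s (s≤s (s≤s (s≤s (s≤s z≤n))))))) h)

forest-theorem : ∀ n (F : Graph n) → Forest F → 7 ≤ n → Φ F < f₁ n → Φ F ≤ f₂ n × (Φ F ≡ f₂ n ⇔ Extremal F)
forest-theorem n F acyclic 7≤n lt = upper verdict , mk⇔ (extremal verdict) (extremal⇒Φ≡f₂ F)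
  where
  ts = proj₁ (decompose n F acyclic)
  i = proj₂ (decompose n F acyclic)
  order : sizes ts ≡ n
  order = sym (order≡sizes F ts i)
  Φ≡ = Φ≡∏φ F ts i
  verdict : Verdict n ⟦ F ⟧ (Φ F)
  verdict = verdict-≃ i Φ≡ (subst (λ m → Verdict m (forest ts) (∏φ ts)) order
    (forest-verdict ts (subst (7 ≤_) (sym order) 7≤n) (subst₂ (λ m k → m < f₁ k) Φ≡ (sym order) lt)))
  upper : Verdict n ⟦ F ⟧ (Φ F) → Φ F ≤ f₂ n
  upper (inj₁ l)       = <⇒≤ l
  upper (inj₂ (e , _)) = ≤-reflexive e
  extremal : Verdict n ⟦ F ⟧ (Φ F) → Φ F ≡ f₂ n → Extremal F
  extremal (inj₁ l)       e = ⊥-elim (<⇒≢ l e)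
  extremal (inj₂ (_ , x)) _ = extremalᶠ⇒ F x

theorem2 : (∀ n (T : Graph n) → 4 ≤ n → Tree T →
    Φ T ≤t n × (Φ T ≡t n ⇔ (∃ λ k → n ≡ k * 3 + 1 × T ≅ T* k)))
    ×
    (∀ n (F : Graph n) → Forest F → 4 ≤ n → n ≤ 6 → Φ F < f₁ n → Φ F ≤ f₂ n)
    ×
    (∀ n (F : Graph n) → Forest F → 7 ≤ n → Φ F < f₁ n →
    Φ F ≤ f₂ n × (Φ F ≡ f₂ n ⇔ Extremal F))
theorem2 = tree-theorem , small-forest-theorem , forest-theorem
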